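{- Let $\mathcal{P}$ be a strongly monotone property of ordered hypergraphs. Suppose that for every constant $c > 0$ there exists $N = N(c) \in \mathbb{N}$ such that $|\mathcal{P}_N| > c^N$. Then $\mathcal{P}$ contains the ordered hypergraph $H(\pi)$ for every $k \in \mathbb{N}$ and every permutation $\pi$ of $[k]$, and hence $$|\mathcal{P}_n| \ge |\mathcal{P}^{(1,2)}_n| \ge \sum_{k=0}^{\lfloor n/2 \rfloor} \binom{n}{2k} k! = n^{n/2 + o(n)}$$ for every $n \in \mathbb{N}$. This lower bound is best possible, and there is a unique strongly monotone property of ordered hypergraphs with this speed, i.e. there is exactly one strongly monotone property $\mathcal{Q}$ of ordered hypergraphs with $|\mathcal{Q}_n| = \sum_{k=0}^{\lfloor n/2 \rfloor} \binom{n}{2k} k!$ for every $n \in \mathbb{N}$.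
   Context: An ordered hypergraph $\mathcal{H} = (V,E,<)$ consists of a finite set $V$ of vertices, a set $E \subset \{A : A \subset V, |A| \ge 2\}$ of edges (no repeated edges, no edges with fewer than two vertices), and a linear order $<$ on $V$. An ordered hypergraph $\mathcal{K} = (U,F,<)$ is a sub-hypergraph of $\mathcal{H} = (V,E,<)$ if $U \subset V$ (with the induced ordering) and $F \subset \{e \cap U : e \in E, |e \cap U| \ge 2\}$. An ordered hypergraph $\mathcal{K} = (U,F,<)$ is contained in $\mathcal{H}$ if there exists a sub-hypergraph $\mathcal{L} = (U,D,<)$ of $\mathcal{H}$ with $|D| = |F| = t$, say, and enumerations $D = \{d_1,\ldots,d_t\}$, $F = \{f_1,\ldots,f_t\}$ such that $f_i \subset d_i$ for each $i \in [t]$. A property of ordered hypergraphs is a collection of ordered hypergraphs closed under order-preserving isomorphisms of the vertex set. It is strongly monotone if it is closed under containment: whenever $\mathcal{H}$ is in it and $\mathcal{K}$ is contained in $\mathcal{H}$, then $\mathcal{K}$ is in it. $\mathcal{P}_n$ denotes the collection of distinct (i.e. non-isomorphic under order-preserving isomorphism) ordered hypergraphs on $n$ vertices in $\mathcal{P}$; the speed of $\mathcal{P}$ is the function $n \mapsto |\mathcal{P}_n|$. For $k,\ell \in \mathbb{N}\cup\{\infty\}$, $\mathcal{P}^{(k,\ell)}$ is the set of $G \in \mathcal{P}$ in which every vertex is contained in at most $k$ edges and every edge has size at most $\ell$. For a permutation $\pi$ of $[k] = \{1,\ldots,k\}$, $H(\pi)$ is the ordered hypergraph with vertex set $[2k]$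 (usual order) and edge set $\{\{i,\pi(i)+k\} : i \in [k]\}$. -}

module Defs where

open import Level using (Level; 0ℓ; _⊔_) renaming (suc to lsuc)
open import Data.Nat.Base using (ℕ; suc; _+_; _*_; _^_; _!; ⌊_/2⌋; _≤_; NonZero)
open import Data.Nat.Combinatorics using (_C_)
open import Data.Integer.Base as ℤ using ()
open import Data.Rational.Base as ℚ using (ℚ; 0ℚ)
open import Data.Fin.Base as Fin using (Fin; _↑ˡ_; _↑ʳ_)
open import Data.Fin.Properties as Fin using (≡-setoid)
open import Data.Fin.Permutation using (Permutation′; _⟨$⟩ʳ_)
open import Data.Fin.Subset using (Subset; ∣_∣; ⁅_⁆; _∪_; _⊆_) renaming (_∈_ to _∈ₛ_)
open import Data.Fin.Subset.Properties as Subset using (_∈?_)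
open import Data.Vec.Base as Vec using ()
open import Data.Vec.Properties as Vec using ()
open import Data.List.Base as List using (List; length; filter; map; upTo)
open import Data.Nat.ListAction using (sum)
open import Data.List.Membership.Propositional using (_∈_)
open import Data.List.Relation.Unary.All using (All)
open import Data.List.Relation.Unary.All.Properties as All using ()
open import Data.List.Relation.Unary.Unique.Propositional using (Unique)
open import Data.List.Relation.Unary.Unique.Propositional.Properties as Unique using ()
open import Data.List.Relation.Binary.Permutation.Propositional using (_↭_)
open import Data.List.Relation.Binary.Pointwise.Base using (Pointwise)
open import Data.Product.Base using (Σ; ∃-syntax; _×_; _,_; proj₁; proj₂)
open import Data.Sum.Base using (inj₁; inj₂)
open import Function.Base using (id; _∘_)
open import Function.Bundles using (Injection; Inverse; _⇔_; mk⇔; Equivalence)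
open import Relation.Nullary.Negation using (contradiction)
open import Relation.Unary using (Pred; _≐_)
open import Relation.Binary.Core using (Rel)
open import Relation.Binary.Bundles using (Setoid)
open import Relation.Binary.Structures using (IsStrictTotalOrder)
open import Relation.Binary.Morphism.Structures using (IsOrderMonomorphism; IsOrderIsomorphism)
import Relation.Binary.Morphism.Construct.Identity as Identity
import Relation.Binary.Morphism.Construct.Composition as Composition
open import Relation.Binary.PropositionalEquality
  using (_≡_; _≢_; refl; sym; trans; cong; subst; subst₂)
import Algebra.Definitions.RawSemiring as RawSemiringDefinitions

open RawSemiringDefinitions ℚ.+-*-rawSemiring using () renaming (_^_ to _^ℚ_)

private
  variable
    a b ℓ ℓ′ : Level
    m n : ℕ

-- The vertex set is Fin n, but the linear order is arbitrary: it need not be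
-- the usual order of Fin n.  The set of edges is a duplicate-free list.
record OrderedHypergraph (n : ℕ) : Set₁ where
  field
    _<_                : Rel (Fin n) 0ℓ
    isStrictTotalOrder : IsStrictTotalOrder _≡_ _<_
    edges              : List (Subset n)
    edges-unique       : Unique edges
    edges-size         : All (λ e → 2 ≤ ∣ e ∣) edges

open OrderedHypergraph using (edges)

-- For an injection ι this is e ∩ U, where U is the image of ι.
trace : (Fin m → Fin n) → Subset n → Subset m
trace ι e = Vec.tabulate (λ x → Vec.lookup e (ι x))

-- K is a sub-hypergraph of H.  The inclusion of U in V, with the induced
-- ordering, is an order embedding.  The requirement |e ∩ U| ≥ 2 on the traces
-- used is enforced by the edges of K having at least two vertices.
record SubHypergraph (K : OrderedHypergraph m) (H : OrderedHypergraph n) : Set where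
  private
    module K = OrderedHypergraph K
    module H = OrderedHypergraph H
  field
    ι                   : Fin m → Fin n
    isOrderMonomorphism : IsOrderMonomorphism _≡_ _≡_ K._<_ H._<_ ι
    isTrace             : ∀ {f} → f ∈ K.edges → ∃[ e ] e ∈ H.edges × f ≡ trace ι e

SameOrder : OrderedHypergraph n → OrderedHypergraph n → Set
SameOrder K L = ∀ x y → (x K.< y) ⇔ (x L.< y)
  where
  module K = OrderedHypergraph K
  module L = OrderedHypergraph L

infix 4 _⊑_ _≅_ _≐ᶜ_

-- K is contained in H.  Pointwise relates only lists of equal length, so it
-- includes |D| = |F|.
_⊑_ : OrderedHypergraph m → OrderedHypergraph n → Set₁
_⊑_ {m} K H =
  ∃[ L ] SameOrder K L × SubHypergraph L H ×
    ∃[ fs ] ∃[ ds ] fs ↭ edges K × ds ↭ edges L × Pointwise _⊆_ fs ds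

-- Order-preserving isomorphism.  For a bijection to, the edges of H
-- correspond to those of G when s ∈ E(H) ⇔ to⁻¹(s) ∈ E(G).
record _≅_ (G H : OrderedHypergraph n) : Set where
  private
    module G = OrderedHypergraph G
    module H = OrderedHypergraph H
  field
    to                 : Fin n → Fin n
    isOrderIsomorphism : IsOrderIsomorphism _≡_ _≡_ G._<_ H._<_ to
    preservesEdges     : ∀ s → (trace to s ∈ G.edges) ⇔ (s ∈ H.edges)

private
  trace-id : (s : Subset n) → trace id s ≡ s
  trace-id = Vec.tabulate∘lookup

  trace-∘ : ∀ {k} (f : Fin k → Fin m) (g : Fin m → Fin n) s →
            trace f (trace g s) ≡ trace (g ∘ f) s
  trace-∘ f g s = Vec.tabulate-cong (λ x → Vec.lookup∘tabulate _ (f x))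

  trace-inverse : (f : Fin m → Fin n) (g : Fin n → Fin m) → (∀ x → g (f x) ≡ x) →
                  ∀ s → trace f (trace g s) ≡ s
  trace-inverse f g g∘f s = trans (trace-∘ f g s)
    (trans (Vec.tabulate-cong (λ x → cong (Vec.lookup s) (g∘f x))) (trace-id s))

≅-refl : {G : OrderedHypergraph n} → G ≅ G
≅-refl {G = G} = record
  { to                 = id
  ; isOrderIsomorphism = Identity.isOrderIsomorphism _≡_ G._<_ refl
  ; preservesEdges     = λ s → mk⇔ (subst (_∈ edges G) (trace-id s))
                                   (subst (_∈ edges G) (sym (trace-id s)))
  }
  where module G = OrderedHypergraph G

≅-sym : {G H : OrderedHypergraph n} → G ≅ H → H ≅ G
≅-sym {n} {G} {H} i = record
  { to                 = from
  ; isOrderIsomorphism = record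
    { isOrderMonomorphism = record
      { isOrderHomomorphism = record
        { cong = cong from
        ; mono = λ {x} {y} x<y →
            I.cancel (subst₂ H._<_ (sym (to∘from x)) (sym (to∘from y)) x<y)
        }
      ; injective = λ {x} {y} eq →
          trans (sym (to∘from x)) (trans (cong to eq) (to∘from y))
      ; cancel    = λ {x} {y} x<y →
          subst₂ H._<_ (to∘from x) (to∘from y) (I.mono x<y)
      }
    ; surjective = λ x → to x , λ { refl → from∘to x }
    }
  ; preservesEdges     = λ s →
      mk⇔ (λ s∈ → subst (_∈ G.edges) (trace-inverse to from from∘to s)
                    (Equivalence.from (preservesEdges (trace from s)) s∈))
          (λ s∈ → Equivalence.to (preservesEdges (trace from s))
                    (subst (_∈ G.edges) (sym (trace-inverse to from from∘to s)) s∈))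
  }
  where
  module G = OrderedHypergraph G
  module H = OrderedHypergraph H
  open _≅_ i
  module I = IsOrderIsomorphism isOrderIsomorphism

  from : Fin n → Fin n
  from y = proj₁ (I.surjective y)

  to∘from : ∀ y → to (from y) ≡ y
  to∘from y = proj₂ (I.surjective y) refl

  from∘to : ∀ x → from (to x) ≡ x
  from∘to x = I.injective (to∘from (to x))

≅-trans : {G H K : OrderedHypergraph n} → G ≅ H → H ≅ K → G ≅ K
≅-trans {G = G} i j = record
  { to                 = j.to ∘ i.to
  ; isOrderIsomorphism =
      Composition.isOrderIsomorphism trans i.isOrderIsomorphism j.isOrderIsomorphism
  ; preservesEdges     = λ s →
      mk⇔ (λ s∈ → Equivalence.to (j.preservesEdges s)
                    (Equivalence.to (i.preservesEdges (trace j.to s))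
                      (subst (_∈ edges G) (sym (trace-∘ i.to j.to s)) s∈)))
          (λ s∈ → subst (_∈ edges G) (trace-∘ i.to j.to s)
                    (Equivalence.from (i.preservesEdges (trace j.to s))
                      (Equivalence.from (j.preservesEdges s) s∈)))
  }
  where
  module i = _≅_ i
  module j = _≅_ j

Class : ∀ ℓ → Set (lsuc 0ℓ ⊔ lsuc ℓ)
Class ℓ = ∀ n → Pred (OrderedHypergraph n) ℓ

_≐ᶜ_ : Class ℓ → Class ℓ → Set (lsuc 0ℓ ⊔ ℓ)
P ≐ᶜ Q = ∀ n → P n ≐ Q n

IsProperty : Class ℓ → Set (lsuc 0ℓ ⊔ ℓ)
IsProperty P = ∀ {n} {G H : OrderedHypergraph n} → G ≅ H → P n G → P n H

record StronglyMonotoneProperty (P : Class ℓ) : Set (lsuc 0ℓ ⊔ ℓ) where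
  field
    isProperty : IsProperty P
    ⊑-closed   : ∀ {m n} {K : OrderedHypergraph m} {H : OrderedHypergraph n} →
                 K ⊑ H → P n H → P m K

degree : OrderedHypergraph n → Fin n → ℕ
degree G v = length (filter (v ∈?_) (edges G))

-- P^(k,l), for finite k and l.
_⟨_,_⟩ : Class ℓ → ℕ → ℕ → Class ℓ
(P ⟨ k , l ⟩) n G =
  P n G × (∀ v → degree G v ≤ k) × All (λ e → ∣ e ∣ ≤ l) (edges G)

-- P_n: the members of P on n vertices, identified when isomorphic.
infix 30 _▹_
_▹_ : Class ℓ → ℕ → Setoid (lsuc 0ℓ ⊔ ℓ) 0ℓ
P ▹ n = record
  { Carrier       = Σ (OrderedHypergraph n) (P n)
  ; _≈_           = λ G H → proj₁ G ≅ proj₁ H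
  ; isEquivalence = record { refl = ≅-refl ; sym = ≅-sym ; trans = ≅-trans }
  }

-- Comparison of cardinalities, as sets modulo the setoid equality.  Membership
-- in a class need not be decidable, so |P_n| is not given by a numeral.
∣_∣≥∣_∣ : Setoid a ℓ → Setoid b ℓ′ → Set (a ⊔ b ⊔ ℓ ⊔ ℓ′)
∣ A ∣≥∣ B ∣ = Injection B A

∣_∣≥_ : Setoid a ℓ → ℕ → Set (a ⊔ ℓ)
∣ A ∣≥ m = ∣ A ∣≥∣ ≡-setoid m ∣

∣_∣≈_ : Setoid a ℓ → ℕ → Set (a ⊔ ℓ)
∣ A ∣≈ m = Inverse (≡-setoid m) A

-- For every c > 0 there is an N with |P_N| > c^N.  Only rational c are
-- required, which as a hypothesis is no stronger than requiring all real c.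
SuperExponential : Class ℓ → Set (lsuc 0ℓ ⊔ ℓ)
SuperExponential P = ∀ (c : ℚ) → 0ℚ ℚ.< c →
  ∃[ N ] ∃[ m ] c ^ℚ N ℚ.< ℤ.+ m ℚ./ 1 × ∣ P ▹ N ∣≥ m

private
  left≢right : ∀ {k} (i j : Fin k) → i ↑ˡ k ≢ k ↑ʳ j
  left≢right {k} i j eq
    with trans (sym (Fin.splitAt-↑ˡ k i k)) (trans (cong (Fin.splitAt k) eq) (Fin.splitAt-↑ʳ k k j))
  ... | ()

  2≤∣pair∣ : {x y : Fin n} → x ≢ y → 2 ≤ ∣ ⁅ x ⁆ ∪ ⁅ y ⁆ ∣
  2≤∣pair∣ {x = x} {y} x≢y = subst (λ s → suc s ≤ ∣ ⁅ x ⁆ ∪ ⁅ y ⁆ ∣) (Subset.∣⁅x⁆∣≡1 x)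
    (Subset.p⊂q⇒∣p∣<∣q∣
      ( Subset.p⊆p∪q ⁅ y ⁆
      , y , Subset.x∈p∪q⁺ (inj₂ (Subset.x∈⁅x⁆ y))
      , λ y∈ → x≢y (sym (Subset.x∈⁅y⁆⇒x≡y x y∈))))

matchingEdge : ∀ {k} → Permutation′ k → Fin k → Subset (k + k)
matchingEdge {k} π i = ⁅ i ↑ˡ k ⁆ ∪ ⁅ k ↑ʳ (π ⟨$⟩ʳ i) ⁆

private
  matchingEdge-injective : ∀ {k} (π : Permutation′ k) {i j : Fin k} →
                           matchingEdge π i ≡ matchingEdge π j → i ≡ j
  matchingEdge-injective {k} π {i} {j} eq
    with Subset.x∈p∪q⁻ ⁅ j ↑ˡ k ⁆ ⁅ k ↑ʳ (π ⟨$⟩ʳ j) ⁆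
           (subst (i ↑ˡ k ∈ₛ_) eq (Subset.x∈p∪q⁺ (inj₁ (Subset.x∈⁅x⁆ (i ↑ˡ k)))))
  ... | inj₁ i∈ = Fin.↑ˡ-injective k i j (Subset.x∈⁅y⁆⇒x≡y _ i∈)
  ... | inj₂ i∈ = contradiction (Subset.x∈⁅y⁆⇒x≡y _ i∈) (left≢right i (π ⟨$⟩ʳ j))

H⟨_⟩ : ∀ {k} → Permutation′ k → OrderedHypergraph (k + k)
H⟨ π ⟩ = record
  { _<_                = Fin._<_
  ; isStrictTotalOrder = Fin.<-isStrictTotalOrder
  ; edges              = List.tabulate (matchingEdge π)
  ; edges-unique       = Unique.tabulate⁺ (matchingEdge-injective π)
  ; edges-size         = All.tabulate⁺ (λ i → 2≤∣pair∣ (left≢right i (π ⟨$⟩ʳ i)))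
  }

minSpeed : ℕ → ℕ
minSpeed n = sum (map (λ k → (n C (2 * k)) * k !) (upTo (suc ⌊ n /2⌋)))

-- f(n) = n^(n/2 + o(n)): for every ε = 1/m > 0, eventually
-- n^(n/2 - n/m) ≤ f(n) ≤ n^(n/2 + n/m).  Both inequalities are raised to the
-- power 2m, and the negative exponent is cleared.
_≈n^⟨n/2+o[n]⟩ : (ℕ → ℕ) → Set
f ≈n^⟨n/2+o[n]⟩ = ∀ (m : ℕ) .{{_ : NonZero m}} → ∃[ n₀ ] ∀ n → n₀ ≤ n →
  (n ^ (m * n) ≤ f n ^ (2 * m) * n ^ (2 * n)) ×
  (f n ^ (2 * m) ≤ n ^ (m * n + 2 * n))

{-# OPTIONS --safe #-}
-- Let H be a hypergraph on an ordered n-set that does not contain H⟨ π ⟩.  Then H has no large grid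
-- of distinct edges, i.e. no intervals A_1 < ... < A_R < B_1 < ... < B_R with distinct edges e_ij
-- meeting A_i and B_j: in such a grid either many edges meet the same large set of intervals, and
-- then a comb in their binary trie separates them, or the edges can be chosen greedily so that no
-- edge contains the pair of a later one; in both cases the traces become distinct.  Grids, unlike
-- containment, are inherited from the hypergraph obtained by contracting pairs of consecutive
-- vertices.  By the Marcus-Tardos argument a graph without a large grid has linearly many edges.
-- Applied to shadows of sets of bounded size this makes the graph degenerate and bounds the number of
-- such sets; cutting large edges into chunks shows that the sum of all edge sizes is linear in n.
-- Hence a contracted hypergraph has at most exponentially many preimages, and halving n repeatedly
-- gives at most c^n hypergraphs.  A superexponential property therefore contains all H⟨ π ⟩.
--
-- The extremal property consists of the matchings all of whose left endpoints precede all right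
-- endpoints.  Each embeds in some H⟨ π ⟩, and reading the vertices from left to right gives the count
-- minSpeed.  A property with this speed contains these matchings, hence equals them by cardinality.
module Submission where

open import Level using (Level; Lift; lift; 0ℓ)
open import Data.Nat using (ℕ; zero; suc; _+_; _*_; _∸_; _^_; _!; _≤_; _<_; z≤n; s≤s; z<s; s<s; _⊔_; _⊓_; _/_; _%_; NonZero; ⌊_/2⌋)
open import Data.Nat.Properties
open import Data.Nat.DivMod
open import Data.Nat.ListAction using (sum)
open import Data.Nat.Tactic.RingSolver using (solve-∀)
open import Data.Bool using (Bool; true; false; not; _∧_; _∨_; if_then_else_)
import Data.Bool.Properties as Bool
open import Data.Fin.Base as Fin using (Fin; toℕ; fromℕ<; _↑ˡ_; _↑ʳ_; combine; remQuot)
import Data.Fin.Properties as Fin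
open import Data.Fin.Subset using (Subset; ∣_∣; ⁅_⁆; _∪_; _⊆_)
open import Data.Fin.Permutation using (Permutation′; _⟨$⟩ʳ_; _⟨$⟩ˡ_)
import Data.Fin.Permutation as Perm
open import Data.Vec.Base as Vec using (Vec; []; _∷_)
import Data.Vec.Properties as Vec
open import Data.List.Base as List using (List; []; _∷_; length; map; filter; _++_; upTo; allFin; concatMap; cartesianProduct; cartesianProductWith; deduplicate)
open import Data.List.Properties as ListP using (length-++; length-map; length-filter; length-applyUpTo; length-tabulate; filter-++)
open import Data.List.Membership.Propositional using (_∈_; find; lose)
open import Data.List.Membership.Propositional.Properties
open import Data.List.Relation.Unary.Any as Any using (Any; here; there)
open import Data.List.Relation.Unary.All as All using (All; []; _∷_)
import Data.List.Relation.Unary.All.Properties as All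
open import Data.List.Relation.Unary.AllPairs as AllPairs using (AllPairs; []; _∷_)
import Data.List.Relation.Unary.AllPairs.Properties as AllPairs
open import Data.List.Relation.Unary.Unique.Propositional using (Unique)
import Data.List.Relation.Unary.Unique.Propositional.Properties as Unique
import Data.List.Relation.Unary.Unique.DecPropositional.Properties as UniqueDec
open import Data.Product using (Σ; ∃!; ∃-syntax; _×_; _,_; proj₁; proj₂; swap; uncurry)
import Data.Product.Properties as Product
open import Data.Sum using (_⊎_; inj₁; inj₂; [_,_]′)
open import Data.Empty using (⊥; ⊥-elim)
open import Data.Unit using (tt)
open import Function using (_∘_; id; case_of_)
open import Relation.Nullary using (¬_; Dec; yes; no; does; contradiction; ¬?; _×-dec_)
open import Relation.Nullary.Decidable using (dec-true; dec-false; decidable-stable; map′; _→-dec_; _⊎-dec_)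
open import Relation.Binary using (DecidableEquality; tri<; tri≈; tri>)
open import Relation.Binary.PropositionalEquality using (_≡_; _≢_; refl; sym; trans; cong; cong₂; subst; subst₂; module ≡-Reasoning)
open import Data.Integer.Base as ℤ using ()
import Data.Integer.Properties as ℤ
open import Data.Rational.Base as ℚ using (ℚ; 0ℚ)
import Data.Rational.Properties as ℚ
open import Data.Rational.Unnormalised.Base as ℚᵘ using (mkℚᵘ; *<*)
import Data.Rational.Unnormalised.Properties as ℚᵘ
open import Data.List.Relation.Binary.Permutation.Propositional using (↭-refl; ↭-sym)
open import Data.List.Relation.Binary.Pointwise.Base using (Pointwise; []; _∷_)
open import Function.Bundles using (Injection; Inverse; _↔_; mk⇔; mk↔ₛ′; Equivalence)
open import Relation.Binary.Core using (Rel)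
open import Relation.Binary.Structures using (IsStrictTotalOrder)
open import Relation.Binary.Morphism.Structures using (IsOrderMonomorphism; IsOrderIsomorphism)
import Relation.Binary.Morphism.Construct.Identity as Identity
import Algebra.Definitions.RawSemiring as RawSemiringDefinitions
open import Data.Nat.Divisibility using (divides-refl)
open import Data.List.Relation.Unary.Any.Properties using (lookup-index)
open import Defs
open import Data.Nat.Combinatorics using (nCk+nC[k+1]≡[n+1]C[k+1]; k>n⇒nCk≡0) renaming (_C_ to _choose_)
open import Data.Sum.Function.Propositional using (_⊎-↔_)
open import Data.Product.Function.NonDependent.Propositional using (_×-↔_)
open import Function.Properties.Inverse using (↔-refl; ↔-trans)
open import Data.Fin.Subset.Properties as Subset using (x∈⁅x⁆; x∈⁅y⁆⇒x≡y; x∈p∪q⁺; x∈p∪q⁻; p⊆q⇒∣p∣≤∣q∣)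
open import Data.List.Relation.Binary.Permutation.Propositional.Properties using (∈-resp-↭)
open import Data.List.Membership.DecPropositional using () renaming (_∈?_ to member?)

open OrderedHypergraph using (edges; edges-unique; edges-size)
open RawSemiringDefinitions ℚ.+-*-rawSemiring using () renaming (_^_ to _^ℚ_)

-- Containment asks for edges with distinct traces, and contraction destroys this: two edges that
-- differ at a vertex of the contracted hypergraph may agree at the chosen lift of that vertex. A
-- grid asks only for distinct edges, and preimages of distinct edges are distinct. The sum of the
-- edge sizes has to be linear, not just the number of edges: a contracted edge `c` has 3 ^ |c|
-- possible preimages, of which at most `M` occur together, so a contracted hypergraph has at most 3
-- ^ (weight * M) preimages. As n is halved each time, the exponents form a geometric series.
-- Intervals are fibres of monotone maps on ℕ, so that merging intervals and pulling them back is
-- composition of maps. A property need not be decidable, so a member containing `H⟨ π ⟩` has to be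
-- found by a search among finitely many hypergraphs, for which containment is shown to be
-- decidable.

Mono : (ℕ → ℕ) → Set
Mono p = ∀ {x y} → x ≤ y → p x ≤ p y

mono-reflects-< : ∀ {p} → Mono p → ∀ {x y} → p x < p y → x < y
mono-reflects-< m {x} {y} px<py with x <? y
... | yes x<y = x<y
... | no  x≮y = contradiction (m (≮⇒≥ x≮y)) (<⇒≱ px<py)

-- Counting in lists without repetition

module _ {A : Set} where

  length-filter-¬ : ∀ {P : A → Set} (P? : ∀ x → Dec (P x)) xs →
                    length xs ≡ length (filter P? xs) + length (filter (λ x → ¬? (P? x)) xs)
  length-filter-¬ P? [] = refl
  length-filter-¬ P? (x ∷ xs) with P? x
  ... | yes _ = cong suc (length-filter-¬ P? xs)
  ... | no  _ = trans (cong suc (length-filter-¬ P? xs)) (sym (+-suc _ _))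

  filter-mono-length : ∀ {P Q : A → Set} (P? : ∀ x → Dec (P x)) (Q? : ∀ x → Dec (Q x)) xs →
                       (∀ {x} → x ∈ xs → P x → Q x) →
                       length (filter P? xs) ≤ length (filter Q? xs)
  filter-mono-length P? Q? [] imp = z≤n
  filter-mono-length P? Q? (x ∷ xs) imp with P? x | Q? x
  ... | yes p | yes q = s≤s (filter-mono-length P? Q? xs (imp ∘ there))
  ... | yes p | no ¬q = contradiction (imp (here refl) p) ¬q
  ... | no ¬p | yes q = m≤n⇒m≤1+n (filter-mono-length P? Q? xs (imp ∘ there))
  ... | no ¬p | no ¬q = filter-mono-length P? Q? xs (imp ∘ there)

  filter-comm-length : ∀ {P Q : A → Set} (P? : ∀ x → Dec (P x)) (Q? : ∀ x → Dec (Q x)) xs →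
                       length (filter P? (filter Q? xs)) ≤ length (filter P? xs)
  filter-comm-length P? Q? [] = z≤n
  filter-comm-length P? Q? (x ∷ xs) with Q? x
  ... | yes q with P? x
  ...   | yes p = s≤s (filter-comm-length P? Q? xs)
  ...   | no ¬p = filter-comm-length P? Q? xs
  filter-comm-length P? Q? (x ∷ xs) | no ¬q with P? x
  ...   | yes p = m≤n⇒m≤1+n (filter-comm-length P? Q? xs)
  ...   | no ¬p = filter-comm-length P? Q? xs

  length≤1 : ∀ {xs : List A} → Unique xs → (∀ {x y} → x ∈ xs → y ∈ xs → x ≡ y) → length xs ≤ 1
  length≤1 {[]} u eq = z≤n
  length≤1 {x ∷ []} u eq = s≤s z≤n
  length≤1 {x ∷ y ∷ xs} ((x≢y ∷ _) ∷ _) eq =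
    contradiction (eq (here refl) (there (here refl))) x≢y

  nonempty : ∀ {xs : List A} → 0 < length xs → ∃[ x ] x ∈ xs
  nonempty {x ∷ xs} _ = x , here refl

module _ {A B : Set} {R : A → B → Set} (R? : ∀ x y → Dec (R x y)) where

  -- The common form of the double counts below. `R` need not be functional: the induction removes
  -- all elements related to the first `y`, so every element is charged once.
  cover-bound : ∀ d (ys : List B) (xs : List A) →
                (∀ {x} → x ∈ xs → ∃[ y ] y ∈ ys × R x y) →
                (∀ {y} → y ∈ ys → length (filter (λ x → R? x y) xs) ≤ d) →
                length xs ≤ length ys * d
  cover-bound d [] [] cov fib = z≤n
  cover-bound d [] (x ∷ xs) cov fib = case cov (here refl) of λ ()
  cover-bound d (y ∷ ys) xs cov fib = begin
    length xs                            ≡⟨ length-filter-¬ (λ x → R? x y) xs ⟩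
    length (filter (λ x → R? x y) xs) + length rest
      ≤⟨ +-mono-≤ (fib (here refl)) (cover-bound d ys rest cov′ fib′) ⟩
    d + length ys * d                    ∎
    where
    open ≤-Reasoning
    rest = filter (λ x → ¬? (R? x y)) xs
    cov′ : ∀ {x} → x ∈ rest → ∃[ z ] z ∈ ys × R x z
    cov′ x∈ with ∈-filter⁻ (λ x → ¬? (R? x y)) {xs = xs} x∈
    ... | x∈xs , ¬r with cov x∈xs
    ...   | z , here refl , r = contradiction r ¬r
    ...   | z , there z∈ , r = z , z∈ , r
    fib′ : ∀ {z} → z ∈ ys → length (filter (λ x → R? x z) rest) ≤ d
    fib′ z∈ = ≤-trans (filter-comm-length _ _ xs) (fib (there z∈))

  cover-≤ : ∀ (ys : List B) {xs : List A} → Unique xs →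
            (∀ {x} → x ∈ xs → ∃[ y ] y ∈ ys × R x y) →
            (∀ {x x′ y} → x ∈ xs → x′ ∈ xs → R x y → R x′ y → x ≡ x′) →
            length xs ≤ length ys
  cover-≤ ys {xs} u cov inj = subst (length xs ≤_) (*-identityʳ _) (cover-bound 1 ys xs cov
    (λ {y} _ → length≤1 (Unique.filter⁺ (λ x → R? x y) u)
      (λ x∈ x′∈ → let a , r = ∈-filter⁻ (λ x → R? x y) {xs = xs} x∈
                      b , r′ = ∈-filter⁻ (λ x → R? x y) {xs = xs} x′∈
                  in inj a b r r′)))

unique-⊆-length : ∀ {A : Set} → DecidableEquality A → ∀ {xs ys : List A} → Unique xs →
                  (∀ {x} → x ∈ xs → x ∈ ys) → length xs ≤ length ys
unique-⊆-length _≟_ {ys = ys} u sub =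
  cover-≤ _≟_ ys u (λ x∈ → _ , sub x∈ , refl) (λ { _ _ refl refl → refl })

module _ {A : Set} (_≟A_ : DecidableEquality A) where

  ded : List A → List A
  ded = deduplicate _≟A_

  ded-unique : ∀ xs → Unique (ded xs)
  ded-unique = UniqueDec.deduplicate-! _≟A_

  ∈-ded⁺ : ∀ {xs x} → x ∈ xs → x ∈ ded xs
  ∈-ded⁺ = ∈-deduplicate⁺ _≟A_

  ∈-ded⁻ : ∀ {xs x} → x ∈ ded xs → x ∈ xs
  ∈-ded⁻ {xs} = ∈-deduplicate⁻ _≟A_ xs

map-unique : ∀ {A B : Set} (f : A → B) {xs : List A} →
             (∀ {x y} → x ∈ xs → y ∈ xs → f x ≡ f y → x ≡ y) → Unique xs → Unique (map f xs)
map-unique f {[]} inj [] = []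
map-unique f {x ∷ xs} inj (x∉ ∷ u) =
  All.map⁺ (All.tabulate (λ y∈ eq → All.lookup x∉ y∈ (inj (here refl) (there y∈) eq)))
  ∷ map-unique f (λ a b → inj (there a) (there b)) u

length-cartesianProductWith : ∀ {A B C : Set} (f : A → B → C) xs ys →
                              length (cartesianProductWith f xs ys) ≡ length xs * length ys
length-cartesianProductWith f [] ys = refl
length-cartesianProductWith f (x ∷ xs) ys =
  trans (length-++ (map (f x) ys)) (cong₂ _+_ (length-map (f x) ys) (length-cartesianProductWith f xs ys))

length-upTo : ∀ n → length (upTo n) ≡ n
length-upTo = length-applyUpTo id

-- Ranks, bit vectors and powers

-- Counts the elements of `D` below `x`. It is a main source of interval maps: it is monotone, and
-- its fibre over `i` ends with element number `i` of `D` (counted from 0) and contains no other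
-- one, so the elements of a set represent consecutive intervals.
rank : (ℕ → Bool) → ℕ → ℕ
rank D zero    = 0
rank D (suc x) = (if D x then 1 else 0) + rank D x

rank-mono : ∀ D → Mono (rank D)
rank-mono D {x} {zero} z≤n = z≤n
rank-mono D {x} {suc y} x≤sy with m≤n⇒m<n∨m≡n x≤sy
... | inj₁ (s≤s x≤y) = ≤-trans (rank-mono D x≤y) (m≤n+m _ (if D y then 1 else 0))
... | inj₂ refl = ≤-refl

rank-strict : ∀ D {x y} → D x ≡ true → x < y → rank D x < rank D y
rank-strict D {x} {y} Dx x<y = ≤-trans (≤-reflexive lem) (rank-mono D x<y)
  where
  lem : suc (rank D x) ≡ rank D (suc x)
  lem rewrite Dx = refl

rank-injective : ∀ D {x y} → D x ≡ true → D y ≡ true → rank D x ≡ rank D y → x ≡ y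
rank-injective D {x} {y} Dx Dy eq with <-cmp x y
... | tri< x<y _ _ = contradiction eq (<⇒≢ (rank-strict D Dx x<y))
... | tri≈ _ x≡y _ = x≡y
... | tri> _ _ y<x = contradiction (sym eq) (<⇒≢ (rank-strict D Dy y<x))

rank-hit : ∀ D n {i} → i < rank D n → ∃[ x ] x < n × D x ≡ true × rank D x ≡ i
rank-hit D (suc n) {i} i< with D n in eq
... | false = let x , x<n , Dx , r = rank-hit D n i< in x , m<n⇒m<1+n x<n , Dx , r
... | true with m≤n⇒m<n∨m≡n i<
...   | inj₁ (s≤s i<r) = let x , x<n , Dx , r = rank-hit D n i<r in x , m<n⇒m<1+n x<n , Dx , r
...   | inj₂ i≡r = n , n<1+n n , eq , sym (suc-injective i≡r)

length≤rank : ∀ D n {xs : List ℕ} → Unique xs → (∀ {x} → x ∈ xs → x < n × D x ≡ true) →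
              length xs ≤ rank D n
length≤rank D n {xs} u b = subst (length xs ≤_) (length-upTo _)
  (cover-≤ (λ x i → rank D x ≟ i) (upTo (rank D n)) u
    (λ x∈ → let x<n , Dx = b x∈ in _ , ∈-upTo⁺ (rank-strict D Dx x<n) , refl)
    (λ x∈ y∈ p q → rank-injective D (proj₂ (b x∈)) (proj₂ (b y∈)) (trans p (sym q))))

bitVectors : ∀ n → List (Vec Bool n)
bitVectors zero    = [] ∷ []
bitVectors (suc n) = map (true ∷_) (bitVectors n) ++ map (false ∷_) (bitVectors n)

∈-bitVectors : ∀ {n} (v : Vec Bool n) → v ∈ bitVectors n
∈-bitVectors [] = here refl
∈-bitVectors (true ∷ v) = ∈-++⁺ˡ (∈-map⁺ (true ∷_) (∈-bitVectors v))
∈-bitVectors {suc n} (false ∷ v) = ∈-++⁺ʳ (map (true ∷_) (bitVectors n)) (∈-map⁺ (false ∷_) (∈-bitVectors v))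

_≟ᵛ_ : ∀ {n} → DecidableEquality (Vec Bool n)
_≟ᵛ_ = Vec.≡-dec Bool._≟_

-- Extends bounds known at powers of `t` to every `n`: rounding up to such a power costs at most the
-- factor `t`.
power-between : ∀ t → 2 ≤ t → ∀ n → 1 ≤ n → ∃[ j ] n ≤ t ^ j × t ^ j ≤ t * n
power-between t 2≤t (suc zero) _ = 0 , ≤-refl , ≤-trans (≤-trans (s≤s z≤n) 2≤t) (≤-reflexive (sym (*-identityʳ t)))
power-between t 2≤t (suc (suc n)) _ with power-between t 2≤t (suc n) (s≤s z≤n)
... | j , n≤ , ≤tn with suc (suc n) ≤? t ^ j
...   | yes p = j , p , ≤-trans ≤tn (*-monoʳ-≤ t (n≤1+n _))
...   | no ¬p = suc j
  , ≤-trans (≤-reflexive (+-comm 1 (suc n)))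
      (≤-trans (+-monoʳ-≤ (suc n) {1} {suc n + 0} (s≤s z≤n))
        (≤-trans (*-monoˡ-≤ (suc n) 2≤t) (*-monoʳ-≤ t n≤)))
  , *-monoʳ-≤ t (≤-trans (≤-pred (≰⇒> ¬p)) (n≤1+n _))

-- Positions beyond the length hold `false`, so membership implies the bound, and vertex maps can be
-- maps on ℕ.
at : ∀ {n} → Vec Bool n → ℕ → Bool
at []      _       = false
at (b ∷ v) zero    = b
at (b ∷ v) (suc x) = at v x

infix 4 _∋_
_∋_ : ∀ {n} → Vec Bool n → ℕ → Set
e ∋ x = at e x ≡ true

∋-bound : ∀ {n} (v : Vec Bool n) {x} → v ∋ x → x < n
∋-bound (b ∷ v) {zero}  _ = z<s
∋-bound (b ∷ v) {suc x} h = s<s (∋-bound v h)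

_∋?_ : ∀ {n} (v : Vec Bool n) x → Dec (v ∋ x)
v ∋? x = at v x Bool.≟ true

∌-false : ∀ {n} {v : Vec Bool n} {x} → ¬ v ∋ x → at v x ≡ false
∌-false h = Bool.¬-not h

vec : ∀ n → (ℕ → Bool) → Vec Bool n
vec zero    f = []
vec (suc n) f = f 0 ∷ vec n (f ∘ suc)

at-vec : ∀ {n} f {x} → x < n → at (vec n f) x ≡ f x
at-vec {suc n} f {zero}  _         = refl
at-vec {suc n} f {suc x} (s<s x<n) = at-vec (f ∘ suc) x<n

at-ext : ∀ {n} {v w : Vec Bool n} → (∀ {x} → x < n → at v x ≡ at w x) → v ≡ w
at-ext {v = []} {[]} h = refl
at-ext {v = b ∷ v} {c ∷ w} h = cong₂ _∷_ (h z<s) (at-ext (h ∘ s<s))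

decide : ∀ {P : Set} (d : Dec P) → does d ≡ true → P
decide (yes p) _ = p

length-filter-map : ∀ {A B : Set} {P : B → Set} (P? : ∀ x → Dec (P x)) (f : A → B) xs →
                    length (filter P? (map f xs)) ≡ length (filter (λ x → P? (f x)) xs)
length-filter-map P? f [] = refl
length-filter-map P? f (x ∷ xs) with P? (f x)
... | yes _ = cong suc (length-filter-map P? f xs)
... | no  _ = length-filter-map P? f xs

-- Grid minors of 0-1 matrices

-- A k × k grid minor: intervals of rows and columns are the fibres of two
-- monotone maps, so that contraction to blocks is composition.
Grid : ℕ → List (ℕ × ℕ) → Set
Grid k xs = ∃[ p ] ∃[ q ] Mono p × Mono q ×
  (∀ {i j} → i < k → j < k → ∃[ x ] ∃[ y ] (x , y) ∈ xs × p x ≡ i × q y ≡ j)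

_≟ₚ_ : DecidableEquality (ℕ × ℕ)
_≟ₚ_ = Product.≡-dec _≟_ _≟_

grid-swap : ∀ {k xs} → Grid k (map swap xs) → Grid k xs
grid-swap {k} {xs} (p , q , mp , mq , hit) = q , p , mq , mp , λ i< j< →
  let x , y , xy∈ , px , qy = hit j< i<
      (y′ , x′) , ∈xs , eq = ∈-map⁻ swap xy∈
  in y , x , subst (_∈ xs) (cong swap (sym eq)) ∈xs , qy , px

module Contraction (q : ℕ) where

  t : ℕ
  -- A block that is neither wide nor tall has at most q * q entries, so these blocks multiply the
  -- bound by q * q while the side grows by the factor `t`; the remaining 2 pays for the wide and
  -- the tall blocks.
  t = 2 + q * q

  block : ℕ × ℕ → ℕ × ℕ
  block (x , y) = x / t , y / t

  recompose : ∀ x x′ → x % t ≡ x′ % t → x / t ≡ x′ / t → x ≡ x′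
  recompose x x′ r d = trans (m≡m%n+[m/n]*n x t) (trans (cong₂ (λ u v → u + v * t) r d) (sym (m≡m%n+[m/n]*n x′ t)))

  InBlockColumn : ℕ → ℕ → ℕ → ℕ × ℕ → Set
  InBlockColumn a b i (x , y) = x / t ≡ a × y / t ≡ b × x % t ≡ i

  inBlockColumn? : ∀ a b i z → Dec (InBlockColumn a b i z)
  inBlockColumn? a b i (x , y) = (x / t ≟ a) ×-dec (y / t ≟ b) ×-dec (x % t ≟ i)

  column? : ∀ (xs : List (ℕ × ℕ)) a b i → Dec (Any (InBlockColumn a b i) xs)
  column? xs a b i = Any.any? (inBlockColumn? a b i) xs

  columns : List (ℕ × ℕ) → ℕ → ℕ → Vec Bool t
  columns xs a b = vec t (λ i → does (column? xs a b i))

  ∈-columns : ∀ {xs x y} → (x , y) ∈ xs → columns xs (x / t) (y / t) ∋ x % t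
  ∈-columns {xs} {x} {y} ∈xs = trans (at-vec (λ i → does (column? xs (x / t) (y / t) i)) (m%n<n x t))
    (dec-true (column? xs (x / t) (y / t) (x % t)) (lose ∈xs (refl , refl , refl)))

  Wide : List (ℕ × ℕ) → ℕ × ℕ → Set
  Wide xs (x , y) = q < rank (at (columns xs (x / t) (y / t))) t

  wide? : ∀ xs z → Dec (Wide xs z)
  wide? xs (x , y) = q <? rank (at (columns xs (x / t) (y / t))) t

  L : ℕ
  L = length (bitVectors t)

  -- The factors are the `n` strips of blocks, the `L` patterns of occupied columns, at most `q`
  -- wide blocks with one pattern in a strip, and the t * t cells of a block. Classifying blocks by
  -- the whole pattern, rather than by q + 1 chosen columns, only affects the constant.
  wide-bound : ∀ n xs → Unique xs → (∀ {x y} → (x , y) ∈ xs → x / t < n) → ¬ Grid (suc q) xs →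
               length (filter (wide? xs) xs) ≤ (n * L) * (q * (t * t))
  wide-bound n xs u bd ¬grid = begin
    length ws ≤⟨ cover-bound R? (q * (t * t)) ys ws
                   (λ { {x , y} ∈ws → (x / t , columns xs (x / t) (y / t))
                      , ∈-cartesianProduct⁺ (∈-upTo⁺ (bd (proj₁ (∈-filter⁻ (wide? xs) {xs = xs} ∈ws)))) (∈-bitVectors _)
                      , refl , refl })
                   (λ {(a , S)} _ → fibre a S) ⟩
    length ys * (q * (t * t))
      ≡⟨ cong (_* (q * (t * t))) (trans (length-cartesianProductWith _,_ (upTo n) (bitVectors t)) (cong (_* L) (length-upTo n))) ⟩
    (n * L) * (q * (t * t)) ∎
    where
    open ≤-Reasoning
    ws = filter (wide? xs) xs
    ys = cartesianProduct (upTo n) (bitVectors t)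
    R? : ∀ (z : ℕ × ℕ) (w : ℕ × Vec Bool t) →
         Dec (proj₁ z / t ≡ proj₁ w × columns xs (proj₁ z / t) (proj₂ z / t) ≡ proj₂ w)
    R? (x , y) (a , S) = (x / t ≟ a) ×-dec (columns xs (x / t) (y / t) ≟ᵛ S)

    fibre : ∀ a S → length (filter (λ z → R? z (a , S)) ws) ≤ q * (t * t)
    fibre a S = ≤-trans
      (cover-bound (λ (z : ℕ × ℕ) b → proj₂ z / t ≟ b) (t * t) bs zs
        (λ z∈ → _ , ∈-ded⁺ _≟_ (∈-map⁺ (λ z → proj₂ z / t) z∈) , refl)
        (λ {b} _ → blockSize b))
      (*-monoˡ-≤ (t * t) (≮⇒≥ few))
      where
      zs = filter (λ z → R? z (a , S)) ws
      bs = ded _≟_ (map (λ z → proj₂ z / t) zs)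
      zs-unique : Unique zs
      zs-unique = Unique.filter⁺ (λ z → R? z (a , S)) (Unique.filter⁺ (wide? xs) u)
      zs-spec : ∀ {x y} → (x , y) ∈ zs → (x , y) ∈ xs × Wide xs (x , y) × x / t ≡ a × columns xs (x / t) (y / t) ≡ S
      zs-spec z∈ = let w∈ , r , s = ∈-filter⁻ (λ z → R? z (a , S)) {xs = ws} z∈
                       x∈ , w = ∈-filter⁻ (wide? xs) {xs = xs} w∈
                   in x∈ , w , r , s

      blockSize : ∀ b → length (filter (λ z → proj₂ z / t ≟ b) zs) ≤ t * t
      blockSize b = subst (length vs ≤_) (trans (length-cartesianProductWith _,_ (upTo t) (upTo t)) (cong₂ _*_ (length-upTo t) (length-upTo t)))
        (cover-≤ (λ z w → ((proj₁ z % t) , (proj₂ z % t)) ≟ₚ w) (cartesianProduct (upTo t) (upTo t))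
          (Unique.filter⁺ (λ z → proj₂ z / t ≟ b) zs-unique)
          (λ {(x , y)} _ → _ , ∈-cartesianProduct⁺ (∈-upTo⁺ (m%n<n x t)) (∈-upTo⁺ (m%n<n y t)) , refl)
          (λ { {x , y} {x′ , y′} z∈ z′∈ refl eq →
             let zz , yb = ∈-filter⁻ (λ z → proj₂ z / t ≟ b) {xs = zs} z∈
                 zz′ , yb′ = ∈-filter⁻ (λ z → proj₂ z / t ≟ b) {xs = zs} z′∈
                 _ , _ , xa , _ = zs-spec zz
                 _ , _ , xa′ , _ = zs-spec zz′
             in cong₂ _,_ (recompose x x′ (sym (cong proj₁ eq)) (trans xa (sym xa′)))
                          (recompose y y′ (sym (cong proj₂ eq)) (trans yb (sym yb′))) }))
        where vs = filter (λ z → proj₂ z / t ≟ b) zs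

      -- In q + 1 such blocks every column of the common pattern `S` is occupied in every block.
      -- Ranks in `S` number the columns, ranks in the set `D` of block indices number the blocks.
      few : ¬ (q < length bs)
      few q<bs = ¬grid ((λ x → rank (at S) (x ∸ a * t)) , (λ y → rank D (y / t))
        , (λ le → rank-mono (at S) (∸-monoˡ-≤ (a * t) le))
        , (λ le → rank-mono D (/-monoˡ-≤ t le))
        , hit)
        where
        D : ℕ → Bool
        D b = does (Any.any? (b ≟_) bs)
        N = suc (List.foldr _⊔_ 0 bs)
        below : ∀ (l : List ℕ) {b} → b ∈ l → b ≤ List.foldr _⊔_ 0 l
        below (c ∷ l) (here refl) = m≤m⊔n c _
        below (c ∷ l) (there b∈) = ≤-trans (below l b∈) (m≤n⊔m c _)
        q<S : q < rank (at S) t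
        q<S with nonempty {xs = bs} (≤-<-trans z≤n q<bs)
        ... | b , b∈ with ∈-map⁻ (λ z → proj₂ z / t) (∈-ded⁻ _≟_ b∈)
        ...   | (x , y) , z∈ , _ with zs-spec z∈
        ...     | _ , w , _ , eqS = subst (λ s → q < rank (at s) t) eqS w
        hit : ∀ {i j} → i < suc q → j < suc q → ∃[ x ] ∃[ y ] (x , y) ∈ xs ×
              rank (at S) (x ∸ a * t) ≡ i × rank D (y / t) ≡ j
        hit (s≤s i≤q) (s≤s j≤q)
          with rank-hit (at S) t (≤-<-trans i≤q q<S)
             | rank-hit D N (≤-<-trans j≤q (<-≤-trans q<bs
                 (length≤rank D N (ded-unique _≟_ (map (λ z → proj₂ z / t) zs))
                   (λ {b} b∈ → s≤s (below bs b∈) , dec-true (Any.any? (b ≟_) bs) b∈))))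
        ... | i′ , i′<t , Si′ , ri | b , _ , Db , rj
          with ∈-map⁻ (λ z → proj₂ z / t) (∈-ded⁻ _≟_ {map (λ z → proj₂ z / t) zs} (decide (Any.any? (b ≟_) bs) Db))
        ... | (x₀ , y₀) , z∈ , refl with zs-spec z∈
        ... | _ , _ , refl , refl
          with find (decide (column? xs a b i′) (trans (sym (at-vec (λ i → does (column? xs a b i)) i′<t)) Si′))
        ... | (x , y) , xy∈ , xa , yb , xi = x , y , xy∈
          , trans (cong (rank (at S)) (trans (cong (_∸ a * t) (trans (m≡m%n+[m/n]*n x t) (cong₂ (λ u v → u + v * t) xi xa))) (m+n∸n≡m i′ (a * t)))) ri
          , trans (cong (rank D) yb) rj

  -- Tall blocks are the wide blocks of the transposed matrix. The other blocks are counted through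
  -- the contracted matrix `ys`: a grid of it, composed with division by `t`, would be a grid of
  -- `xs`, so `ih` applies.
  step : ∀ n c xs → Unique xs → (∀ {x y} → (x , y) ∈ xs → x / t < n × y / t < n) → ¬ Grid (suc q) xs →
         (∀ ys → Unique ys → (∀ {x y} → (x , y) ∈ ys → x < n × y < n) → ¬ Grid (suc q) ys → length ys ≤ c * n) →
         length xs ≤ (n * L) * (q * (t * t)) + ((n * L) * (q * (t * t)) + c * n * (q * q))
  step n c xs u bd ¬grid ih = begin
    length xs ≡⟨ length-filter-¬ (wide? xs) xs ⟩
    length (filter (wide? xs) xs) + length narrow ≡⟨ cong (length (filter (wide? xs) xs) +_) (length-filter-¬ tall? narrow) ⟩
    length (filter (wide? xs) xs) + (length (filter tall? narrow) + length normal)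
      ≤⟨ +-mono-≤ (wide-bound n xs u (proj₁ ∘ bd) ¬grid) (+-mono-≤ tall normal-bound) ⟩
    (n * L) * (q * (t * t)) + ((n * L) * (q * (t * t)) + c * n * (q * q)) ∎
    where
    open ≤-Reasoning
    xsᵀ = map swap xs
    narrow = filter (λ z → ¬? (wide? xs z)) xs
    tall? : ∀ z → Dec (Wide xsᵀ (swap z))
    tall? z = wide? xsᵀ (swap z)
    normal = filter (λ z → ¬? (tall? z)) narrow

    tall : length (filter tall? narrow) ≤ (n * L) * (q * (t * t))
    tall = ≤-trans (filter-comm-length tall? (λ z → ¬? (wide? xs z)) xs)
      (≤-trans (≤-reflexive (sym (length-filter-map (wide? xsᵀ) swap xs)))
        (wide-bound n xsᵀ (map-unique swap (λ _ _ → cong swap) u)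
          (λ z∈ → let (x , y) , ∈xs , eq = ∈-map⁻ swap z∈ in subst (λ v → v / t < n) (sym (cong proj₁ eq)) (proj₂ (bd ∈xs)))
          (¬grid ∘ grid-swap)))

    ys = ded _≟ₚ_ (map block xs)
    ys-bound : length ys ≤ c * n
    ys-bound = ih ys (ded-unique _≟ₚ_ (map block xs))
      (λ z∈ → let (x , y) , ∈xs , eq = ∈-map⁻ block (∈-ded⁻ _≟ₚ_ {map block xs} z∈)
                  b₁ , b₂ = bd ∈xs
              in subst (_< n) (sym (cong proj₁ eq)) b₁ , subst (_< n) (sym (cong proj₂ eq)) b₂)
      (λ { (p , r , mp , mr , hit) → ¬grid ((λ x → p (x / t)) , (λ y → r (y / t)) , (mp ∘ /-monoˡ-≤ t) , (mr ∘ /-monoˡ-≤ t)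
         , λ i< j< → let _ , _ , z∈ , pi , rj = hit i< j<
                         (x , y) , ∈xs , eq = ∈-map⁻ block (∈-ded⁻ _≟ₚ_ {map block xs} z∈)
                     in x , y , ∈xs , trans (cong p (sym (cong proj₁ eq))) pi , trans (cong r (sym (cong proj₂ eq))) rj) })

    normal-bound : length normal ≤ c * n * (q * q)
    normal-bound = ≤-trans
      (cover-bound (λ z w → block z ≟ₚ w) (q * q) ys normal
        (λ z∈ → _ , ∈-ded⁺ _≟ₚ_ (∈-map⁺ block (proj₁ (spec z∈))) , refl)
        (λ {w} _ → fibre w))
      (*-monoˡ-≤ (q * q) ys-bound)
      where
      spec : ∀ {z} → z ∈ normal → z ∈ xs × ¬ Wide xs z × ¬ Wide xsᵀ (swap z)
      spec z∈ = let n∈ , ¬tl = ∈-filter⁻ (λ z → ¬? (tall? z)) {xs = narrow} z∈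
                    x∈ , ¬w = ∈-filter⁻ (λ z → ¬? (wide? xs z)) {xs = xs} n∈
                in x∈ , ¬w , ¬tl
      normal-unique : Unique normal
      normal-unique = Unique.filter⁺ (λ z → ¬? (tall? z)) (Unique.filter⁺ (λ z → ¬? (wide? xs z)) u)
      -- At most `q` columns and `q` rows of the block are occupied, and an entry is determined by
      -- its ranks among them.
      fibre : ∀ w → length (filter (λ z → block z ≟ₚ w) normal) ≤ q * q
      fibre (a , b) = subst (length zs ≤_) (trans (length-cartesianProductWith _,_ (upTo q) (upTo q)) (cong₂ _*_ (length-upTo q) (length-upTo q)))
        (cover-≤ (λ z w → (rank C (proj₁ z % t) , rank R (proj₂ z % t)) ≟ₚ w) (cartesianProduct (upTo q) (upTo q))
          (Unique.filter⁺ (λ z → block z ≟ₚ (a , b)) normal-unique)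
          (λ {(x , y)} z∈ → let _ , ¬w , ¬tl , Cx , Ry , xa , yb = zspec z∈ in
            _ , ∈-cartesianProduct⁺
              (∈-upTo⁺ (<-≤-trans (rank-strict C Cx (m%n<n x t)) (subst₂ (λ u v → rank (at (columns xs u v)) t ≤ q) xa yb (≮⇒≥ ¬w))))
              (∈-upTo⁺ (<-≤-trans (rank-strict R Ry (m%n<n y t)) (subst₂ (λ u v → rank (at (columns xsᵀ u v)) t ≤ q) yb xa (≮⇒≥ ¬tl))))
            , refl)
          (λ { {x , y} {x′ , y′} z∈ z′∈ refl eq →
            let _ , _ , _ , Cx , Ry , xa , yb = zspec z∈
                _ , _ , _ , Cx′ , Ry′ , xa′ , yb′ = zspec z′∈
            in cong₂ _,_ (recompose x x′ (rank-injective C Cx Cx′ (sym (cong proj₁ eq))) (trans xa (sym xa′)))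
                         (recompose y y′ (rank-injective R Ry Ry′ (sym (cong proj₂ eq))) (trans yb (sym yb′))) }))
        where
        zs = filter (λ z → block z ≟ₚ (a , b)) normal
        C = at (columns xs a b)
        R = at (columns xsᵀ b a)
        zspec : ∀ {x y} → (x , y) ∈ zs → (x , y) ∈ xs × ¬ Wide xs (x , y) × ¬ Wide xsᵀ (y , x) ×
                C (x % t) ≡ true × R (y % t) ≡ true × x / t ≡ a × y / t ≡ b
        zspec z∈ with ∈-filter⁻ (λ z → block z ≟ₚ (a , b)) {xs = normal} z∈
        ... | n∈ , refl = let x∈ , ¬w , ¬tl = spec n∈ in
          x∈ , ¬w , ¬tl , ∈-columns x∈ , ∈-columns (∈-map⁺ swap x∈) , refl , refl

  B : ℕ
  B = L * (q * (t * t))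

  c : ℕ
  -- The 1 covers the single cell in the base case; since `c` is at least `B`, the 2 contained in
  -- `t` absorbs the wide and tall blocks.
  c = 1 + (B + B)

  powers : ∀ j xs → Unique xs → (∀ {x y} → (x , y) ∈ xs → x < t ^ j × y < t ^ j) → ¬ Grid (suc q) xs →
           length xs ≤ c * t ^ j
  powers zero xs u bd ¬grid = ≤-trans
    (length≤1 u (λ z∈ z′∈ → trans (origin z∈) (sym (origin z′∈)))) (s≤s z≤n)
    where
    origin : ∀ {z} → z ∈ xs → z ≡ (0 , 0)
    origin z∈ = let a , b = bd z∈ in cong₂ _,_ (n<1⇒n≡0 a) (n<1⇒n≡0 b)
  powers (suc j) xs u bd ¬grid = ≤-trans
    (step n c xs u (λ {x} {y} z∈ → let a , b = bd z∈ in m<n*o⇒m/o<n {x} (subst (x <_) (*-comm t n) a) , m<n*o⇒m/o<n {y} (subst (y <_) (*-comm t n) b)) ¬grid (powers j))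
    (begin
      n * L * (q * (t * t)) + (n * L * (q * (t * t)) + c * n * (q * q)) ≡⟨ eq₁ n L (q * (t * t)) (c * n * (q * q)) ⟩
      n * (B + B) + c * n * (q * q) ≤⟨ +-monoˡ-≤ _ (*-monoʳ-≤ n {B + B} {2 * c} (≤-trans (n≤1+n (B + B)) (m≤m+n c (c + 0)))) ⟩
      n * (2 * c) + c * n * (q * q) ≡⟨ eq₂ n c (q * q) ⟩
      c * (t * n) ∎)
    where
    open ≤-Reasoning
    n = t ^ j
    eq₁ : ∀ n l s r → n * l * s + (n * l * s + r) ≡ n * (l * s + l * s) + r
    eq₁ = solve-∀
    eq₂ : ∀ n c r → n * (2 * c) + c * n * r ≡ c * ((2 + r) * n)
    eq₂ = solve-∀

marcusTardos : ∀ k → ∃[ c ] ∀ n xs → Unique xs → (∀ {x y} → (x , y) ∈ xs → x < n × y < n) →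
               ¬ Grid k xs → length xs ≤ c * n
marcusTardos zero = 0 , λ n xs u bd ¬grid → ⊥-elim (¬grid (id , id , id , id , λ ()))
marcusTardos (suc q) = c * t , bound
  where
  open Contraction q
  bound : ∀ n xs → Unique xs → (∀ {x y} → (x , y) ∈ xs → x < n × y < n) → ¬ Grid (suc q) xs → length xs ≤ c * t * n
  bound n [] u bd ¬grid = z≤n
  bound zero (z ∷ xs) u bd ¬grid = case proj₁ (bd (here refl)) of λ ()
  bound (suc n) xs@(_ ∷ _) u bd ¬grid with power-between t (s≤s (s≤s z≤n)) (suc n) (s≤s z≤n)
  ... | j , n≤ , ≤tn = ≤-trans
    (powers j xs u (λ z∈ → let a , b = bd z∈ in <-≤-trans a n≤ , <-≤-trans b n≤) ¬grid)
    (≤-trans (*-monoʳ-≤ c ≤tn) (≤-reflexive (sym (*-assoc c t (suc n)))))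

-- Hypergraphs without edge grids are sparse

Meets : ∀ {n} → (ℕ → ℕ) → Vec Bool n → ℕ → Set
Meets p e i = ∃[ x ] e ∋ x × p x ≡ i

-- The row and column intervals are fibres of one monotone map.  Only the edges,
-- not their traces, have to be distinct, so that grids can be lifted along contractions.
record EdgeGrid {n} (R : ℕ) (E : List (Vec Bool n)) : Set where
  field
    p        : ℕ → ℕ
    mono     : Mono p
    e        : Fin R → Fin R → Vec Bool n
    member   : ∀ i j → e i j ∈ E
    left     : ∀ i j → Meets p (e i j) (toℕ i)
    right    : ∀ i j → Meets p (e i j) (R + toℕ j)
    distinct : ∀ {i j i′ j′} → e i j ≡ e i′ j′ → i ≡ i′ × j ≡ j′

-- A vertex of `φ f` is replaced by a vertex of `f` above it, and the edges by preimages, which stay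
-- distinct because `φ` is a function. Deleting a vertex, contracting, padding and passing to a
-- subfamily are instances.
edgeGrid-lift : ∀ {m n R} {F : List (Vec Bool m)} {G : List (Vec Bool n)} (φ : Vec Bool m → Vec Bool n) (h : ℕ → ℕ) → Mono h →
                (∀ {g} → g ∈ G → ∃[ f ] f ∈ F × g ≡ φ f) →
                (∀ {f x} → f ∈ F → φ f ∋ x → ∃[ y ] f ∋ y × h y ≡ x) →
                EdgeGrid R G → EdgeGrid R F
edgeGrid-lift φ h mh cov lft K = record
  { p = p ∘ h
  ; mono = mono ∘ mh
  ; e = λ i j → proj₁ (cov (member i j))
  ; member = λ i j → proj₁ (proj₂ (cov (member i j)))
  ; left = λ i j → meets (member i j) (left i j)
  ; right = λ i j → meets (member i j) (right i j)
  ; distinct = λ {i} {j} {i′} {j′} eq → distinct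
      (trans (proj₂ (proj₂ (cov (member i j)))) (trans (cong φ eq) (sym (proj₂ (proj₂ (cov (member i′ j′)))))))
  }
  where
  open EdgeGrid K
  meets : ∀ {g} (g∈ : g ∈ _) {i} → Meets p g i → Meets (p ∘ h) (proj₁ (cov g∈)) i
  meets g∈ (x , gx , px) with cov g∈
  ... | f , f∈ , refl = let y , fy , hy = lft f∈ gx in y , fy , trans (cong p hy) px

-- Each of these edges fits in every cell, so any assignment of different edges to the cells works.
edgeGrid-parallel : ∀ {n R} {E zs : List (Vec Bool n)} p → Mono p → Unique zs → R * R ≤ length zs →
                    (∀ {f} → f ∈ zs → f ∈ E) → (∀ {f i} → f ∈ zs → i < R + R → Meets p f i) → EdgeGrid R E
edgeGrid-parallel {R = R} {zs = zs} p mp u len sub meets = record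
  { p = p ; mono = mp
  ; e = e
  ; member = λ i j → sub (e∈ i j)
  ; left = λ i j → meets (e∈ i j) (<-≤-trans (Fin.toℕ<n i) (m≤m+n R R))
  ; right = λ i j → meets (e∈ i j) (+-monoʳ-< R (Fin.toℕ<n j))
  ; distinct = λ {i} {j} {i′} {j′} eq → Fin.combine-injective i j i′ j′
      (Fin.inject≤-injective len len _ _ (lookup-injective u eq))
  }
  where
  e = λ i j → List.lookup zs (Fin.inject≤ (combine i j) len)
  e∈ : ∀ i j → e i j ∈ zs
  e∈ i j = ∈-lookup (Fin.inject≤ (combine i j) len)
  lookup-injective : ∀ {A : Set} {xs : List A} → Unique xs → ∀ {i j} → List.lookup xs i ≡ List.lookup xs j → i ≡ j
  lookup-injective (x ∷ u) {Fin.zero} {Fin.zero} eq = refl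
  lookup-injective (x ∷ u) {Fin.zero} {Fin.suc j} eq = contradiction eq (All.lookup x (∈-lookup j))
  lookup-injective (x ∷ u) {Fin.suc i} {Fin.zero} eq = contradiction (sym eq) (All.lookup x (∈-lookup i))
  lookup-injective (x ∷ u) {Fin.suc i} {Fin.suc j} eq = cong Fin.suc (lookup-injective u eq)

module Greedy {X : Set} {Conf : X → X → Set} (conf? : ∀ x y → Dec (Conf x y)) (d T : ℕ) where

  bounded : ∀ {L} → (Fin L → Fin T → X) → X → Set
  bounded c x = ∀ g → length (filter (λ t → conf? x (c g t)) (allFin T)) ≤ d

  -- The items chosen so far exclude at most length chosen * d of the `T` candidates of the next
  -- group. Each choice moves one unit from `L` to length chosen, so the hypothesis is preserved.
  -- Conflicts are controlled only from earlier to later choices.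
  select : ∀ L (c : Fin L → Fin T → X) (chosen : List X) → (length chosen + L) * d < T →
           (∀ {x} → x ∈ chosen → bounded c x) → (∀ g t → bounded c (c g t)) →
           Σ (Fin L → Fin T) λ τ → (∀ {x} g → x ∈ chosen → ¬ Conf x (c g (τ g))) ×
                  (∀ {g g′} → g Fin.< g′ → ¬ Conf (c g (τ g)) (c g′ (τ g′)))
  select zero c chosen lt bc bd = (λ ()) , (λ ()) , λ { {()} }
  select (suc L) c chosen lt bc bd
    with Fin.any? (λ t → ¬? (Any.any? (λ x → conf? x (c Fin.zero t)) chosen))
  ... | no none = contradiction (subst (_≤ length chosen * d) (length-tabulate {n = T} id)
          (cover-bound (λ t x → conf? x (c Fin.zero t)) d chosen (allFin T)
            (λ {t} _ → find (decidable-stable (Any.any? (λ x → conf? x (c Fin.zero t)) chosen) (λ ¬a → none (t , ¬a))))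
            (λ x∈ → bc x∈ Fin.zero)))
          (<⇒≱ (≤-<-trans (*-monoˡ-≤ d (m≤m+n (length chosen) (suc L))) lt))
  ... | yes (t₀ , ok) with select L (c ∘ Fin.suc) (c Fin.zero t₀ ∷ chosen)
                         (subst (λ z → z * d < T) (+-suc (length chosen) L) lt)
                         (λ { (here refl) g → bd Fin.zero t₀ (Fin.suc g) ; (there x∈) g → bc x∈ (Fin.suc g) })
                         (λ g t g′ → bd (Fin.suc g) t (Fin.suc g′))
  ...   | τ , fresh , later = τ⁺
    , (λ { Fin.zero x∈ cf → ok (lose x∈ cf) ; (Fin.suc g) x∈ → fresh g (there x∈) })
    , λ { {Fin.zero} {Fin.suc g′} _ → fresh g′ (here refl)
        ; {Fin.suc g} {Fin.suc g′} (s<s g<g′) → later g<g′ }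
    where
    τ⁺ : Fin (suc L) → Fin T
    τ⁺ Fin.zero    = t₀
    τ⁺ (Fin.suc g) = τ g

div-block : ∀ a T .{{_ : NonZero T}} {d} → d < T → (a * T + d) / T ≡ a
div-block a T {d} d<T = trans (+-distrib-/-∣ˡ d (divides-refl a))
  (trans (cong₂ _+_ (m*n/n≡m a T) (m<n⇒m/n≡0 d<T)) (+-identityʳ a))

-- A cardinality bound in terms of lists of distinct vertices, which transports along injections of
-- vertices.
Small : ∀ {n} → ℕ → Vec Bool n → Set
Small s f = ∀ xs → Unique xs → (∀ {x} → x ∈ xs → f ∋ x) → length xs ≤ s

module _ {n} (F : List (Vec Bool n)) where

  -- Loops are included, so the neighbours of a vertex `v` comprise every set through `v` entirely,
  -- with `v` itself.
  Adj : ℕ × ℕ → Set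
  Adj (x , y) = Any (λ f → f ∋ x × f ∋ y) F

  adj? : ∀ z → Dec (Adj z)
  adj? (x , y) = Any.any? (λ f → (f ∋? x) ×-dec (f ∋? y)) F

  shadow : List (ℕ × ℕ)
  shadow = filter adj? (cartesianProduct (upTo n) (upTo n))

  shadow-symmetric : ∀ {x y} → (x , y) ∈ shadow → (y , x) ∈ shadow
  shadow-symmetric {x} {y} xy∈ with ∈-filter⁻ adj? {xs = cartesianProduct (upTo n) (upTo n)} xy∈
  ... | ∈p , a = let x< , y< = ∈-cartesianProduct⁻ (upTo n) (upTo n) ∈p in
    ∈-filter⁺ adj? (∈-cartesianProduct⁺ y< x<) (Any.map swap a)

  shadow-adj : ∀ {x y} → (x , y) ∈ shadow → ∃[ f ] f ∈ F × f ∋ x × f ∋ y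
  shadow-adj xy∈ = find (proj₂ (∈-filter⁻ adj? {xs = cartesianProduct (upTo n) (upTo n)} xy∈))

-- Rows and columns are to be read off one monotone map. It follows `p` while `q` is below suc M,
-- and `q` afterwards; capping `p` at `M` keeps the first part below the second, and `sep` puts the
-- row vertices into the first part.
crossing-glue : ∀ M xs p q → Mono p → Mono q → (∀ {x y} → (x , y) ∈ xs → p x < suc M → q x < suc M) →
  (∀ {i j} → i < suc M → j < suc M → ∃[ x ] ∃[ y ] (x , y) ∈ xs × p x ≡ i × q y ≡ suc M + j) →
  ∃[ r ] Mono r × (∀ {i j} → i < suc M → j < suc M → ∃[ x ] ∃[ y ] (x , y) ∈ xs × r x ≡ i × r y ≡ suc M + j)
crossing-glue M xs p q mp mq sep hit = r , mr , λ i< j< → let x , y , xy∈ , px , qy = hit i< j< in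
  x , y , xy∈
    , trans (low (sep xy∈ (subst (_< suc M) (sym px) i<))) (trans (cong (_⊓ M) px) (m≤n⇒m⊓n≡m (≤-pred i<)))
    , trans (high (subst (suc M ≤_) (sym qy) (m≤m+n (suc M) _))) qy
  where
  r : ℕ → ℕ
  r x = if does (q x <? suc M) then p x ⊓ M else q x
  low : ∀ {x} → q x < suc M → r x ≡ p x ⊓ M
  low {x} l rewrite dec-true (q x <? suc M) l = refl
  high : ∀ {x} → suc M ≤ q x → r x ≡ q x
  high {x} h rewrite dec-false (q x <? suc M) (≤⇒≯ h) = refl
  mr : Mono r
  mr {x} {y} x≤y with q x <? suc M | q y <? suc M
  ... | yes l | yes l′ rewrite dec-true (q x <? suc M) l | dec-true (q y <? suc M) l′ = ⊓-monoˡ-≤ M (mp x≤y)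
  ... | yes l | no qy rewrite dec-true (q x <? suc M) l | dec-false (q y <? suc M) qy =
    ≤-trans (m⊓n≤n (p x) M) (≤-trans (n≤1+n M) (≮⇒≥ qy))
  ... | no qx | yes qy = contradiction (≤-<-trans (mq x≤y) qy) qx
  ... | no qx | no qy rewrite dec-false (q x <? suc M) qx | dec-false (q y <? suc M) qy = mq x≤y

-- Of the rows A_i and columns B_j, either A_M < B_{M+1} or B_M < A_{M+1}.
crossing-grid : ∀ n M xs → (∀ {x y} → (x , y) ∈ xs → (y , x) ∈ xs) → (∀ {x y} → (x , y) ∈ xs → x < n) →
                Grid (M + M) xs →
                ∃[ p ] Mono p × (∀ {i j} → i < M → j < M → ∃[ x ] ∃[ y ] (x , y) ∈ xs × p x ≡ i × p y ≡ M + j)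
crossing-grid n zero xs sm bd _ = id , id , λ ()
crossing-grid n M@(suc M-1) xs sm bd (p , q , mp , mq , hit)
  with anyUpTo? (λ x → (M ≤? q x) ×-dec (p x <? M)) n
... | no none = crossing-glue M-1 xs p q mp mq
        (λ xy∈ px<M → ≰⇒> (λ M≤qx → none (_ , bd xy∈ , M≤qx , px<M)))
        (λ i< j< → hit (<-≤-trans i< (m≤m+n M M)) (+-monoʳ-< M j<))
-- The first `M` column intervals lie before x₀ and the row intervals from `M` on lie after it. They
-- become the left and the right side, and the entries are transposed by symmetry.
... | yes (x₀ , _ , M≤qx₀ , px₀<M) = crossing-glue M-1 xs q p mq mp
        (λ {x} _ qx<M → ≰⇒> (λ M≤px → <⇒≱ qx<M (≤-trans M≤qx₀ (mq (<⇒≤ (mono-reflects-< mp (<-≤-trans px₀<M M≤px)))))))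
        (λ i< j< → let y , x , yx∈ , py , qx = hit (+-monoʳ-< M j<) (<-≤-trans i< (m≤m+n M M)) in
          x , y , sm yx∈ , qx , py)

-- Each small set covers few of the T diagonal cells of a T × T block of cells,
-- so distinct sets can be chosen greedily for the R × R blocks.
module DistinctCells {n : ℕ} (R s : ℕ) (F : List (Vec Bool n)) (small : ∀ {f} → f ∈ F → Small s f)
  (p : ℕ → ℕ) (mp : Mono p)
  (hit : ∀ {i j} → i < R * suc (R * R * s) → j < R * suc (R * R * s) →
         ∃[ x ] ∃[ y ] (x , y) ∈ shadow F × p x ≡ i × p y ≡ R * suc (R * R * s) + j) where

  -- Each of the `R * R` choices excludes at most `s` candidates of any block.
  T : ℕ
  T = suc (R * R * s)

  module Cell (g : Fin (R * R)) (t : Fin T) where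
    I J : Fin R
    I = proj₁ (remQuot {R} R g)
    J = proj₂ (remQuot {R} R g)
    cell< : ∀ (i : Fin R) → toℕ i * T + toℕ t < R * T
    cell< i = <-≤-trans (+-monoʳ-< (toℕ i * T) (Fin.toℕ<n t))
      (≤-trans (≤-reflexive (+-comm (toℕ i * T) T)) (*-monoˡ-≤ T (Fin.toℕ<n i)))
    abstract
      cellSet : ∃[ f ] f ∈ F × (∃[ x ] f ∋ x × p x ≡ toℕ I * T + toℕ t) ×
                (∃[ y ] f ∋ y × p y ≡ R * T + (toℕ J * T + toℕ t))
      cellSet = let x , y , xy∈ , px , py = hit (cell< I) (cell< J)
                    f , f∈ , fx , fy = shadow-adj F xy∈
                in f , f∈ , (x , fx , px) , (y , fy , py)
    cand : Vec Bool n
    cand = proj₁ cellSet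
    cand∈ : cand ∈ F
    cand∈ = proj₁ (proj₂ cellSet)
    row : ∃[ x ] cand ∋ x × p x ≡ toℕ I * T + toℕ t
    row = proj₁ (proj₂ (proj₂ cellSet))
    col : ∃[ x ] cand ∋ x × p x ≡ R * T + (toℕ J * T + toℕ t)
    col = proj₂ (proj₂ (proj₂ cellSet))
  open Cell

  -- The diagonal cells of a block lie in different fine rows, so a set serving several of them has
  -- a different vertex for each.
  bound : ∀ g t → Greedy.bounded _≟ᵛ_ s T cand (cand g t)
  bound g t g′ = subst (_≤ s) (length-map pt ts)
    (small (cand∈ g t) (map pt ts)
      (map-unique pt (λ {a} {b} _ _ eq → Fin.toℕ-injective (+-cancelˡ-≡ _ _ _
         (trans (sym (proj₂ (proj₂ (row g′ a)))) (trans (cong p eq) (proj₂ (proj₂ (row g′ b)))))))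
        (Unique.filter⁺ (λ t′ → cand g t ≟ᵛ cand g′ t′) (Unique.allFin⁺ T)))
      (λ x∈ → let a , a∈ , eq = ∈-map⁻ pt x∈ ; _ , same = ∈-filter⁻ (λ t′ → cand g t ≟ᵛ cand g′ t′) {xs = allFin T} a∈ in
        subst₂ _∋_ (sym same) (sym eq) (proj₁ (proj₂ (row g′ a)))))
    where
    pt = λ t′ → proj₁ (row g′ t′)
    ts = filter (λ t′ → cand g t ≟ᵛ cand g′ t′) (allFin T)

  fromChoice : (τ : Fin (R * R) → Fin T) → (∀ {g g′} → g Fin.< g′ → cand g (τ g) ≢ cand g′ (τ g′)) → EdgeGrid R F
  fromChoice τ diff = record
    { p = λ x → p x / T
    ; mono = /-monoˡ-≤ T ∘ mp
    ; e = e
    ; member = λ i j → cand∈ (combine i j) (τ (combine i j))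
    ; left = left
    ; right = right
    ; distinct = λ {i} {j} {i′} {j′} eq → Fin.combine-injective i j i′ j′ (same (combine i j) (combine i′ j′) eq)
    }
    where
    e : Fin R → Fin R → Vec Bool n
    e i j = cand (combine i j) (τ (combine i j))
    left : ∀ i j → Meets (λ x → p x / T) (e i j) (toℕ i)
    left i j = let x , ex , px = row (combine i j) (τ (combine i j)) in x , ex ,
        trans (cong (_/ T) px) (trans (div-block _ T (Fin.toℕ<n (τ (combine i j)))) (cong (toℕ ∘ proj₁) (Fin.remQuot-combine i j)))
    right : ∀ i j → Meets (λ x → p x / T) (e i j) (R + toℕ j)
    right i j = let x , ex , px = col (combine i j) t in x , ex ,
        trans (cong (_/ T) (trans px (trans (sym (+-assoc (R * T) (toℕ J′ * T) (toℕ t))) (cong (_+ toℕ t) (sym (*-distribʳ-+ T R (toℕ J′)))))))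
          (trans (div-block (R + toℕ J′) T (Fin.toℕ<n t)) (cong (λ z → R + toℕ (proj₂ z)) (Fin.remQuot-combine i j)))
      where
      t = τ (combine i j)
      J′ = J (combine i j) t
    same : ∀ g g′ → cand g (τ g) ≡ cand g′ (τ g′) → g ≡ g′
    same g g′ eq with Fin.<-cmp g g′
    ... | tri< l _ _ = contradiction eq (diff l)
    ... | tri≈ _ g≡ _ = g≡
    ... | tri> _ _ l = contradiction (sym eq) (diff l)

  grid : EdgeGrid R F
  grid = let τ , _ , diff = Greedy.select _≟ᵛ_ s T (R * R) cand [] ≤-refl (λ ()) bound in fromChoice τ (λ {g} {g′} → diff {g} {g′})

shadow-grid⇒edgeGrid : ∀ {n} R s (F : List (Vec Bool n)) → (∀ {f} → f ∈ F → Small s f) →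
                       let M = R * suc (R * R * s) in Grid (M + M) (shadow F) → EdgeGrid R F
shadow-grid⇒edgeGrid {n} R s F small gr =
  let p , mp , hit = crossing-grid n (R * suc (R * R * s)) (shadow F) (shadow-symmetric F)
         (λ xy∈ → ∈-upTo⁻ (proj₁ (∈-cartesianProduct⁻ (upTo n) (upTo n)
            (proj₁ (∈-filter⁻ (adj? F) {xs = cartesianProduct (upTo n) (upTo n)} xy∈))))) gr
  in DistinctCells.grid R s F small p mp hit

-- `skip v` enumerates the numbers other than `v`. To act on intervals, its left inverse `unskip v`
-- must be monotone on all of ℕ, so it merges `v` with its successor.
skip unskip : ℕ → ℕ → ℕ
skip zero    x       = suc x
skip (suc v) zero    = zero
skip (suc v) (suc x) = suc (skip v x)
unskip zero    zero    = zero
unskip zero    (suc x) = x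
unskip (suc v) zero    = zero
unskip (suc v) (suc x) = suc (unskip v x)

unskip-skip : ∀ v x → unskip v (skip v x) ≡ x
unskip-skip zero    x       = refl
unskip-skip (suc v) zero    = refl
unskip-skip (suc v) (suc x) = cong suc (unskip-skip v x)

skip-unskip : ∀ v x → x ≢ v → skip v (unskip v x) ≡ x
skip-unskip zero    zero    ne = contradiction refl ne
skip-unskip zero    (suc x) ne = refl
skip-unskip (suc v) zero    ne = refl
skip-unskip (suc v) (suc x) ne = cong suc (skip-unskip v x (ne ∘ cong suc))

unskip-mono : ∀ v → Mono (unskip v)
unskip-mono zero    {zero}          _         = z≤n
unskip-mono zero    {suc x} {suc y} (s≤s x≤y) = x≤y
unskip-mono (suc v) {zero}          _         = z≤n
unskip-mono (suc v) {suc x} {suc y} (s≤s x≤y) = s≤s (unskip-mono v x≤y)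

del : ∀ {n} → ℕ → Vec Bool (suc n) → Vec Bool n
del         zero    (b ∷ e) = e
del {zero}  (suc v) (b ∷ e) = []
del {suc n} (suc v) (b ∷ e) = b ∷ del v e

at-del : ∀ {n} v (e : Vec Bool (suc n)) x → v < suc n → at (del v e) x ≡ at e (skip v x)
at-del         zero    (b ∷ e) x       _       = refl
at-del {suc n} (suc v) (b ∷ e) zero    _       = refl
at-del {suc n} (suc v) (b ∷ e) (suc x) (s<s l) = at-del v e x l
at-del {zero}  (suc v) (b ∷ e) x       (s<s ())

del-injective : ∀ {n} v (e e′ : Vec Bool (suc n)) → v < suc n → at e v ≡ at e′ v → del v e ≡ del v e′ → e ≡ e′
del-injective v e e′ v< eq deq = at-ext lem
  where
  lem : ∀ {x} → x < _ → at e x ≡ at e′ x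
  lem {x} _ with x ≟ v
  ... | yes refl = eq
  ... | no x≢v = trans (sym (pull e)) (trans (cong (λ w → at w (unskip v x)) deq) (pull e′))
    where
    pull : ∀ w → at (del v w) (unskip v x) ≡ at w x
    pull w = trans (at-del v w (unskip v x) v<) (cong (at w) (skip-unskip v x x≢v))

product-filter-lower : ∀ {A B : Set} {P : A × B → Set} (P? : ∀ z → Dec (P z)) k (xs : List A) (ys : List B) →
  (∀ {x} → x ∈ xs → k ≤ length (filter (λ y → P? (x , y)) ys)) →
  length xs * k ≤ length (filter P? (cartesianProduct xs ys))
product-filter-lower P? k [] ys h = z≤n
product-filter-lower P? k (x ∷ xs) ys h = begin
  k + length xs * k ≤⟨ +-mono-≤ (h (here refl)) (product-filter-lower P? k xs ys (h ∘ there)) ⟩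
  length (filter (λ y → P? (x , y)) ys) + length (filter P? (cartesianProduct xs ys))
    ≡⟨ cong (_+ _) (sym (length-filter-map P? (x ,_) ys)) ⟩
  length (filter P? (map (x ,_) ys)) + length (filter P? (cartesianProduct xs ys))
    ≡⟨ sym (length-++ (filter P? (map (x ,_) ys))) ⟩
  length (filter P? (map (x ,_) ys) ++ filter P? (cartesianProduct xs ys))
    ≡⟨ cong length (sym (filter-++ P? (map (x ,_) ys) _)) ⟩
  length (filter P? (map (x ,_) ys ++ cartesianProduct xs ys)) ∎
  where open ≤-Reasoning

boolLists : ℕ → List (List Bool)
boolLists zero    = [] ∷ []
boolLists (suc n) = map (true ∷_) (boolLists n) ++ map (false ∷_) (boolLists n)

∈-boolLists : ∀ l → l ∈ boolLists (length l)
∈-boolLists [] = here refl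
∈-boolLists (true ∷ l) = ∈-++⁺ˡ (∈-map⁺ (true ∷_) (∈-boolLists l))
∈-boolLists (false ∷ l) = ∈-++⁺ʳ (map (true ∷_) (boolLists (length l))) (∈-map⁺ (false ∷_) (∈-boolLists l))

length-boolLists : ∀ n → length (boolLists n) ≡ 2 ^ n
length-boolLists zero = refl
length-boolLists (suc n) = trans (length-++ (map (true ∷_) (boolLists n)))
  (cong₂ _+_ (trans (length-map _ (boolLists n)) (length-boolLists n))
             (trans (trans (length-map _ (boolLists n)) (length-boolLists n)) (sym (+-identityʳ (2 ^ n)))))

module _ {n} (F : List (Vec Bool n)) where

  neighbours : ℕ → List ℕ
  neighbours v = filter (λ u → adj? F (v , u)) (upTo n)

  star : ℕ → List (Vec Bool n)
  star v = filter (_∋? v) F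

  star-bound : Unique F → ∀ v → length (star v) ≤ 2 ^ length (neighbours v)
  star-bound u v = ≤-trans
    (cover-≤ (λ f w → ListP.≡-dec Bool._≟_ (map (at f) N) w) (boolLists (length N)) (Unique.filter⁺ (_∋? v) u)
      (λ {f} _ → _ , subst (λ k → map (at f) N ∈ boolLists k) (length-map (at f) N) (∈-boolLists (map (at f) N)) , refl)
      (λ {f} {f′} f∈ f′∈ p q → at-ext (λ {x} _ → agree {f} {f′} f∈ f′∈ (trans p (sym q)) x)))
    (≤-reflexive (length-boolLists (length N)))
    where

    N = neighbours v
    covered : ∀ {f x} → f ∈ star v → f ∋ x → x ∈ N
    covered {f} f∈ fx = let f∈F , fv = ∈-filter⁻ (_∋? v) {xs = F} f∈ in
      ∈-filter⁺ (λ u → adj? F (v , u)) (∈-upTo⁺ (∋-bound f fx)) (lose f∈F (fv , fx))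
    onList : ∀ {f f′ : Vec Bool n} (l : List ℕ) → map (at f) l ≡ map (at f′) l → ∀ {x} → x ∈ l → at f x ≡ at f′ x
    onList (y ∷ l) eq (here refl) = proj₁ (ListP.∷-injective eq)
    onList {f} {f′} (y ∷ l) eq (there x∈) = onList {f} {f′} l (proj₂ (ListP.∷-injective eq)) x∈
    agree : ∀ {f f′} → f ∈ star v → f′ ∈ star v → map (at f) N ≡ map (at f′) N → ∀ x → at f x ≡ at f′ x
    agree {f} {f′} f∈ f′∈ eq x with f ∋? x | f′ ∋? x
    ... | yes fx | _      = onList {f} {f′} N eq (covered f∈ fx)
    ... | no _   | yes f′x = onList {f} {f′} N eq (covered f′∈ f′x)
    ... | no ¬fx | no ¬f′x = trans (∌-false {v = f} ¬fx) (sym (∌-false {v = f′} ¬f′x))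

  low-degree : ∀ c → 0 < n → length (shadow F) ≤ c * n → ∃[ v ] v < n × length (neighbours v) ≤ c
  low-degree c 0<n sh with anyUpTo? (λ v → length (neighbours v) ≤? c) n
  ... | yes r = r
  ... | no none = contradiction
    (≤-trans (≤-reflexive (cong (_* suc c) (sym (length-upTo n))))
      (≤-trans (product-filter-lower (adj? F) (suc c) (upTo n) (upTo n) (λ {v} v∈ → ≰⇒> (λ le → none (v , ∈-upTo⁻ v∈ , le)))) sh))
    (<⇒≱ (subst (c * n <_) (*-comm (suc c) n) (m<n+m (c * n) 0<n)))

-- The shadow graph is hereditarily sparse, hence has a vertex of bounded degree;
-- the sets through it are subsets of its neighbourhood, and it can be deleted.
small-sets : ∀ R s → ∃[ D ] ∀ n (F : List (Vec Bool n)) → Unique F → (∀ {f} → f ∈ F → Small s f) →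
             ¬ EdgeGrid R F → length F ≤ D * n + 1
small-sets R s = 2 ^ c , bound
  where
  M = R * suc (R * R * s)
  c = proj₁ (marcusTardos (M + M))
  bound : ∀ n (F : List (Vec Bool n)) → Unique F → (∀ {f} → f ∈ F → Small s f) → ¬ EdgeGrid R F → length F ≤ 2 ^ c * n + 1
  -- With no vertices left the empty set may remain; this is the summand 1.
  bound zero F u small ¬grid = ≤-trans (length≤1 u (λ { {[]} {[]} _ _ → refl })) (m≤n+m 1 (2 ^ c * 0))
  bound (suc n) F u small ¬grid with low-degree F c z<s
    (proj₂ (marcusTardos (M + M)) (suc n) (shadow F)
      (Unique.filter⁺ (adj? F) (Unique.cartesianProduct⁺ (Unique.upTo⁺ (suc n)) (Unique.upTo⁺ (suc n))))
      (λ xy∈ → let a , b = ∈-cartesianProduct⁻ (upTo (suc n)) (upTo (suc n)) (proj₁ (∈-filter⁻ (adj? F) {xs = cartesianProduct (upTo (suc n)) (upTo (suc n))} xy∈))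
               in ∈-upTo⁻ a , ∈-upTo⁻ b)
      (¬grid ∘ shadow-grid⇒edgeGrid R s F small))
  ... | v , v< , deg = begin
    length F ≡⟨ length-filter-¬ (_∋? v) F ⟩
    length (star F v) + length F₀
      ≤⟨ +-mono-≤ (≤-trans (star-bound F u v) (^-monoʳ-≤ 2 deg))
           (≤-trans (≤-reflexive (sym (length-map (del v) F₀))) (bound n (map (del v) F₀) u₀ small₀ ¬grid₀)) ⟩
    2 ^ c + (2 ^ c * n + 1) ≡⟨ sym (+-assoc (2 ^ c) _ 1) ⟩
    2 ^ c + 2 ^ c * n + 1 ≡⟨ cong (_+ 1) (sym (*-suc (2 ^ c) n)) ⟩
    2 ^ c * suc n + 1 ∎
    where
    open ≤-Reasoning
    F₀ = filter (λ f → ¬? (f ∋? v)) F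
    spec : ∀ {f} → f ∈ F₀ → f ∈ F × ¬ f ∋ v
    spec = ∈-filter⁻ (λ f → ¬? (f ∋? v)) {xs = F}
    u₀ = map-unique (del v)
      (λ {f} {f′} f∈ f′∈ → del-injective v f f′ v< (trans (∌-false {v = f} (proj₂ (spec f∈))) (sym (∌-false {v = f′} (proj₂ (spec f′∈))))))
      (Unique.filter⁺ (λ f → ¬? (f ∋? v)) u)
    small₀ : ∀ {g} → g ∈ map (del v) F₀ → Small s g
    small₀ g∈ xs uxs sub with ∈-map⁻ (del v) g∈
    ... | f , f∈ , refl = subst (_≤ s) (length-map (skip v) xs)
      (small (proj₁ (spec f∈)) (map (skip v) xs)
        (map-unique (skip v) (λ {x} {y} _ _ eq → trans (sym (unskip-skip v x)) (trans (cong (unskip v) eq) (unskip-skip v y))) uxs)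
        (λ z∈ → let x , x∈ , eq = ∈-map⁻ (skip v) z∈ in subst (f ∋_) (sym eq) (trans (sym (at-del v f x v<)) (sub x∈))))
    ¬grid₀ : ¬ EdgeGrid R (map (del v) F₀)
    ¬grid₀ = ¬grid ∘ edgeGrid-lift (del v) (unskip v) (unskip-mono v)
      (λ g∈ → let f , f∈ , eq = ∈-map⁻ (del v) g∈ in f , proj₁ (spec f∈) , eq)
      (λ {f} {x} _ h → skip v x , trans (sym (at-del v f x v<)) h , unskip-skip v x)

rank-suc : ∀ D n → rank D (suc n) ≡ (if D 0 then 1 else 0) + rank (D ∘ suc) n
rank-suc D zero    = refl
rank-suc D (suc n) = trans (cong ((if D (suc n) then 1 else 0) +_) (rank-suc D n))
  (m+[n+o]≡n+[m+o] (if D (suc n) then 1 else 0) (if D 0 then 1 else 0) (rank (D ∘ suc) n))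
  where
  m+[n+o]≡n+[m+o] : ∀ m n o → m + (n + o) ≡ n + (m + o)
  m+[n+o]≡n+[m+o] = solve-∀

∣∣≡rank : ∀ {n} (e : Vec Bool n) → ∣ e ∣ ≡ rank (at e) n
∣∣≡rank [] = refl
∣∣≡rank {suc n} (true ∷ e) = trans (cong suc (∣∣≡rank e)) (sym (rank-suc (at (true ∷ e)) n))
∣∣≡rank {suc n} (false ∷ e) = trans (∣∣≡rank e) (sym (rank-suc (at (false ∷ e)) n))

small-∣∣ : ∀ {n} (e : Vec Bool n) → Small ∣ e ∣ e
small-∣∣ {n} e xs u sub = subst (length xs ≤_) (sym (∣∣≡rank e))
  (length≤rank (at e) n u (λ x∈ → ∋-bound e (sub x∈) , sub x∈))

weight : ∀ {n} → List (Vec Bool n) → ℕ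
weight E = sum (map ∣_∣ E)

module _ {n : ℕ} {P : Vec Bool n → Set} (P? : ∀ e → Dec (P e)) where
  weight-filter : ∀ E → weight E ≡ weight (filter P? E) + weight (filter (λ e → ¬? (P? e)) E)
  weight-filter [] = refl
  weight-filter (e ∷ E) with P? e
  ... | yes _ = trans (cong (∣ e ∣ +_) (weight-filter E)) (sym (+-assoc ∣ e ∣ _ _))
  ... | no  _ = trans (cong (∣ e ∣ +_) (weight-filter E)) (lem ∣ e ∣ (weight (filter P? E)) _)
    where
    lem : ∀ m n o → m + (n + o) ≡ n + (m + o)
    lem = solve-∀

weight-bounded : ∀ {n} s (E : List (Vec Bool n)) → (∀ {e} → e ∈ E → ∣ e ∣ ≤ s) → weight E ≤ length E * s
weight-bounded s [] h = z≤n
weight-bounded s (e ∷ E) h = +-mono-≤ (h (here refl)) (weight-bounded s E (h ∘ there))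

module _ {A B : Set} (g : A → List B) where
  dependentPairs : List A → List (A × B)
  dependentPairs []       = []
  dependentPairs (x ∷ xs) = map (x ,_) (g x) ++ dependentPairs xs

  ∈-dependentPairs⁻ : ∀ xs {x y} → (x , y) ∈ dependentPairs xs → x ∈ xs × y ∈ g x
  ∈-dependentPairs⁻ (x ∷ xs) z∈ with ∈-++⁻ (map (x ,_) (g x)) z∈
  ... | inj₂ z∈′ = let a , b = ∈-dependentPairs⁻ xs z∈′ in there a , b
  ... | inj₁ z∈′ with ∈-map⁻ (x ,_) z∈′
  ...   | y , y∈ , refl = here refl , y∈

  dependentPairs-unique : (∀ x → Unique (g x)) → ∀ {xs} → Unique xs → Unique (dependentPairs xs)
  dependentPairs-unique ug {[]} [] = []
  dependentPairs-unique ug {x ∷ xs} (x∉ ∷ u) = Unique.++⁺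
    (map-unique (x ,_) (λ { _ _ refl → refl }) (ug x)) (dependentPairs-unique ug u)
    (λ (z∈ , z∈′) → case ∈-map⁻ (x ,_) z∈ of λ { (y , y∈ , refl) →
      All.lookup x∉ (proj₁ (∈-dependentPairs⁻ xs z∈′)) refl })

module Chunks (R : ℕ) where

  s : ℕ
  -- A full chunk offers a vertex for each of the R + R intervals of a grid; the successor keeps the
  -- divisor positive.
  s = suc (R + R)

  chunk : ∀ {n} → Vec Bool n × ℕ → Vec Bool n
  chunk {n} (e , c) = vec n (λ x → at e x ∧ does (rank (at e) x / s ≟ c))

  ∈-chunk⁻ : ∀ {n} (e : Vec Bool n) c {x} → chunk (e , c) ∋ x → e ∋ x × rank (at e) x / s ≡ c
  ∈-chunk⁻ e c {x} h =
    let a , b = ∧-true (trans (sym (at-vec (λ x → at e x ∧ does (rank (at e) x / s ≟ c)) (∋-bound (chunk (e , c)) h))) h)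
    in a , decide (rank (at e) x / s ≟ c) b
    where
    ∧-true : ∀ {a b} → a ∧ b ≡ true → a ≡ true × b ≡ true
    ∧-true {true} {true} _ = refl , refl

  ∈-chunk⁺ : ∀ {n} (e : Vec Bool n) c {x} → e ∋ x → rank (at e) x / s ≡ c → chunk (e , c) ∋ x
  ∈-chunk⁺ e c {x} ex r = trans (at-vec (λ x → at e x ∧ does (rank (at e) x / s ≟ c)) (∋-bound e ex))
    (cong₂ _∧_ ex (dec-true (rank (at e) x / s ≟ c) r))

  chunk-small : ∀ {n} (e : Vec Bool n) c → Small s (chunk (e , c))
  chunk-small e c xs u sub = subst (length xs ≤_) (length-upTo s)
    (cover-≤ (λ x i → rank (at e) x % s ≟ i) (upTo s) u
      (λ {x} _ → _ , ∈-upTo⁺ (m%n<n (rank (at e) x) s) , refl)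
      (λ {x} {y} x∈ y∈ p q → let ex , rx = ∈-chunk⁻ e c (sub x∈) ; ey , ry = ∈-chunk⁻ e c (sub y∈) in
        rank-injective (at e) ex ey (trans (m≡m%n+[m/n]*n _ s)
          (trans (cong₂ (λ a b → a + b * s) (trans p (sym q)) (trans rx (sym ry))) (sym (m≡m%n+[m/n]*n _ s))))))

  Full : ∀ {n} → Vec Bool n → ℕ → Set
  Full e c = c < ∣ e ∣ / s

  chunk-hit : ∀ {n} (e : Vec Bool n) c {i} → Full e c → i < s → ∃[ x ] chunk (e , c) ∋ x × rank (at e) x ≡ c * s + i
  chunk-hit {n} e c {i} full i<s with rank-hit (at e) n {c * s + i} (subst (c * s + i <_) (∣∣≡rank e)
      (<-≤-trans (+-monoʳ-< (c * s) i<s) (≤-trans (≤-trans (≤-reflexive (+-comm (c * s) s)) (*-monoˡ-≤ s full)) (m/n*n≤m ∣ e ∣ s))))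
  ... | x , _ , ex , rx = x , ∈-chunk⁺ e c ex (trans (cong (_/ s) rx) (div-block c s i<s)) , rx

  pieces : ∀ {n} → List (Vec Bool n) → List (Vec Bool n × ℕ)
  pieces = dependentPairs (λ e → upTo (∣ e ∣ / s))

  piece-full : ∀ {n} (E : List (Vec Bool n)) {e c} → (e , c) ∈ pieces E → e ∈ E × Full e c
  piece-full E z∈ = let a , b = ∈-dependentPairs⁻ (λ e → upTo (∣ e ∣ / s)) E z∈ in a , ∈-upTo⁻ b

  -- Only full chunks are kept. Each edge has at least one, and the discarded remainder is shorter
  -- than a chunk, so at most half of the edge is lost.
  weight-pieces : ∀ {n} (E : List (Vec Bool n)) → (∀ {e} → e ∈ E → s ≤ ∣ e ∣) → weight E ≤ length (pieces E) * (s + s)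
  weight-pieces [] h = z≤n
  weight-pieces (e ∷ E) h = begin
    ∣ e ∣ + weight E ≤⟨ +-mono-≤ half (weight-pieces E (h ∘ there)) ⟩
    k * (s + s) + length (pieces E) * (s + s) ≡⟨ sym (*-distribʳ-+ (s + s) k _) ⟩
    (k + length (pieces E)) * (s + s)
      ≡⟨ cong (_* (s + s)) (cong (_+ length (pieces E)) (sym (trans (length-map (e ,_) (upTo k)) (length-upTo k)))) ⟩
    (length (map (e ,_) (upTo k)) + length (pieces E)) * (s + s) ≡⟨ cong (_* (s + s)) (sym (length-++ (map (e ,_) (upTo k)))) ⟩
    length (pieces (e ∷ E)) * (s + s) ∎
    where
    open ≤-Reasoning
    k = ∣ e ∣ / s
    half : ∣ e ∣ ≤ k * (s + s)
    half = begin
      ∣ e ∣ ≡⟨ m≡m%n+[m/n]*n ∣ e ∣ s ⟩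
      ∣ e ∣ % s + k * s ≤⟨ +-monoˡ-≤ (k * s) (≤-trans (<⇒≤ (m%n<n ∣ e ∣ s)) (≤-trans (≤-reflexive (sym (*-identityˡ s))) (*-monoˡ-≤ s (m≥n⇒m/n>0 (h (here refl)))))) ⟩
      k * s + k * s ≡⟨ sym (*-distribˡ-+ k s s) ⟩
      k * (s + s) ∎

  chunks : ∀ {n} → List (Vec Bool n) → List (Vec Bool n)
  chunks E = ded _≟ᵛ_ (map chunk (pieces E))

  chunks⁻ : ∀ {n} (E : List (Vec Bool n)) {f} → f ∈ chunks E → ∃[ e ] ∃[ c ] (e , c) ∈ pieces E × f ≡ chunk (e , c)
  chunks⁻ E f∈ = let (e , c) , z∈ , eq = ∈-map⁻ chunk (∈-ded⁻ _≟ᵛ_ {map chunk (pieces E)} f∈) in e , c , z∈ , eq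

  -- Distinct chunks of one edge are separated by order, so at most one of them
  -- crosses the cut between the left and the right intervals of a grid.
  chunks-grid : ∀ {n} (E : List (Vec Bool n)) → EdgeGrid R (chunks E) → EdgeGrid R E
  chunks-grid {n} E K = record
    { p = p ; mono = mono
    ; e = parent
    ; member = λ i j → proj₁ (piece-full E (inPieces i j))
    ; left = λ i j → let x , fx , px = left i j in x , proj₁ (∈-chunk⁻ (parent i j) (index i j) (subst (_∋ x) (isChunk i j) fx)) , px
    ; right = λ i j → let x , fx , px = right i j in x , proj₁ (∈-chunk⁻ (parent i j) (index i j) (subst (_∋ x) (isChunk i j) fx)) , px
    ; distinct = λ {i} {j} {i′} {j′} eq → distinct (trans (isChunk i j) (trans (cong chunk (cong₂ _,_ eq (sameIndex i j i′ j′ eq))) (sym (isChunk i′ j′))))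
    }
    where
    open EdgeGrid K
    parent : Fin R → Fin R → Vec Bool n
    parent i j = proj₁ (chunks⁻ E (member i j))
    index : Fin R → Fin R → ℕ
    index i j = proj₁ (proj₂ (chunks⁻ E (member i j)))
    inPieces : ∀ i j → (parent i j , index i j) ∈ pieces E
    inPieces i j = proj₁ (proj₂ (proj₂ (chunks⁻ E (member i j))))
    isChunk : ∀ i j → e i j ≡ chunk (parent i j , index i j)
    isChunk i j = proj₂ (proj₂ (proj₂ (chunks⁻ E (member i j))))
    notBefore : ∀ i j i′ j′ → parent i j ≡ parent i′ j′ → ¬ (index i j < index i′ j′)
    notBefore i j i′ j′ eq lt with right i j | left i′ j′
    ... | y , fy , py | x , fx , px
      with ∈-chunk⁻ (parent i j) (index i j) (subst (_∋ y) (isChunk i j) fy)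
         | ∈-chunk⁻ (parent i′ j′) (index i′ j′) (subst (_∋ x) (isChunk i′ j′) fx)
    ... | _ , ry | _ , rx = <⇒≱ (Fin.toℕ<n i′)
      (≤-trans (m≤m+n R (toℕ j)) (≤-trans (≤-reflexive (sym py)) (≤-trans (mono (<⇒≤ y<x)) (≤-reflexive px))))
      where
      y<x : y < x
      y<x = mono-reflects-< (rank-mono (at (parent i j)))
        (mono-reflects-< (/-monoˡ-≤ s) (subst₂ _<_ (sym ry) (sym (trans (cong (λ w → rank (at w) x / s) eq) rx)) lt))
    sameIndex : ∀ i j i′ j′ → parent i j ≡ parent i′ j′ → index i j ≡ index i′ j′
    sameIndex i j i′ j′ eq with <-cmp (index i j) (index i′ j′)
    ... | tri< lt _ _ = contradiction lt (notBefore i j i′ j′ eq)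
    ... | tri≈ _ c≡ _ = c≡
    ... | tri> _ _ gt = contradiction gt (notBefore i′ j′ i j (sym eq))

  -- All edges with the chunk `f` contain it, so its vertices supply the intervals for a grid of
  -- parallel edges. An edge has `f` as a chunk at one index only, so many pieces mean many edges.
  chunk-multiplicity : ∀ {n} (E : List (Vec Bool n)) → Unique E → ¬ EdgeGrid R E → ∀ f →
                       length (filter (λ z → chunk z ≟ᵛ f) (pieces E)) ≤ R * R
  chunk-multiplicity {n} E u ¬grid f = ≮⇒≥ many
    where
    zs = filter (λ z → chunk z ≟ᵛ f) (pieces E)
    spec : ∀ {e c} → (e , c) ∈ zs → e ∈ E × Full e c × chunk (e , c) ≡ f
    spec z∈ = let a , eq = ∈-filter⁻ (λ z → chunk z ≟ᵛ f) {xs = pieces E} z∈ ; e∈ , full = piece-full E a in e∈ , full , eq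
    first-injective : ∀ {z z′} → z ∈ zs → z′ ∈ zs → proj₁ z ≡ proj₁ z′ → z ≡ z′
    first-injective {e , c} {_ , c′} z∈ z′∈ refl = let _ , full , eq = spec z∈ ; _ , _ , eq′ = spec z′∈
                                                       x , x∈ , _ = chunk-hit e c {0} full z<s in
      cong (e ,_) (trans (sym (proj₂ (∈-chunk⁻ e c x∈))) (proj₂ (∈-chunk⁻ e c′ (subst (_∋ x) (trans eq (sym eq′)) x∈))))
    many : ¬ (R * R < length zs)
    many lt with nonempty {xs = zs} (≤-<-trans z≤n lt)
    ... | (e₀ , c₀) , z₀∈ with spec z₀∈
    -- The intervals come from the single edge `e₀`: its ranks, shifted by the start of the chunk,
    -- number the vertices of `f` from 0.
    ...   | _ , full , eq₀ = ¬grid (edgeGrid-parallel (λ x → rank (at e₀) x ∸ c₀ * s) (λ le → ∸-monoˡ-≤ (c₀ * s) (rank-mono (at e₀) le))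
        (map-unique proj₁ first-injective (Unique.filter⁺ (λ z → chunk z ≟ᵛ f)
          (dependentPairs-unique (λ e → upTo (∣ e ∣ / s)) (λ e → Unique.upTo⁺ (∣ e ∣ / s)) u)))
        (≤-trans (<⇒≤ lt) (≤-reflexive (sym (length-map proj₁ zs))))
        (λ e∈ → let _ , z∈ , eq = ∈-map⁻ proj₁ e∈ in subst (_∈ E) (sym eq) (proj₁ (spec z∈)))
        (λ {g} {i} e∈ i< → let (e , c) , z∈ , eq = ∈-map⁻ proj₁ e∈
                               x , x∈ , rx = chunk-hit e₀ c₀ {i} full (m<n⇒m<1+n i<)
                           in x , subst (_∋ x) (sym eq) (proj₁ (∈-chunk⁻ e c (subst (_∋ x) (trans eq₀ (sym (proj₂ (proj₂ (spec z∈))))) x∈)))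
                                , trans (cong (_∸ c₀ * s) rx) (m+n∸m≡n (c₀ * s) i)))

weight-bound : ∀ R → ∃[ w ] ∀ n (E : List (Vec Bool n)) → Unique E → ¬ EdgeGrid R E → weight E ≤ w * n
weight-bound R = w , bound
  where
  open Chunks R
  D = proj₁ (small-sets R s)
  -- The first summand is for the edges smaller than `s`. In the second, there are at most suc D * n
  -- different chunks, each belonging to at most `R * R` edges and accounting for weight at most s +
  -- s.
  w = suc D * s + suc D * (R * R) * (s + s)

  bound : ∀ n (E : List (Vec Bool n)) → Unique E → ¬ EdgeGrid R E → weight E ≤ w * n
  bound zero E u ¬grid = ≤-trans (weight-bounded 0 E (λ { {[]} _ → z≤n })) (≤-trans (≤-reflexive (*-zeroʳ (length E))) z≤n)
  bound n@(suc _) E u ¬grid = begin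
    weight E ≡⟨ weight-filter large? E ⟩
    weight big + weight little ≤⟨ +-mono-≤ big-bound little-bound ⟩
    suc D * n * (R * R) * (s + s) + suc D * n * s ≡⟨ arith (suc D) n (R * R) (s + s) s ⟩
    w * n ∎
    where
    open ≤-Reasoning
    arith : ∀ d n r t s → d * n * r * t + d * n * s ≡ (d * s + d * r * t) * n
    arith = solve-∀
    large? : ∀ (e : Vec Bool n) → Dec (s ≤ ∣ e ∣)
    large? e = s ≤? ∣ e ∣
    big = filter large? E
    little = filter (λ e → ¬? (large? e)) E
    linear : ∀ {k} → k ≤ D * n + 1 → k ≤ suc D * n
    linear {k} h = ≤-trans h (≤-trans (+-monoʳ-≤ (D * n) (s≤s z≤n)) (≤-reflexive (+-comm (D * n) n)))
    inE : ∀ {P : Vec Bool n → Set} (P? : ∀ e → Dec (P e)) → ¬ EdgeGrid R (filter P? E)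
    inE P? = ¬grid ∘ edgeGrid-lift id id id (λ g∈ → _ , proj₁ (∈-filter⁻ P? {xs = E} g∈) , refl) (λ _ h → _ , h , refl)
    little-bound : weight little ≤ suc D * n * s
    little-bound = ≤-trans (weight-bounded s little (λ e∈ → <⇒≤ (≰⇒> (proj₂ (∈-filter⁻ (λ e → ¬? (large? e)) {xs = E} e∈)))))
      (*-monoˡ-≤ s (linear (proj₂ (small-sets R s) n little (Unique.filter⁺ (λ e → ¬? (large? e)) u)
        (λ {f} f∈ xs ux sub → ≤-trans (small-∣∣ f xs ux sub) (<⇒≤ (≰⇒> (proj₂ (∈-filter⁻ (λ e → ¬? (large? e)) {xs = E} f∈)))))
        (inE (λ e → ¬? (large? e))))))
    big-bound : weight big ≤ suc D * n * (R * R) * (s + s)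
    big-bound = ≤-trans (weight-pieces big (λ e∈ → proj₂ (∈-filter⁻ large? {xs = E} e∈)))
      (*-monoˡ-≤ (s + s) (≤-trans
        (cover-bound (λ z f → chunk z ≟ᵛ f) (R * R) (chunks big) (pieces big)
          (λ z∈ → _ , ∈-ded⁺ _≟ᵛ_ (∈-map⁺ chunk z∈) , refl)
          (λ {f} _ → chunk-multiplicity big (Unique.filter⁺ large? u) (inE large?) f))
        (*-monoˡ-≤ (R * R) (linear (proj₂ (small-sets R s) n (chunks big) (ded-unique _≟ᵛ_ (map chunk (pieces big)))
          (λ f∈ → let e , c , _ , eq = chunks⁻ big f∈ in subst (Small s) (sym eq) (chunk-small e c))
          (inE large? ∘ chunks-grid big))))))

-- Counting by contraction

-- Doubling by recursion lets `contract` match two vertices at a time.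
dbl : ℕ → ℕ
dbl zero    = zero
dbl (suc n) = suc (suc (dbl n))

dbl≡+ : ∀ n → dbl n ≡ n + n
dbl≡+ zero    = refl
dbl≡+ (suc n) = cong suc (trans (cong suc (dbl≡+ n)) (sym (+-suc n n)))

contract : ∀ {n} → Vec Bool (dbl n) → Vec Bool n
contract {zero}  []          = []
contract {suc n} (a ∷ b ∷ e) = (a ∨ b) ∷ contract e

∈-contract : ∀ {n} (e : Vec Bool (dbl n)) {x} → contract e ∋ x → ∃[ y ] e ∋ y × ⌊ y /2⌋ ≡ x
∈-contract {zero} [] ()
∈-contract {suc n} (true ∷ b ∷ e) {zero} h = 0 , refl , refl
∈-contract {suc n} (false ∷ b ∷ e) {zero} h = 1 , h , refl
∈-contract {suc n} (a ∷ b ∷ e) {suc x} h = let y , ey , eq = ∈-contract e h in suc (suc y) , ey , cong suc eq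

prepend : ∀ {n} → Bool × Bool → Vec Bool (dbl n) → Vec Bool (dbl (suc n))
prepend (a , b) w = a ∷ b ∷ w

nonemptyPairs : List (Bool × Bool)
nonemptyPairs = (true , true) ∷ (true , false) ∷ (false , true) ∷ []

expansions : ∀ {n} → Vec Bool n → List (Vec Bool (dbl n))
expansions []          = [] ∷ []
expansions (true ∷ v)  = cartesianProductWith prepend nonemptyPairs (expansions v)
expansions (false ∷ v) = map (λ w → false ∷ false ∷ w) (expansions v)

∈-expansions : ∀ {n} (e : Vec Bool (dbl n)) → e ∈ expansions (contract e)
∈-expansions {zero} [] = here refl
∈-expansions {suc n} (false ∷ false ∷ e) = ∈-map⁺ (λ w → false ∷ false ∷ w) (∈-expansions e)
∈-expansions {suc n} (true ∷ true ∷ e) =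
  ∈-cartesianProductWith⁺ prepend {xs = nonemptyPairs} {a = true , true} (here refl) (∈-expansions e)
∈-expansions {suc n} (true ∷ false ∷ e) =
  ∈-cartesianProductWith⁺ prepend {xs = nonemptyPairs} {a = true , false} (there (here refl)) (∈-expansions e)
∈-expansions {suc n} (false ∷ true ∷ e) =
  ∈-cartesianProductWith⁺ prepend {xs = nonemptyPairs} {a = false , true} (there (there (here refl))) (∈-expansions e)

length-expansions : ∀ {n} (v : Vec Bool n) → length (expansions v) ≡ 3 ^ ∣ v ∣
length-expansions [] = refl
length-expansions (true ∷ v) =
  trans (length-cartesianProductWith prepend nonemptyPairs (expansions v)) (cong (3 *_) (length-expansions v))
length-expansions (false ∷ v) = trans (length-map _ (expansions v)) (length-expansions v)

infix 4 _≋_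
-- Edge families are compared as sets, so a cover may list them in any order and with repetitions.
_≋_ : ∀ {A : Set} → List A → List A → Set
xs ≋ ys = (∀ {x} → x ∈ xs → x ∈ ys) × (∀ {x} → x ∈ ys → x ∈ xs)

words : ∀ {A : Set} → ℕ → List A → List (List A)
words zero    xs = [] ∷ []
words (suc m) xs = cartesianProductWith _∷_ xs (words m xs)

length-words : ∀ {A : Set} m (xs : List A) → length (words m xs) ≡ length xs ^ m
length-words zero xs = refl
length-words (suc m) xs = trans (length-cartesianProductWith _∷_ xs (words m xs)) (cong (length xs *_) (length-words m xs))

∈-words : ∀ {A : Set} {xs : List A} w → (∀ {x} → x ∈ w → x ∈ xs) → w ∈ words (length w) xs
∈-words [] h = here refl
∈-words (x ∷ w) h = ∈-cartesianProductWith⁺ _∷_ (h (here refl)) (∈-words w (h ∘ there))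

-- Repeating an element pads a nonempty set of at most `m` elements to a word of length exactly `m`;
-- hence there are at most length xs ^ m such sets.
word-for : ∀ {A : Set} {xs ys : List A} m → 0 < length ys → length ys ≤ m → (∀ {x} → x ∈ ys → x ∈ xs) →
           ∃[ w ] w ∈ words m xs × w ≋ ys
word-for {xs = xs} {ys@(y ∷ _)} m _ le sub = w
  , subst (λ k → w ∈ words k xs) len (∈-words w (sub ∘ back)) , back , ∈-++⁺ˡ
  where
  w = ys ++ List.replicate (m ∸ length ys) y
  len : length w ≡ m
  len = trans (length-++ ys) (trans (cong (length ys +_) (ListP.length-replicate (m ∸ length ys))) (m+[n∸m]≡n le))
  replicated : ∀ k {x} → x ∈ List.replicate k y → x ∈ ys
  replicated (suc k) (here refl) = here refl
  replicated (suc k) (there x∈) = replicated k x∈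
  back : ∀ {x} → x ∈ w → x ∈ ys
  back x∈ with ∈-++⁻ ys x∈
  ... | inj₁ a = a
  ... | inj₂ b = replicated (m ∸ length ys) b

module Refinements (M : ℕ) where

  -- Each contracted edge receives a nonempty set of at most `M` preimages, written as a word of
  -- length `M`.
  refinements : ∀ {n} → List (Vec Bool n) → List (List (Vec Bool (dbl n)))
  refinements []      = [] ∷ []
  refinements (e ∷ C) = cartesianProductWith _++_ (words M (expansions e)) (refinements C)

  length-refinements : ∀ {n} (C : List (Vec Bool n)) → length (refinements C) ≡ 3 ^ (weight C * M)
  length-refinements [] = refl
  length-refinements (e ∷ C) = begin
    length (refinements (e ∷ C)) ≡⟨ length-cartesianProductWith _++_ (words M (expansions e)) (refinements C) ⟩
    length (words M (expansions e)) * length (refinements C)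
      ≡⟨ cong₂ _*_ (trans (length-words M (expansions e)) (trans (cong (_^ M) (length-expansions e)) (^-*-assoc 3 ∣ e ∣ M))) (length-refinements C) ⟩
    3 ^ (∣ e ∣ * M) * 3 ^ (weight C * M) ≡⟨ sym (^-distribˡ-+-* 3 (∣ e ∣ * M) (weight C * M)) ⟩
    3 ^ (∣ e ∣ * M + weight C * M) ≡⟨ cong (3 ^_) (sym (*-distribʳ-+ M ∣ e ∣ (weight C))) ⟩
    3 ^ ((∣ e ∣ + weight C) * M) ∎
    where open ≡-Reasoning

  refinements-complete : ∀ {n} (E : List (Vec Bool (dbl n))) (C : List (Vec Bool n)) →
    (∀ {c} → c ∈ C → ∃[ e ] e ∈ E × contract e ≡ c) →
    (∀ c → length (filter (λ e → contract e ≟ᵛ c) E) ≤ M) →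
    ∃[ F ] F ∈ refinements C × (∀ {e} → e ∈ F → e ∈ E) × (∀ {e} → e ∈ E → contract e ∈ C → e ∈ F)
  refinements-complete E [] onto few = [] , here refl , (λ ()) , λ _ ()
  refinements-complete E (c ∷ C) onto few
    with refinements-complete E C (onto ∘ there) few | onto (here refl)
  ... | F , F∈ , sound , complete | e₀ , e₀∈ , eq₀
    with word-for {xs = expansions c} {ys = filter (λ e → contract e ≟ᵛ c) E} M
      (∈⇒pos (∈-filter⁺ (λ e → contract e ≟ᵛ c) e₀∈ eq₀)) (few c)
      (λ {e} e∈ → subst (λ d → e ∈ expansions d) (proj₂ (∈-filter⁻ (λ e → contract e ≟ᵛ c) {xs = E} e∈)) (∈-expansions e))
    where
    ∈⇒pos : ∀ {A : Set} {x : A} {xs} → x ∈ xs → 0 < length xs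
    ∈⇒pos (here _) = z<s
    ∈⇒pos (there _) = z<s
  ... | w , w∈ , w⊆ , ⊆w = w ++ F , ∈-cartesianProductWith⁺ _++_ w∈ F∈
    , (λ e∈ → [ (λ a → proj₁ (∈-filter⁻ (λ e → contract e ≟ᵛ c) {xs = E} (w⊆ a))) , sound ]′ (∈-++⁻ w e∈))
    , λ { e∈ (here eq) → ∈-++⁺ˡ (⊆w (∈-filter⁺ (λ e → contract e ≟ᵛ c) e∈ eq))
        ; e∈ (there c∈) → ∈-++⁺ʳ w (complete e∈ c∈) }

edgeGrid-⊆ : ∀ {n R} {F G : List (Vec Bool n)} → (∀ {g} → g ∈ G → g ∈ F) → EdgeGrid R G → EdgeGrid R F
edgeGrid-⊆ sub = edgeGrid-lift id id id (λ g∈ → _ , sub g∈ , refl) (λ _ h → _ , h , refl)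

length-concatMap-≤ : ∀ {A B : Set} (f : A → List B) k xs → (∀ {x} → x ∈ xs → length (f x) ≤ k) →
                     length (concatMap f xs) ≤ length xs * k
length-concatMap-≤ f k [] h = z≤n
length-concatMap-≤ f k (x ∷ xs) h = ≤-trans (≤-reflexive (length-++ (f x)))
  (+-mono-≤ (h (here refl)) (length-concatMap-≤ f k xs (h ∘ there)))

Cover : ℕ → ℕ → ℕ → Set
Cover R n N = Σ (List (List (Vec Bool n))) λ 𝓛 → length 𝓛 ≤ N ×
  (∀ E → Unique E → ¬ EdgeGrid R E → ∃[ C ] C ∈ 𝓛 × C ≋ E)

module Counting (R : ℕ) where

  M : ℕ
  M = R * R + 3 ^ (R + R)
  open Refinements M

  w : ℕ
  w = proj₁ (weight-bound R)

  -- The two summands of `M` come from here. If `c` has fewer than R + R vertices, it has at most 3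
  -- ^ (R + R) preimages at all. Otherwise all preimages meet the pairs contracted to its first R +
  -- R vertices, and more than R * R of them would form a grid.
  fibre-bound : ∀ {n} (E : List (Vec Bool (dbl n))) → Unique E → ¬ EdgeGrid R E → ∀ c →
                length (filter (λ e → contract e ≟ᵛ c) E) ≤ M
  fibre-bound {n} E u ¬grid c with R + R ≤? ∣ c ∣
  ... | no small = begin
    length fib ≤⟨ unique-⊆-length _≟ᵛ_ {ys = expansions c} fib-unique
                    (λ {e} e∈ → subst (λ d → e ∈ expansions d) (proj₂ (spec e∈)) (∈-expansions e)) ⟩
    length (expansions c) ≡⟨ length-expansions c ⟩
    3 ^ ∣ c ∣ ≤⟨ ^-monoʳ-≤ 3 (<⇒≤ (≰⇒> small)) ⟩
    3 ^ (R + R) ≤⟨ m≤n+m _ (R * R) ⟩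
    M ∎
    where
    open ≤-Reasoning
    fib = filter (λ e → contract e ≟ᵛ c) E
    fib-unique = Unique.filter⁺ (λ e → contract e ≟ᵛ c) u
    spec : ∀ {e} → e ∈ fib → e ∈ E × contract e ≡ c
    spec = ∈-filter⁻ (λ e → contract e ≟ᵛ c) {xs = E}
  ... | yes big = ≤-trans (≮⇒≥ many) (m≤m+n (R * R) _)
    where
    fib = filter (λ e → contract e ≟ᵛ c) E
    spec : ∀ {e} → e ∈ fib → e ∈ E × contract e ≡ c
    spec = ∈-filter⁻ (λ e → contract e ≟ᵛ c) {xs = E}
    meets : ∀ {e i} → e ∈ fib → i < R + R → Meets (λ x → rank (at c) ⌊ x /2⌋) e i
    meets {e} e∈ i< with rank-hit (at c) n (<-≤-trans i< (subst (R + R ≤_) (∣∣≡rank c) big))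
    ... | x , _ , cx , rx with ∈-contract e (subst (_∋ x) (sym (proj₂ (spec e∈))) cx)
    ...   | y , ey , eq = y , ey , trans (cong (rank (at c)) eq) rx
    many : ¬ (R * R < length fib)
    many lt = ¬grid (edgeGrid-parallel (λ x → rank (at c) ⌊ x /2⌋) (rank-mono (at c) ∘ ⌊n/2⌋-mono)
      (Unique.filter⁺ (λ e → contract e ≟ᵛ c) u) (<⇒≤ lt) (proj₁ ∘ spec) meets)

  double : ∀ n N → Cover R n N → Cover R (dbl n) (N * 3 ^ (w * n * M))
  double n N (𝓛 , len , covers) = 𝓛₂ , length-bound , covers₂
    where
    light? : ∀ (C : List (Vec Bool n)) → Dec (weight C ≤ w * n)
    light? C = weight C ≤? w * n
    -- The contraction of a grid-free family is grid-free, hence light once repetitions are removed.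
    -- Dropping the heavy lists bounds the number of refinements of each remaining one.
    𝓛₁ = filter light? (map (ded _≟ᵛ_) 𝓛)
    𝓛₂ = concatMap refinements 𝓛₁
    length-bound : length 𝓛₂ ≤ N * 3 ^ (w * n * M)
    length-bound = ≤-trans
      (length-concatMap-≤ refinements (3 ^ (w * n * M)) 𝓛₁ (λ {C} C∈ → ≤-trans (≤-reflexive (length-refinements C))
        (^-monoʳ-≤ 3 (*-monoˡ-≤ M (proj₂ (∈-filter⁻ light? {xs = map (ded _≟ᵛ_) 𝓛} C∈))))))
      (*-monoˡ-≤ (3 ^ (w * n * M)) (≤-trans (length-filter light? (map (ded _≟ᵛ_) 𝓛)) (≤-trans (≤-reflexive (length-map _ 𝓛)) len)))
    covers₂ : ∀ E → Unique E → ¬ EdgeGrid R E → ∃[ F ] F ∈ 𝓛₂ × F ≋ E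
    covers₂ E u ¬grid = finish (covers E′ (ded-unique _≟ᵛ_ (map contract E)) ¬grid′)
      where
      E′ = ded _≟ᵛ_ (map contract E)
      E′⁻ : ∀ {c} → c ∈ E′ → ∃[ e ] e ∈ E × c ≡ contract e
      E′⁻ c∈ = ∈-map⁻ contract (∈-ded⁻ _≟ᵛ_ {map contract E} c∈)
      ¬grid′ : ¬ EdgeGrid R E′
      ¬grid′ = ¬grid ∘ edgeGrid-lift contract ⌊_/2⌋ ⌊n/2⌋-mono E′⁻ (λ {f} _ → ∈-contract f)
      finish : ∃[ C ] C ∈ 𝓛 × C ≋ E′ → ∃[ F ] F ∈ 𝓛₂ × F ≋ E
      finish (C , C∈ , C⊆ , ⊆C) with refinements-complete E (ded _≟ᵛ_ C)
        (λ c∈ → let e , e∈ , eq = E′⁻ (C⊆ (∈-ded⁻ _≟ᵛ_ {C} c∈)) in e , e∈ , sym eq) (fibre-bound E u ¬grid)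
      ... | F , F∈ , sound , complete = F
        , ∈-concatMap⁺ refinements (lose (∈-filter⁺ light? (∈-map⁺ (ded _≟ᵛ_) C∈)
            (proj₂ (weight-bound R) n (ded _≟ᵛ_ C) (ded-unique _≟ᵛ_ C) (¬grid′ ∘ edgeGrid-⊆ (C⊆ ∘ ∈-ded⁻ _≟ᵛ_ {C})))) F∈)
        , sound , λ e∈ → complete e∈ (∈-ded⁺ _≟ᵛ_ (⊆C (∈-ded⁺ _≟ᵛ_ (∈-map⁺ contract e∈))))

  single : Cover R 1 4
  single = ([] ∷ (o ∷ []) ∷ (i ∷ []) ∷ (o ∷ i ∷ []) ∷ []) , ≤-refl , covers
    where
    o i : Vec Bool 1
    o = false ∷ []
    i = true ∷ []
    covers : ∀ E → Unique E → ¬ EdgeGrid R E → ∃[ C ] C ∈ ([] ∷ (o ∷ []) ∷ (i ∷ []) ∷ (o ∷ i ∷ []) ∷ []) × C ≋ E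
    covers E _ _ with member? _≟ᵛ_ o E | member? _≟ᵛ_ i E
    ... | no ¬o | no ¬i = [] , here refl , (λ ()) , λ { {false ∷ []} h → contradiction h ¬o ; {true ∷ []} h → contradiction h ¬i }
    ... | yes p | no ¬i = _ , there (here refl) , (λ { (here refl) → p }) , λ { {false ∷ []} h → here refl ; {true ∷ []} h → contradiction h ¬i }
    ... | no ¬o | yes q = _ , there (there (here refl)) , (λ { (here refl) → q }) , λ { {false ∷ []} h → contradiction h ¬o ; {true ∷ []} h → here refl }
    ... | yes p | yes q = _ , there (there (there (here refl))) , (λ { (here refl) → p ; (there (here refl)) → q })
                          , λ { {false ∷ []} h → here refl ; {true ∷ []} h → there (here refl) }

  size : ℕ → ℕ
  size zero    = 1
  size (suc t) = dbl (size t)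

  size≡2^ : ∀ t → size t ≡ 2 ^ t
  size≡2^ zero    = refl
  size≡2^ (suc t) = trans (dbl≡+ (size t)) (cong₂ _+_ (size≡2^ t) (trans (size≡2^ t) (sym (+-identityʳ (2 ^ t)))))

  K : ℕ
  -- There are 4 families of subsets of one vertex; the other factor pays for doubling `s`, because
  -- K ^ s * 3 ^ (w * M * s) ≤ K ^ (s + s).
  K = 4 * 3 ^ (w * M)

  powers-of-two : ∀ t → Cover R (size t) (K ^ size t)
  powers-of-two zero = let 𝓛 , len , c = single in
    𝓛 , ≤-trans len (≤-trans (m≤m*n 4 (3 ^ (w * M)) {{m^n≢0 3 (w * M)}}) (≤-reflexive (sym (*-identityʳ K)))) , c
  powers-of-two (suc t) = let 𝓛 , len , c = double s (K ^ s) (powers-of-two t) in 𝓛 , ≤-trans len bound , c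
    where
    s = size t
    open ≤-Reasoning
    rearrange : ∀ w s m → w * s * m ≡ w * m * s
    rearrange = solve-∀
    bound : K ^ s * 3 ^ (w * s * M) ≤ K ^ dbl s
    bound = begin
      K ^ s * 3 ^ (w * s * M) ≡⟨ cong (λ z → K ^ s * 3 ^ z) (rearrange w s M) ⟩
      K ^ s * 3 ^ (w * M * s) ≡⟨ cong (K ^ s *_) (sym (^-*-assoc 3 (w * M) s)) ⟩
      K ^ s * (3 ^ (w * M)) ^ s ≤⟨ *-monoʳ-≤ (K ^ s) (^-monoˡ-≤ s (m≤n*m (3 ^ (w * M)) 4)) ⟩
      K ^ s * K ^ s ≡⟨ sym (^-distribˡ-+-* K s s) ⟩
      K ^ (s + s) ≡⟨ cong (K ^_) (sym (dbl≡+ s)) ⟩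
      K ^ dbl s ∎

  resize : ∀ {n} m → Vec Bool n → Vec Bool m
  resize m e = vec m (at e)

  resize-resize : ∀ {n m} → n ≤ m → (e : Vec Bool n) → resize n (resize m e) ≡ e
  resize-resize {n} {m} n≤m e = at-ext (λ x<n → trans (at-vec (at (resize m e)) x<n) (at-vec (at e) (<-≤-trans x<n n≤m)))

  -- Padding with isolated vertices to a power of two at most doubles `n`, which replaces `K` by its
  -- square.
  all-sizes : ∀ n → 0 < n → Cover R n ((K ^ 2) ^ n)
  all-sizes n 0<n with power-between 2 ≤-refl n 0<n
  ... | j , n≤ , ≤2n with powers-of-two j
  ...   | 𝓛 , len , covers = map (map (resize n)) 𝓛 , length-bound , covers′
    where
    m = size j
    n≤m : n ≤ m
    n≤m = ≤-trans n≤ (≤-reflexive (sym (size≡2^ j)))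
    instance
      K≢0 : NonZero K
      K≢0 = m*n≢0 4 (3 ^ (w * M)) {{_}} {{m^n≢0 3 (w * M)}}
    length-bound : length (map (map (resize n)) 𝓛) ≤ (K ^ 2) ^ n
    length-bound = ≤-trans (≤-reflexive (length-map _ 𝓛)) (≤-trans len (≤-trans
      (^-monoʳ-≤ K (≤-trans (≤-reflexive (size≡2^ j)) ≤2n)) (≤-reflexive (sym (^-*-assoc K 2 n)))))
    covers′ : ∀ E → Unique E → ¬ EdgeGrid R E → ∃[ C ] C ∈ map (map (resize n)) 𝓛 × C ≋ E
    covers′ E u ¬grid with covers (map (resize m) E)
      (map-unique (resize m) (λ {e} {e′} _ _ eq → trans (sym (resize-resize n≤m e)) (trans (cong (resize n) eq) (resize-resize n≤m e′))) u)
      (¬grid ∘ edgeGrid-lift (resize m) id id (∈-map⁻ (resize m))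
        (λ {f} {x} _ h → x , trans (sym (at-vec (at f) (∋-bound (resize m f) h))) h , refl))
    ... | C , C∈ , C⊆ , ⊆C = map (resize n) C , ∈-map⁺ (map (resize n)) C∈
      , (λ x∈ → let y , y∈ , eq = ∈-map⁻ (resize n) x∈ ; e , e∈ , eq′ = ∈-map⁻ (resize m) (C⊆ y∈) in
           subst (_∈ E) (sym (trans eq (trans (cong (resize n) eq′) (resize-resize n≤m e)))) e∈)
      , λ {e} e∈ → subst (_∈ map (resize n) C) (resize-resize n≤m e) (∈-map⁺ (resize n) (⊆C (∈-map⁺ (resize m) e∈)))

abstract
  exponential-count : ∀ R → ∃[ K ] ∀ n → 0 < n → Cover R n (K ^ n)
  exponential-count R = Counting.K R ^ 2 , Counting.all-sizes R

-- From edge grids to H⟨ π ⟩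

-- Containment of H⟨ π ⟩ in edge sets on the standard order: the traces on the
-- 2k chosen vertices of the k chosen edges are distinct.
Contains : ∀ {k n} → Permutation′ k → List (Vec Bool n) → Set
Contains {k} {n} π E = Σ (Fin (k + k) → Fin n) λ ι → Σ (Fin k → Fin (length E)) λ e →
  (∀ x y → x Fin.< y → ι x Fin.< ι y) ×
  (∀ i → Vec.lookup (List.lookup E (e i)) (ι (i ↑ˡ k)) ≡ true ×
         Vec.lookup (List.lookup E (e i)) (ι (k ↑ʳ (π ⟨$⟩ʳ i))) ≡ true) ×
  (∀ i j → i ≢ j → trace ι (List.lookup E (e i)) ≢ trace ι (List.lookup E (e j)))

at-lookup : ∀ {n} (e : Vec Bool n) i → at e (toℕ i) ≡ Vec.lookup e i
at-lookup (b ∷ e) Fin.zero    = refl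
at-lookup (b ∷ e) (Fin.suc i) = at-lookup e i

lookup-trace : ∀ {m n} (ι : Fin m → Fin n) e i → Vec.lookup (trace ι e) i ≡ Vec.lookup e (ι i)
lookup-trace ι e i = Vec.lookup∘tabulate (λ x → Vec.lookup e (ι x)) i

-- Two traces differ as soon as one chosen vertex tells the edges apart, so `differ` may also use
-- endpoints of other edges.
module _ {k n} (π : Permutation′ k) (E : List (Vec Bool n))
  (u w : Fin k → ℕ) (f : Fin k → Vec Bool n) (f∈ : ∀ i → f i ∈ E)
  (fu : ∀ i → f i ∋ u i) (fw : ∀ i → f i ∋ w (π ⟨$⟩ʳ i))
  (u-mono : ∀ {i j} → i Fin.< j → u i < u j) (w-mono : ∀ {i j} → i Fin.< j → w i < w j)
  (u<w : ∀ i j → u i < w j)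
  (differ : ∀ {i j} → i Fin.< j → (∃[ l ] at (f i) (u l) ≢ at (f j) (u l)) ⊎ (∃[ l ] at (f i) (w l) ≢ at (f j) (w l))) where

  private
    w< : ∀ j → w j < n
    w< j = ∋-bound (f i) (subst (λ z → f i ∋ w z) (Perm.inverseʳ π) (fw i))
      where i = π ⟨$⟩ˡ j
    pick : Fin k ⊎ Fin k → Fin n
    pick (inj₁ i) = fromℕ< (∋-bound (f i) (fu i))
    pick (inj₂ j) = fromℕ< (w< j)
    ι : Fin (k + k) → Fin n
    ι x = pick (Fin.splitAt k x)
    ι-left : ∀ i → toℕ (ι (i ↑ˡ k)) ≡ u i
    ι-left i = trans (cong (toℕ ∘ pick) (Fin.splitAt-↑ˡ k i k)) (Fin.toℕ-fromℕ< _)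
    ι-right : ∀ j → toℕ (ι (k ↑ʳ j)) ≡ w j
    ι-right j = trans (cong (toℕ ∘ pick) (Fin.splitAt-↑ʳ k k j)) (Fin.toℕ-fromℕ< _)
    value : ∀ e {y x} → toℕ (ι y) ≡ x → Vec.lookup e (ι y) ≡ at e x
    value e {y} eq = trans (sym (at-lookup e (ι y))) (cong (at e) eq)
    ι-mono : ∀ x y → x Fin.< y → ι x Fin.< ι y
    ι-mono x y x<y with Fin.splitAt k x in eqx | Fin.splitAt k y in eqy
    ... | inj₁ i | inj₁ j = subst₂ _<_ (sym (Fin.toℕ-fromℕ< _)) (sym (Fin.toℕ-fromℕ< _))
      (u-mono (subst₂ _<_ (trans (cong toℕ (sym (Fin.splitAt⁻¹-↑ˡ eqx))) (Fin.toℕ-↑ˡ i k)) (trans (cong toℕ (sym (Fin.splitAt⁻¹-↑ˡ eqy))) (Fin.toℕ-↑ˡ j k)) x<y))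
    ... | inj₁ i | inj₂ j = subst₂ _<_ (sym (Fin.toℕ-fromℕ< _)) (sym (Fin.toℕ-fromℕ< _)) (u<w i j)
    ... | inj₂ i | inj₁ j = contradiction x<y (<⇒≯ (subst₂ _<_
        (trans (sym (Fin.toℕ-↑ˡ j k)) (cong toℕ (Fin.splitAt⁻¹-↑ˡ eqy))) (trans (sym (Fin.toℕ-↑ʳ k i)) (cong toℕ (Fin.splitAt⁻¹-↑ʳ {k} eqx)))
        (<-≤-trans (Fin.toℕ<n j) (m≤m+n k (toℕ i)))))
    ... | inj₂ i | inj₂ j = subst₂ _<_ (sym (Fin.toℕ-fromℕ< _)) (sym (Fin.toℕ-fromℕ< _))
      (w-mono (+-cancelˡ-< k _ _ (subst₂ _<_ (trans (cong toℕ (sym (Fin.splitAt⁻¹-↑ʳ {k} eqx))) (Fin.toℕ-↑ʳ k i)) (trans (cong toℕ (sym (Fin.splitAt⁻¹-↑ʳ {k} eqy))) (Fin.toℕ-↑ʳ k j)) x<y)))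
    e : Fin k → Fin (length E)
    e i = Any.index (f∈ i)
    f≡ : ∀ i → f i ≡ List.lookup E (e i)
    f≡ i = lookup-index (f∈ i)
    separated : ∀ {i j} → i Fin.< j → trace ι (f i) ≢ trace ι (f j)
    separated {i} {j} i<j eq = [ (λ (l , ne) → ne (agree (ι-left l))) , (λ (l , ne) → ne (agree (ι-right l))) ]′ (differ i<j)
      where
      agree : ∀ {y x} → toℕ (ι y) ≡ x → at (f i) x ≡ at (f j) x
      agree {y} eqy = trans (sym (value (f i) eqy)) (trans (sym (lookup-trace ι (f i) y))
        (trans (cong (λ t → Vec.lookup t y) eq) (trans (lookup-trace ι (f j) y) (value (f j) eqy))))

  mkContains : Contains π E
  mkContains = ι , e , ι-mono
    , (λ i → trans (cong (λ v → Vec.lookup v (ι (i ↑ˡ k))) (sym (f≡ i))) (trans (value (f i) (ι-left i)) (fu i))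
           , trans (cong (λ v → Vec.lookup v (ι (k ↑ʳ (π ⟨$⟩ʳ i)))) (sym (f≡ i))) (trans (value (f i) (ι-right (π ⟨$⟩ʳ i))) (fw i)))
    , λ i j i≢j → subst₂ (λ a b → trace ι a ≢ trace ι b) (f≡ i) (f≡ j) (case Fin.<-cmp i j of λ
        { (tri< l _ _) → separated l ; (tri≈ _ eq _) → contradiction eq i≢j ; (tri> _ _ g) → separated g ∘ sym })

-- A step (x , b , e) of a comb: e takes the value b at x, and every later edge
-- takes the other value there.
Step : ℕ → Set
Step n = ℕ × Bool × Vec Bool n

Later : ∀ {n} → Step n → Step n → Set
Later (x , b , e) (x′ , b′ , e′) = x < x′ × at e′ x ≡ not b

Own : ∀ {n} → Step n → Set
Own (x , b , e) = at e x ≡ b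

record Comb {n} (zs : List (Vec Bool n)) (t : ℕ) : Set where
  constructor comb
  field
    steps   : List (Step n)
    long    : t ≤ length steps
    later   : AllPairs Later steps
    own     : ∀ {z} → z ∈ steps → Own z
    sources : ∀ {z} → z ∈ steps → proj₂ (proj₂ z) ∈ zs

headed : ∀ {n} → Bool → List (Vec Bool (suc n)) → List (Vec Bool (suc n))
headed b = filter (λ e → Vec.head e Bool.≟ b)

module _ {n} (b : Bool) (zs : List (Vec Bool (suc n))) where

  tails : List (Vec Bool n)
  tails = map Vec.tail (headed b zs)

  tails⁻ : ∀ {e} → e ∈ tails → (b ∷ e) ∈ zs
  tails⁻ e∈ with ∈-map⁻ Vec.tail e∈
  ... | (c ∷ e) , z∈ , refl with ∈-filter⁻ (λ e → Vec.head e Bool.≟ b) {xs = zs} z∈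
  ...   | z∈zs , refl = z∈zs

  tails-unique : Unique zs → Unique tails
  tails-unique u = map-unique Vec.tail
    (λ { {c ∷ e} {d ∷ e′} z∈ z∈′ refl → cong (_∷ e) (trans (head≡ z∈) (sym (head≡ z∈′))) })
    (Unique.filter⁺ (λ e → Vec.head e Bool.≟ b) u)
    where
    head≡ : ∀ {z} → z ∈ headed b zs → Vec.head z ≡ b
    head≡ = proj₂ ∘ ∈-filter⁻ (λ e → Vec.head e Bool.≟ b) {xs = zs}

  prolong : Step n → Step (suc n)
  prolong (x , c , e) = suc x , c , b ∷ e

  comb-tails : ∀ {t} → Comb tails t → Comb zs t
  comb-tails (comb ss long later own sources) = comb (map prolong ss)
    (≤-trans long (≤-reflexive (sym (length-map prolong ss))))
    (AllPairs.map⁺ (AllPairs.map (λ (lt , v) → s<s lt , v) later))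
    (λ z∈ → let _ , s∈ , eq = ∈-map⁻ prolong z∈ in subst Own (sym eq) (own s∈))
    (λ z∈ → let _ , s∈ , eq = ∈-map⁻ prolong z∈ in subst (λ z → proj₂ (proj₂ z) ∈ zs) (sym eq) (tails⁻ (sources s∈)))

  comb-branch : ∀ {t e} → (not b ∷ e) ∈ zs → Comb tails t → Comb zs (suc t)
  comb-branch {e = e} e∈ c@(comb ss long later own sources) =
    let comb ss′ long′ later′ own′ sources′ = comb-tails c in
    comb ((0 , not b , not b ∷ e) ∷ ss′) (s≤s long′)
      (All.map⁺ (All.tabulate (λ _ → z<s , sym (Bool.not-involutive b))) ∷ later′)
      (λ { (here refl) → refl ; (there z∈) → own′ z∈ })
      (λ { (here refl) → e∈ ; (there z∈) → sources′ z∈ })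

tails-split : ∀ {n} (zs : List (Vec Bool (suc n))) → length zs ≡ length (tails true zs) + length (tails false zs)
tails-split [] = refl
tails-split ((true ∷ e) ∷ zs) = cong suc (tails-split zs)
tails-split ((false ∷ e) ∷ zs) = trans (cong suc (tails-split zs)) (sym (+-suc _ _))

-- Follow the larger branch of the binary trie of zs, recording an edge of the
-- smaller branch whenever both are inhabited.
find-comb : ∀ {n} (zs : List (Vec Bool n)) t → Unique zs → 2 ^ t ≤ length zs → Comb zs t
find-comb zs zero u le = comb [] z≤n [] (λ ()) (λ ())
find-comb {zero} zs (suc t) u le = contradiction
  (≤-trans (+-mono-≤ (m^n>0 2 t) (≤-trans (m^n>0 2 t) (m≤m+n (2 ^ t) 0))) (≤-trans le (length≤1 u (λ { {[]} {[]} _ _ → refl }))))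
  (λ { (s≤s ()) })
find-comb {suc n} zs (suc t) u le = split (tails true zs) (tails false zs) refl refl
  where
  total : 2 ^ suc t ≤ length (tails true zs) + length (tails false zs)
  total = ≤-trans le (≤-reflexive (tails-split zs))
  split : ∀ xs ys → tails true zs ≡ xs → tails false zs ≡ ys → Comb zs (suc t)
  split [] _ eq _ = comb-tails false zs (find-comb (tails false zs) (suc t) (tails-unique false zs u)
    (subst (λ l → 2 ^ suc t ≤ length l + length (tails false zs)) eq total))
  split (_ ∷ _) [] _ eq = comb-tails true zs (find-comb (tails true zs) (suc t) (tails-unique true zs u)
    (≤-trans total (≤-reflexive (trans (cong (λ l → length (tails true zs) + length l) eq) (+-identityʳ _)))))
  split (x ∷ _) (y ∷ _) eqt eqf with 2 ^ t ≤? length (tails true zs)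
  ... | yes big = comb-branch true zs (tails⁻ false zs (subst (y ∈_) (sym eqf) (here refl)))
        (find-comb (tails true zs) t (tails-unique true zs u) big)
  ... | no small = comb-branch false zs (tails⁻ true zs (subst (x ∈_) (sym eqt) (here refl)))
        (find-comb (tails false zs) t (tails-unique false zs u)
          (+-cancelˡ-≤ (2 ^ t) _ _ (≤-trans (≤-reflexive (cong (2 ^ t +_) (sym (+-identityʳ (2 ^ t)))))
            (≤-trans total (+-monoˡ-≤ _ (<⇒≤ (≰⇒> small)))))))

record Staircase {n} (Q : ℕ → Set) (zs : List (Vec Bool n)) (k : ℕ) : Set where
  field
    point    : Fin k → ℕ
    edge     : Fin k → Vec Bool n
    edge∈    : ∀ i → edge i ∈ zs
    incident : ∀ i → edge i ∋ point i
    inside   : ∀ i → Q (point i)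
    rising   : ∀ {i j} → i Fin.< j → point i < point j
    separate : ∀ {i j} → i Fin.< j → ∃[ l ] at (edge i) (point l) ≢ at (edge j) (point l)

allPairs-lookup : ∀ {A : Set} {R : A → A → Set} {xs} → AllPairs R xs → ∀ {i j} → i Fin.< j →
                  R (List.lookup xs i) (List.lookup xs j)
allPairs-lookup (r ∷ rs) {Fin.zero} {Fin.suc j} _ = All.lookup r (∈-lookup j)
allPairs-lookup (r ∷ rs) {Fin.suc i} {Fin.suc j} (s<s lt) = allPairs-lookup rs lt

-- For b = true each edge contains its own point and later edges miss it. For b = false point i is
-- paired with the edge of step i + 1, which contains point i and misses point i + 1, while later
-- edges contain the latter; this shift uses the extra step of the comb.
staircase : ∀ {n k} {Q : ℕ → Set} {zs : List (Vec Bool n)} b (c : Comb zs (suc k)) →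
            (∀ {z} → z ∈ Comb.steps c → proj₁ (proj₂ z) ≡ b × Q (proj₁ z)) → Staircase Q zs k
staircase {n} {k} {Q} {zs} b (comb ss long later own sources) spec = build b kind
  where
  st : Fin (suc k) → Step n
  st i = List.lookup ss (Fin.inject≤ i long)
  x : Fin (suc k) → ℕ
  x i = proj₁ (st i)
  e : Fin (suc k) → Vec Bool n
  e i = proj₂ (proj₂ (st i))
  st∈ : ∀ i → st i ∈ ss
  st∈ i = ∈-lookup (Fin.inject≤ i long)
  lt : ∀ {i j} → i Fin.< j → x i < x j × at (e j) (x i) ≡ not (proj₁ (proj₂ (st i)))
  lt {i} {j} i<j = allPairs-lookup later (subst₂ _<_ (sym (Fin.toℕ-inject≤ i long)) (sym (Fin.toℕ-inject≤ j long)) i<j)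
  kind : ∀ i → proj₁ (proj₂ (st i)) ≡ b
  kind i = proj₁ (spec (st∈ i))
  up : ∀ {i j : Fin k} → i Fin.< j → Fin.inject₁ i Fin.< Fin.inject₁ j
  up {i} {j} = subst₂ _<_ (sym (Fin.toℕ-inject₁ i)) (sym (Fin.toℕ-inject₁ j))
  build : ∀ b → (∀ i → proj₁ (proj₂ (st i)) ≡ b) → Staircase Q zs k
  build true kind = record
    { point = x ∘ Fin.inject₁ ; edge = e ∘ Fin.inject₁
    ; edge∈ = λ i → sources (st∈ (Fin.inject₁ i))
    ; incident = λ i → trans (own (st∈ (Fin.inject₁ i))) (kind _)
    ; inside = λ i → proj₂ (spec (st∈ (Fin.inject₁ i)))
    ; rising = λ i<j → proj₁ (lt (up i<j))
    ; separate = λ {i} i<j → i , λ eq → case trans (sym (trans (own (st∈ (Fin.inject₁ i))) (kind _)))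
                   (trans eq (trans (proj₂ (lt (up i<j))) (cong not (kind _)))) of λ ()
    }
  build false kind = record
    { point = x ∘ Fin.inject₁ ; edge = e ∘ Fin.suc
    ; edge∈ = λ i → sources (st∈ (Fin.suc i))
    ; incident = λ i → trans (proj₂ (lt (next i))) (cong not (kind _))
    ; inside = λ i → proj₂ (spec (st∈ (Fin.inject₁ i)))
    ; rising = λ i<j → proj₁ (lt (up i<j))
    ; separate = λ {i} {j} i<j →
        let l = fromℕ< (≤-<-trans i<j (Fin.toℕ<n j))
            l≡ : Fin.inject₁ l ≡ Fin.suc i
            l≡ = Fin.toℕ-injective (trans (Fin.toℕ-inject₁ l) (Fin.toℕ-fromℕ< _))
        in l , λ eq → case trans (sym (trans (own (st∈ (Fin.suc i))) (kind _)))
             (trans (cong (at (e (Fin.suc i)) ∘ x) (sym l≡)) (trans eq (trans (cong (at (e (Fin.suc j)) ∘ x) l≡)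
               (trans (proj₂ (lt {Fin.suc i} {Fin.suc j} (s<s i<j))) (cong not (kind _)))))) of λ ()
    }
    where
    next : ∀ (i : Fin k) → Fin.inject₁ i Fin.< Fin.suc i
    next i = subst (_< suc (toℕ i)) (sym (Fin.toℕ-inject₁ i)) (n<1+n (toℕ i))

-- So many edges have a comb of 4 * suc k steps. The steps fall into four classes, by the value at
-- the point and by the half of the intervals in which it lies, so one class has suc k steps.
parallel-bound : ℕ → ℕ
parallel-bound k = 2 ^ (4 * suc k)

-- A staircase within one half supplies the endpoints on that side and makes the traces distinct.
-- Since every edge meets every interval, the other endpoints can be taken in the other half, in the
-- order that `π` prescribes.
parallel⇒contains : ∀ {k n} (π : Permutation′ k) (E zs : List (Vec Bool n)) (h : ℕ → ℕ) → Mono h → Unique zs →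
  parallel-bound k ≤ length zs → (∀ {f} → f ∈ zs → f ∈ E) → (∀ {f i} → f ∈ zs → i < k + k → Meets h f i) → Contains π E
parallel⇒contains {k} {n} π E zs h mh u many sub meets = main
  where
  c = find-comb zs (4 * suc k) u many
  open Comb c
  class : Step n → Bool × Bool
  class (x , b , e) = b , does (h x <? k)
  _≟ᶜ_ = Product.≡-dec Bool._≟_ Bool._≟_
  classes : List (Bool × Bool)
  classes = (true , true) ∷ (true , false) ∷ (false , true) ∷ (false , false) ∷ []
  all-classes : ∀ z → z ∈ classes
  all-classes (true  , true)  = here refl
  all-classes (true  , false) = there (here refl)
  all-classes (false , true)  = there (there (here refl))
  all-classes (false , false) = there (there (there (here refl)))
  subcomb : ∀ y → suc k ≤ length (filter (λ z → class z ≟ᶜ y) steps) → Comb zs (suc k)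
  subcomb y len = comb (filter (λ z → class z ≟ᶜ y) steps) len (AllPairs.filter⁺ (λ z → class z ≟ᶜ y) later)
    (own ∘ proj₁ ∘ ∈-filter⁻ (λ z → class z ≟ᶜ y) {xs = steps}) (sources ∘ proj₁ ∘ ∈-filter⁻ (λ z → class z ≟ᶜ y) {xs = steps})
  fromLeft : Staircase (λ x → h x < k) zs k → Contains π E
  fromLeft s = mkContains π E point (λ j → proj₁ (hits j)) edge (sub ∘ edge∈) incident
      (λ i → subst (λ z → edge z ∋ proj₁ (hits (π ⟨$⟩ʳ i))) (Perm.inverseˡ π) (proj₁ (proj₂ (hits (π ⟨$⟩ʳ i)))))
      rising
      (λ {i} {j} i<j → mono-reflects-< mh (subst₂ _<_ (sym (proj₂ (proj₂ (hits i)))) (sym (proj₂ (proj₂ (hits j)))) (+-monoʳ-< k i<j)))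
      (λ i j → mono-reflects-< mh (<-≤-trans (inside i) (subst (k ≤_) (sym (proj₂ (proj₂ (hits j)))) (m≤m+n k _))))
      (inj₁ ∘ separate)
    where
    open Staircase s
    hits : ∀ j → Meets h (edge (π ⟨$⟩ˡ j)) (k + toℕ j)
    hits j = meets (edge∈ (π ⟨$⟩ˡ j)) (+-monoʳ-< k (Fin.toℕ<n j))
  fromRight : Staircase (λ x → ¬ h x < k) zs k → Contains π E
  fromRight s = mkContains π E (λ i → proj₁ (hits i)) point (λ i → edge (π ⟨$⟩ʳ i)) (λ i → sub (edge∈ (π ⟨$⟩ʳ i)))
      (λ i → proj₁ (proj₂ (hits i))) (λ i → incident (π ⟨$⟩ʳ i))
      (λ {i} {j} i<j → mono-reflects-< mh (subst₂ _<_ (sym (proj₂ (proj₂ (hits i)))) (sym (proj₂ (proj₂ (hits j)))) i<j))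
      rising
      (λ i j → mono-reflects-< mh (<-≤-trans (subst (_< k) (sym (proj₂ (proj₂ (hits i)))) (Fin.toℕ<n i)) (≮⇒≥ (inside j))))
      (λ {i} {j} i<j → inj₂ (apart (π ⟨$⟩ʳ i) (π ⟨$⟩ʳ j) (λ eq → <⇒≢ i<j (cong toℕ
        (trans (sym (Perm.inverseˡ π)) (trans (cong (π ⟨$⟩ˡ_) eq) (Perm.inverseˡ π)))))))
    where
    open Staircase s
    hits : ∀ i → Meets h (edge (π ⟨$⟩ʳ i)) (toℕ i)
    hits i = meets (edge∈ (π ⟨$⟩ʳ i)) (<-≤-trans (Fin.toℕ<n i) (m≤m+n k k))
    apart : ∀ i j → i ≢ j → ∃[ l ] at (edge i) (point l) ≢ at (edge j) (point l)
    apart i j i≢j with Fin.<-cmp i j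
    ... | tri< l _ _ = separate l
    ... | tri≈ _ eq _ = contradiction eq i≢j
    ... | tri> _ _ g = let l , ne = separate g in l , ne ∘ sym
  main : Contains π E
  main with Any.any? (λ y → suc k ≤? length (filter (λ z → class z ≟ᶜ y) steps)) classes
  ... | no none = contradiction (≤-trans long (cover-bound (λ z y → class z ≟ᶜ y) k classes steps
          (λ {z} _ → _ , all-classes (class z) , refl)
          (λ y∈ → ≮⇒≥ (λ lt → none (lose y∈ lt)))))
        (<⇒≱ (*-monoʳ-< 4 (n<1+n k)))
  ... | yes found with find found
  ...   | (b , true) , _ , len = fromLeft (staircase b (subcomb _ len) (λ {z} z∈ →
            let eq = proj₂ (∈-filter⁻ (λ z → class z ≟ᶜ (b , true)) {xs = steps} z∈) in
            cong proj₁ eq , decide (h (proj₁ z) <? k) (cong proj₂ eq)))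
  ...   | (b , false) , _ , len = fromRight (staircase b (subcomb _ len) (λ {z} z∈ →
            let eq = proj₂ (∈-filter⁻ (λ z → class z ≟ᶜ (b , false)) {xs = steps} z∈) in
            cong proj₁ eq , λ lt → case trans (sym (cong proj₂ eq)) (dec-true (h (proj₁ z) <? k) lt) of λ ()))

meets? : ∀ {n} p (e : Vec Bool n) i → Dec (Meets p e i)
meets? {n} p e i = map′ (λ (x , _ , h) → x , h) (λ (x , ex , px) → x , ∋-bound e ex , ex , px)
  (anyUpTo? (λ x → (e ∋? x) ×-dec (p x ≟ i)) n)

-- The fine intervals of the grid are merged into K = k * r coarse ones on each
-- side.  For a cell of coarse intervals, either one of its T diagonal edges meets
-- few coarse intervals, or many of them meet the same large set of coarse intervals.
-- Edges of the first kind can be chosen so that no edge meets both intervals of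
-- a later one.
module GridContains {k : ℕ} (π : Permutation′ k) where

  s r K Mx T : ℕ
  -- A common signature larger than `s` suffices for `parallel⇒contains`. The k edges chosen
  -- greedily exclude at most `s` candidates each, hence r > k * s. `T` exceeds `Mx` times the
  -- number of signatures.
  s  = k + k
  r  = suc (k * s)
  K  = k * r
  Mx = parallel-bound k
  T  = suc (length (bitVectors (K + K)) * Mx)

  module _ {n : ℕ} (E : List (Vec Bool n)) (G : EdgeGrid (K * T) E) (avoid : ¬ Contains π E) where
    open EdgeGrid G

    p̄ : ℕ → ℕ
    p̄ x = p x / T

    p̄-mono : Mono p̄
    p̄-mono = /-monoˡ-≤ T ∘ mono

    -- For each `a` the `r` candidates stay within left group `a` and right group π a, so every
    -- choice of `ρ` realises the order pattern of `π`.
    leftBlock rightBlock : Fin k → Fin r → Fin K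
    leftBlock a ρ  = combine a ρ
    rightBlock a ρ = combine (π ⟨$⟩ʳ a) ρ

    edgeAt : Fin k → Fin r → Fin T → Vec Bool n
    edgeAt a ρ d = e (combine (leftBlock a ρ) d) (combine (rightBlock a ρ) d)

    coarse : ∀ (c : Fin K) (d : Fin T) → toℕ (combine c d) / T ≡ toℕ c
    coarse c d = trans (cong (_/ T) (trans (Fin.toℕ-combine c d) (cong (_+ toℕ d) (*-comm T (toℕ c)))))
      (div-block (toℕ c) T (Fin.toℕ<n d))

    meets-left : ∀ a ρ d → Meets p̄ (edgeAt a ρ d) (toℕ (leftBlock a ρ))
    meets-left a ρ d = let x , ex , px = left _ _ in x , ex , trans (cong (_/ T) px) (coarse (leftBlock a ρ) d)

    meets-right : ∀ a ρ d → Meets p̄ (edgeAt a ρ d) (K + toℕ (rightBlock a ρ))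
    meets-right a ρ d = let x , ex , px = right _ _ in x , ex ,
      trans (cong (_/ T) px) (trans (+-distrib-/-∣ˡ (toℕ (combine (rightBlock a ρ) d)) (divides-refl K))
        (cong₂ _+_ (m*n/n≡m K T) (coarse (rightBlock a ρ) d)))

    signature : Vec Bool n → Vec Bool (K + K)
    signature f = vec (K + K) (λ i → does (meets? p̄ f i))

    signature⁻ : ∀ f {i} → signature f ∋ i → Meets p̄ f i
    signature⁻ f {i} h = decide (meets? p̄ f i)
      (trans (sym (at-vec (λ i → does (meets? p̄ f i)) (∋-bound (signature f) h))) h)

    signature⁺ : ∀ f {i} → i < K + K → Meets p̄ f i → signature f ∋ i
    signature⁺ f {i} i< m = trans (at-vec (λ i → does (meets? p̄ f i)) i<) (dec-true (meets? p̄ f i) m)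

    sparse : ∀ a ρ → ∃[ d ] ∣ signature (edgeAt a ρ d) ∣ ≤ s
    sparse a ρ with Fin.any? (λ d → ∣ signature (edgeAt a ρ d) ∣ ≤? s)
    ... | yes found = found
    ... | no none = contradiction
      (subst (_≤ length (bitVectors (K + K)) * Mx) (length-tabulate {n = T} id)
        (cover-bound (λ d S → signature (edgeAt a ρ d) ≟ᵛ S) Mx (bitVectors (K + K)) (allFin T)
          (λ {d} _ → _ , ∈-bitVectors _ , refl)
          (λ {S} _ → ≮⇒≥ (dense S))))
      1+n≰n
      where
      edge-injective : ∀ {d d′} → edgeAt a ρ d ≡ edgeAt a ρ d′ → d ≡ d′
      edge-injective {d} {d′} eq = proj₂ (Fin.combine-injective (leftBlock a ρ) d (leftBlock a ρ) d′ (proj₁ (distinct eq)))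
      dense : ∀ S → ¬ (Mx < length (filter (λ d → signature (edgeAt a ρ d) ≟ᵛ S) (allFin T)))
      -- The coarse intervals in the common signature `S`, more than k + k in number, are renumbered
      -- by their rank in `S`.
      dense S lt = avoid (parallel⇒contains π E (map (edgeAt a ρ) ds) (rank (at S) ∘ p̄) (rank-mono (at S) ∘ p̄-mono)
        (map-unique (edgeAt a ρ) (λ _ _ → edge-injective) (Unique.filter⁺ (λ d → signature (edgeAt a ρ d) ≟ᵛ S) (Unique.allFin⁺ T)))
        (≤-trans (<⇒≤ lt) (≤-reflexive (sym (length-map (edgeAt a ρ) ds))))
        (λ f∈ → let d , _ , eq = ∈-map⁻ (edgeAt a ρ) f∈ in subst (_∈ E) (sym eq) (member _ _))
        meetsS)
        where
        ds = filter (λ d → signature (edgeAt a ρ d) ≟ᵛ S) (allFin T)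
        sig : ∀ {d} → d ∈ ds → signature (edgeAt a ρ d) ≡ S
        sig = proj₂ ∘ ∈-filter⁻ (λ d → signature (edgeAt a ρ d) ≟ᵛ S) {xs = allFin T}
        meetsS : ∀ {f i} → f ∈ map (edgeAt a ρ) ds → i < k + k → Meets (rank (at S) ∘ p̄) f i
        meetsS f∈ i< with ∈-map⁻ (edgeAt a ρ) f∈
        ... | d , d∈ , refl with rank-hit (at S) (K + K) (<-≤-trans i< (<⇒≤ (subst (s <_) (trans (cong ∣_∣ (sig d∈)) (∣∣≡rank S)) (≰⇒> (λ le → none (d , le))))))
        ...   | c , _ , Sc , rc with signature⁻ (edgeAt a ρ d) (subst (_∋ c) (sym (sig d∈)) Sc)
        ...     | x , fx , px = x , fx , trans (cong (rank (at S)) px) rc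

    abstract
      edgeOf : ∀ a ρ → Σ (Vec Bool n) λ f → f ∈ E × ∣ signature f ∣ ≤ s ×
               Meets p̄ f (toℕ (leftBlock a ρ)) × Meets p̄ f (K + toℕ (rightBlock a ρ))
      edgeOf a ρ = let d , le = sparse a ρ in
        edgeAt a ρ d , member _ _ , le , meets-left a ρ d , meets-right a ρ d

    Candidate : Set
    Candidate = Vec Bool n × ℕ

    -- Only the left interval is recorded: an edge missing the left interval of a later edge already
    -- differs from it at the left vertex of that edge.
    Conflict : Candidate → Candidate → Set
    Conflict (f , _) (_ , i) = Meets p̄ f i

    conflict? : ∀ x y → Dec (Conflict x y)
    conflict? (f , _) (_ , i) = meets? p̄ f i

    candidate : Fin k → Fin r → Candidate
    candidate a ρ = proj₁ (edgeOf a ρ) , toℕ (leftBlock a ρ)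

    few-conflicts : ∀ a ρ → Greedy.bounded conflict? s r candidate (candidate a ρ)
    few-conflicts a ρ a′ = ≤-trans
      (subst (_≤ ∣ signature f ∣) (length-map block ρs)
        (small-∣∣ (signature f) (map block ρs)
          (map-unique block (λ _ _ eq → proj₂ (Fin.combine-injective a′ _ a′ _ (Fin.toℕ-injective eq)))
            (Unique.filter⁺ (λ ρ′ → conflict? (candidate a ρ) (candidate a′ ρ′)) (Unique.allFin⁺ r)))
          (λ i∈ → let ρ′ , ρ∈ , eq = ∈-map⁻ block i∈ in subst (signature f ∋_) (sym eq)
            (signature⁺ f (<-≤-trans (Fin.toℕ<n (leftBlock a′ ρ′)) (m≤m+n K K))
              (proj₂ (∈-filter⁻ (λ ρ′ → conflict? (candidate a ρ) (candidate a′ ρ′)) {xs = allFin r} ρ∈))))))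
      (proj₁ (proj₂ (proj₂ (edgeOf a ρ))))
      where
      f = proj₁ (edgeOf a ρ)
      block = λ ρ′ → toℕ (leftBlock a′ ρ′)
      ρs = filter (λ ρ′ → conflict? (candidate a ρ) (candidate a′ ρ′)) (allFin r)

    contradictory : (ρ : Fin k → Fin r) →
                    (∀ {a a′} → a Fin.< a′ → ¬ Meets p̄ (proj₁ (edgeOf a (ρ a))) (toℕ (leftBlock a′ (ρ a′)))) → ⊥
    contradictory ρ free = avoid (mkContains π E (λ a → proj₁ (u a)) (λ b → proj₁ (w b)) f
      (λ a → proj₁ (proj₂ (edgeOf a (ρ a))))
      (λ a → proj₁ (proj₂ (u a)))
      (λ a → subst (λ z → f z ∋ proj₁ (w (π ⟨$⟩ʳ a))) (Perm.inverseˡ π) (proj₁ (proj₂ (w (π ⟨$⟩ʳ a)))))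
      (λ {i} {j} i<j → mono-reflects-< p̄-mono (subst₂ _<_ (sym (proj₂ (proj₂ (u i)))) (sym (proj₂ (proj₂ (u j))))
        (Fin.combine-monoˡ-< (ρ i) (ρ j) i<j)))
      (λ {i} {j} i<j → mono-reflects-< p̄-mono (subst₂ _<_ (sym (proj₂ (proj₂ (w i)))) (sym (proj₂ (proj₂ (w j))))
        (+-monoʳ-< K (Fin.combine-monoˡ-< (ρ (π ⟨$⟩ˡ i)) (ρ (π ⟨$⟩ˡ j)) i<j))))
      (λ i j → mono-reflects-< p̄-mono (subst₂ _<_ (sym (proj₂ (proj₂ (u i)))) (sym (proj₂ (proj₂ (w j))))
        (<-≤-trans (Fin.toℕ<n (leftBlock i (ρ i))) (m≤m+n K _))))
      (λ {i} {j} i<j → inj₁ (j , λ eq → free i<j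
        (proj₁ (u j) , trans eq (proj₁ (proj₂ (u j))) , proj₂ (proj₂ (u j))))))
      where
      f : Fin k → Vec Bool n
      f a = proj₁ (edgeOf a (ρ a))
      u : ∀ a → Meets p̄ (f a) (toℕ (leftBlock a (ρ a)))
      u a = proj₁ (proj₂ (proj₂ (proj₂ (edgeOf a (ρ a)))))
      w : ∀ b → Meets p̄ (f (π ⟨$⟩ˡ b)) (K + toℕ (combine b (ρ (π ⟨$⟩ˡ b))))
      w b = subst (λ z → Meets p̄ (f (π ⟨$⟩ˡ b)) (K + toℕ (combine z (ρ (π ⟨$⟩ˡ b))))) (Perm.inverseʳ π)
        (proj₂ (proj₂ (proj₂ (proj₂ (edgeOf (π ⟨$⟩ˡ b) (ρ (π ⟨$⟩ˡ b)))))))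

    impossible : ⊥
    impossible = let ρ , _ , free = Greedy.select conflict? s r k candidate [] ≤-refl (λ ()) few-conflicts in
      contradictory ρ (λ {a} {a′} → free {a} {a′})

abstract
  grid-order : ∀ {k} → Permutation′ k → ℕ
  grid-order π = GridContains.K π * GridContains.T π

  avoid⇒¬edgeGrid : ∀ {k n} (π : Permutation′ k) (E : List (Vec Bool n)) → ¬ Contains π E → ¬ EdgeGrid (grid-order π) E
  avoid⇒¬edgeGrid π E avoid G = GridContains.impossible π E G avoid

-- Hypergraphs on the usual order, and containment

standard : ∀ {n} (E : List (Subset n)) → Unique E → All (λ e → 2 ≤ ∣ e ∣) E → OrderedHypergraph n
standard E u s = record
  { _<_ = Fin._<_ ; isStrictTotalOrder = Fin.<-isStrictTotalOrder ; edges = E ; edges-unique = u ; edges-size = s }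

trace-id : ∀ {n} (e : Subset n) → trace id e ≡ e
trace-id = Vec.tabulate∘lookup

standard-≅ : ∀ {n} {E E′ : List (Subset n)} {u s u′ s′} → E ≋ E′ → standard E u s ≅ standard E′ u′ s′
standard-≅ (E⊆ , ⊆E) = record
  { to = id
  ; isOrderIsomorphism = Identity.isOrderIsomorphism _≡_ Fin._<_ refl
  ; preservesEdges = λ e → mk⇔ (λ e∈ → E⊆ (subst (_∈ _) (trace-id e) e∈)) (λ e∈ → subst (_∈ _) (sym (trace-id e)) (⊆E e∈))
  }

module _ {m n} {_<₁_ : Rel (Fin m) 0ℓ} {_<₂_ : Rel (Fin n) 0ℓ}
         (sto₁ : IsStrictTotalOrder _≡_ _<₁_) (sto₂ : IsStrictTotalOrder _≡_ _<₂_) where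
  private
    module S₁ = IsStrictTotalOrder sto₁
    module S₂ = IsStrictTotalOrder sto₂

  strictlyMonotone⇒monomorphism : ∀ {φ} → (∀ {x y} → x <₁ y → φ x <₂ φ y) → IsOrderMonomorphism _≡_ _≡_ _<₁_ _<₂_ φ
  strictlyMonotone⇒monomorphism {φ} mono = record
    { isOrderHomomorphism = record { cong = cong φ ; mono = mono }
    ; injective = injective
    ; cancel = cancel
    }
    where
    injective : ∀ {x y} → φ x ≡ φ y → x ≡ y
    injective {x} {y} eq with S₁.compare x y
    ... | tri< l _ _ = contradiction (mono l) (S₂.irrefl eq)
    ... | tri≈ _ e _ = e
    ... | tri> _ _ g = contradiction (mono g) (S₂.irrefl (sym eq))
    cancel : ∀ {x y} → φ x <₂ φ y → x <₁ y
    cancel {x} {y} lt with S₁.compare x y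
    ... | tri< l _ _ = l
    ... | tri≈ _ refl _ = contradiction lt (S₂.irrefl refl)
    ... | tri> _ _ g = contradiction (mono g) (S₂.asym lt)

injective⇒surjective : ∀ {n} (f : Fin n → Fin n) → (∀ {x y} → f x ≡ f y → x ≡ y) → ∀ y → ∃[ x ] f x ≡ y
injective⇒surjective {suc n} f inj y with Fin.any? (λ x → f x Fin.≟ y)
... | yes found = found
... | no none = contradiction
  (Fin.injective⇒≤ {f = λ x → Fin.punchOut {i = y} {j = f x} (λ eq → none (x , sym eq))}
    (λ {a} {b} eq → inj (Fin.punchOut-injective (λ e → none (a , sym e)) (λ e → none (b , sym e)) eq)))
  1+n≰n

filter-strict-length : ∀ {A : Set} {P Q : A → Set} (P? : ∀ x → Dec (P x)) (Q? : ∀ x → Dec (Q x)) xs →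
  (∀ {x} → x ∈ xs → P x → Q x) → ∀ {z} → z ∈ xs → Q z → ¬ P z → length (filter P? xs) < length (filter Q? xs)
filter-strict-length P? Q? (x ∷ xs) imp (here refl) Qz ¬Pz with P? x | Q? x
... | yes p | _ = contradiction p ¬Pz
... | no _ | yes _ = s≤s (filter-mono-length P? Q? xs (imp ∘ there))
... | no _ | no ¬q = contradiction Qz ¬q
filter-strict-length P? Q? (x ∷ xs) imp (there z∈) Qz ¬Pz with P? x | Q? x
... | yes p | yes q = s<s (filter-strict-length P? Q? xs (imp ∘ there) z∈ Qz ¬Pz)
... | yes p | no ¬q = contradiction (imp (here refl) p) ¬q
... | no _ | yes _ = m<n⇒m<1+n (filter-strict-length P? Q? xs (imp ∘ there) z∈ Qz ¬Pz)
... | no _ | no _ = filter-strict-length P? Q? xs (imp ∘ there) z∈ Qz ¬Pz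

infix 4 _∋ᶠ_
_∋ᶠ_ : ∀ {n} → Subset n → Fin n → Set
e ∋ᶠ x = Vec.lookup e x ≡ true

nth-element : ∀ {n} (e : Subset n) i → i < ∣ e ∣ → ∃[ x ] e ∋ᶠ x × rank (at e) (toℕ x) ≡ i
nth-element {n} e i i< with rank-hit (at e) n (≤-trans i< (≤-reflexive (∣∣≡rank e)))
... | x , x< , ex , rx = fromℕ< x<
  , trans (sym (at-lookup e _)) (trans (cong (at e) (Fin.toℕ-fromℕ< x<)) ex)
  , trans (cong (rank (at e)) (Fin.toℕ-fromℕ< x<)) rx

two-elements : ∀ {n} (e : Subset n) → 2 ≤ ∣ e ∣ → ∃[ x ] ∃[ y ] x Fin.< y × e ∋ᶠ x × e ∋ᶠ y
two-elements e 2≤ = let x , ex , rx = nth-element e 0 (<-trans z<s 2≤) ; y , ey , ry = nth-element e 1 2≤ in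
  x , y , mono-reflects-< (rank-mono (at e)) (subst₂ _<_ (sym rx) (sym ry) z<s) , ex , ey

two≤∣∣ : ∀ {n} (e : Subset n) {x y} → x ≢ y → Vec.lookup e x ≡ true → Vec.lookup e y ≡ true → 2 ≤ ∣ e ∣
two≤∣∣ e {x} {y} x≢y ex ey = small-∣∣ e (toℕ x ∷ toℕ y ∷ []) ((x≢y ∘ Fin.toℕ-injective ∷ []) ∷ [] ∷ [])
  (λ { (here refl) → trans (at-lookup e x) ex ; (there (here refl)) → trans (at-lookup e y) ey })

module _ {m n} (φ : Fin m → Fin n) (surj : ∀ y → ∃[ x ] φ x ≡ y) where

  trace-injective : ∀ {s s′} → trace φ s ≡ trace φ s′ → s ≡ s′
  trace-injective {s} {s′} eq = trans (sym (Vec.tabulate∘lookup s)) (trans (Vec.tabulate-cong agree) (Vec.tabulate∘lookup s′))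
    where
    agree : ∀ y → Vec.lookup s y ≡ Vec.lookup s′ y
    agree y with surj y
    ... | x , refl = trans (sym (lookup-trace φ s x)) (trans (cong (λ t → Vec.lookup t x) eq) (lookup-trace φ s′ x))

  trace-size : ∀ {s} → 2 ≤ ∣ s ∣ → 2 ≤ ∣ trace φ s ∣
  trace-size {s} 2≤ with two-elements s 2≤
  ... | x , y , x<y , sx , sy with surj x | surj y
  ...   | a , refl | b , refl = two≤∣∣ (trace φ s) {a} {b} (λ a≡b → <⇒≢ x<y (cong (toℕ ∘ φ) a≡b))
    (trans (lookup-trace φ s a) sx) (trans (lookup-trace φ s b) sy)

-- Counting and `Contains` refer to the usual order, whereas that of `G` is arbitrary. `position` is
-- the rank of a vertex in the order of `G`, and its inverse `φ` transports the edges.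
module Standardise {n} (G : OrderedHypergraph n) where
  private
    module G = OrderedHypergraph G
    module S = IsStrictTotalOrder G.isStrictTotalOrder

  below : Fin n → ℕ
  below x = length (filter (S._<? x) (allFin n))

  below< : ∀ x → below x < n
  below< x = <-≤-trans (filter-strict-length (S._<? x) (λ _ → yes tt) (allFin n) (λ _ _ → tt) (∈-allFin x) tt (S.irrefl refl))
    (≤-trans (length-filter (λ _ → yes tt) (allFin n)) (≤-reflexive (length-tabulate {n = n} id)))

  below-mono : ∀ {x y} → x G.< y → below x < below y
  below-mono {x} {y} x<y = filter-strict-length (S._<? x) (S._<? y) (allFin n) (λ _ z<x → S.trans z<x x<y) (∈-allFin x) x<y (S.irrefl refl)

  position : Fin n → Fin n
  position x = fromℕ< (below< x)

  position-mono : ∀ {x y} → x G.< y → position x Fin.< position y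
  position-mono x<y = subst₂ _<_ (sym (Fin.toℕ-fromℕ< _)) (sym (Fin.toℕ-fromℕ< _)) (below-mono x<y)

  private
    module M = IsOrderMonomorphism (strictlyMonotone⇒monomorphism G.isStrictTotalOrder Fin.<-isStrictTotalOrder position-mono)

  φ : Fin n → Fin n
  φ i = proj₁ (injective⇒surjective position M.injective i)

  position∘φ : ∀ i → position (φ i) ≡ i
  position∘φ i = proj₂ (injective⇒surjective position M.injective i)

  φ-surjective : ∀ y → ∃[ x ] φ x ≡ y
  φ-surjective y = position y , M.injective (position∘φ (position y))

  φ-mono : ∀ {i j} → i Fin.< j → φ i G.< φ j
  φ-mono {i} {j} i<j = M.cancel (subst₂ Fin._<_ (sym (position∘φ i)) (sym (position∘φ j)) i<j)

  stdEdges : List (Subset n)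
  stdEdges = map (trace φ) G.edges

  stdEdges-unique : Unique stdEdges
  stdEdges-unique = map-unique (trace φ) (λ _ _ → trace-injective φ φ-surjective) G.edges-unique

  stdEdges-size : All (λ e → 2 ≤ ∣ e ∣) stdEdges
  stdEdges-size = All.map⁺ (All.map (λ {s} → trace-size φ φ-surjective {s}) G.edges-size)

  std : OrderedHypergraph n
  std = standard stdEdges stdEdges-unique stdEdges-size

  std≅ : std ≅ G
  std≅ = record
    { to = φ
    ; isOrderIsomorphism = record
      { isOrderMonomorphism = strictlyMonotone⇒monomorphism Fin.<-isStrictTotalOrder G.isStrictTotalOrder φ-mono
      ; surjective = λ y → let x , eq = φ-surjective y in x , λ { refl → eq }
      }
    ; preservesEdges = λ s → mk⇔
        (λ s∈ → let e , e∈ , eq = ∈-map⁻ (trace φ) s∈ in subst (_∈ G.edges) (sym (trace-injective φ φ-surjective eq)) e∈)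
        (∈-map⁺ (trace φ))
    }

contains⇒⊑ : ∀ {k n} (π : Permutation′ k) (E : List (Subset n)) {u s} → Contains π E → H⟨ π ⟩ ⊑ standard E u s
contains⇒⊑ {k} {n} π E {u} {s} (ι , e , mono , incident , distinct) = L , (λ _ _ → mk⇔ id id) , sub
  , List.tabulate (matchingEdge π) , List.tabulate tr , ↭-refl , ↭-refl , pointwise k (matchingEdge π) tr inside
  where
  tr : Fin k → Subset (k + k)
  tr i = trace ι (List.lookup E (e i))
  inside : ∀ i → matchingEdge π i ⊆ tr i
  inside i {x} x∈ = Vec.lookup⇒[]= x (tr i) (trans (lookup-trace ι (List.lookup E (e i)) x)
    ([ (λ p → subst (λ z → Vec.lookup (List.lookup E (e i)) (ι z) ≡ true) (sym (x∈⁅y⁆⇒x≡y _ p)) (proj₁ (incident i)))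
     , (λ p → subst (λ z → Vec.lookup (List.lookup E (e i)) (ι z) ≡ true) (sym (x∈⁅y⁆⇒x≡y _ p)) (proj₂ (incident i))) ]′
     (x∈p∪q⁻ _ _ x∈)))
  -- Only the traces of the k chosen edges are kept; as they are distinct, they are as many as the
  -- edges of `H⟨ π ⟩`.
  L : OrderedHypergraph (k + k)
  L = standard (List.tabulate tr)
    (Unique.tabulate⁺ (λ {i} {j} eq → decidable-stable (i Fin.≟ j) (λ i≢j → distinct i j i≢j eq)))
    (All.tabulate⁺ (λ i → ≤-trans (All.lookup (edges-size H⟨ π ⟩) (∈-tabulate⁺ i)) (p⊆q⇒∣p∣≤∣q∣ (inside i))))
  sub : SubHypergraph L (standard E u s)
  sub = record
    { ι = ι
    ; isOrderMonomorphism = strictlyMonotone⇒monomorphism Fin.<-isStrictTotalOrder Fin.<-isStrictTotalOrder (mono _ _)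
    ; isTrace = λ f∈ → let i , eq = ∈-tabulate⁻ f∈ in List.lookup E (e i) , ∈-lookup (e i) , eq
    }
  pointwise : ∀ l (f g : Fin l → Subset (k + k)) → (∀ i → f i ⊆ g i) → Pointwise _⊆_ (List.tabulate f) (List.tabulate g)
  pointwise zero f g h = []
  pointwise (suc l) f g h = h Fin.zero ∷ pointwise l (f ∘ Fin.suc) (g ∘ Fin.suc) (h ∘ Fin.suc)

-- Turns a proof by contradiction into a search, since a double negation of membership in a property
-- could not be removed. Maps between finite sets agree with their decoded codes only pointwise,
-- hence `transport`.
contains? : ∀ {k n} (π : Permutation′ k) (E : List (Subset n)) → Dec (Contains π E)
contains? {k} {n} π E = map′
  (λ (a , b , h) → Fin.finToFun a , Fin.finToFun b , h)
  (λ (ι , e , h) → Fin.funToFin ι , Fin.funToFin e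
     , transport (λ x → sym (Fin.finToFun-funToFin ι x)) (λ i → sym (Fin.finToFun-funToFin e i)) h)
  (Fin.any? (λ a → Fin.any? (λ b → good? (Fin.finToFun a) (Fin.finToFun b))))
  where
  Good : (Fin (k + k) → Fin n) → (Fin k → Fin (length E)) → Set
  Good ι e =
    (∀ x y → x Fin.< y → ι x Fin.< ι y) ×
    (∀ i → Vec.lookup (List.lookup E (e i)) (ι (i ↑ˡ k)) ≡ true ×
           Vec.lookup (List.lookup E (e i)) (ι (k ↑ʳ (π ⟨$⟩ʳ i))) ≡ true) ×
    (∀ i j → i ≢ j → trace ι (List.lookup E (e i)) ≢ trace ι (List.lookup E (e j)))
  good? : ∀ ι e → Dec (Good ι e)
  good? ι e =
    Fin.all? (λ x → Fin.all? (λ y → (x Fin.<? y) →-dec (ι x Fin.<? ι y))) ×-dec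
    Fin.all? (λ i → (Vec.lookup (List.lookup E (e i)) (ι (i ↑ˡ k)) Bool.≟ true) ×-dec
                    (Vec.lookup (List.lookup E (e i)) (ι (k ↑ʳ (π ⟨$⟩ʳ i))) Bool.≟ true)) ×-dec
    Fin.all? (λ i → Fin.all? (λ j → ¬? (i Fin.≟ j) →-dec ¬? (trace ι (List.lookup E (e i)) ≟ᵛ trace ι (List.lookup E (e j)))))
  transport : ∀ {ι ι′ e e′} → (∀ x → ι x ≡ ι′ x) → (∀ i → e i ≡ e′ i) → Good ι e → Good ι′ e′
  transport {ι} {ι′} {e} {e′} eqι eqe (mono , inc , dis) =
    (λ x y x<y → subst₂ Fin._<_ (eqι x) (eqι y) (mono x y x<y)) ,
    (λ i → subst₂ (λ f z → Vec.lookup (List.lookup E f) z ≡ true) (eqe i) (eqι _) (proj₁ (inc i))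
         , subst₂ (λ f z → Vec.lookup (List.lookup E f) z ≡ true) (eqe i) (eqι _) (proj₂ (inc i))) ,
    λ i j i≢j eq → dis i j i≢j (trans (tr i) (trans eq (sym (tr j))))
    where
    tr : ∀ i → trace ι (List.lookup E (e i)) ≡ trace ι′ (List.lookup E (e′ i))
    tr i = trans (cong (trace ι ∘ List.lookup E) (eqe i)) (Vec.tabulate-cong (λ x → cong (Vec.lookup (List.lookup E (e′ i))) (eqι x)))

-- Natural numbers as rationals

ofℕ : ℕ → ℚ
ofℕ a = ℤ.+ a ℚ./ 1

toℚᵘ-ofℕ : ∀ a → ℚ.toℚᵘ (ofℕ a) ℚᵘ.≃ mkℚᵘ (ℤ.+ a) 0
toℚᵘ-ofℕ a = ℚ.toℚᵘ-fromℚᵘ (mkℚᵘ (ℤ.+ a) 0)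

ofℕ-* : ∀ a b → ofℕ a ℚ.* ofℕ b ≡ ofℕ (a * b)
ofℕ-* a b = ℚ.toℚᵘ-injective (ℚᵘ.≃-trans (ℚ.toℚᵘ-homo-* (ofℕ a) (ofℕ b))
  (ℚᵘ.≃-trans (ℚᵘ.*-cong (toℚᵘ-ofℕ a) (toℚᵘ-ofℕ b))
    (ℚᵘ.≃-trans (ℚᵘ.≃-reflexive (cong (λ z → mkℚᵘ z 0) (sym (ℤ.pos-* a b)))) (ℚᵘ.≃-sym (toℚᵘ-ofℕ (a * b))))))

ofℕ-^ : ∀ a n → ofℕ a ^ℚ n ≡ ofℕ (a ^ n)
ofℕ-^ a zero    = refl
ofℕ-^ a (suc n) = trans (cong (ofℕ a ℚ.*_) (ofℕ-^ a n)) (ofℕ-* a (a ^ n))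

ofℕ-mono-< : ∀ {a b} → a < b → ofℕ a ℚ.< ofℕ b
ofℕ-mono-< {a} {b} a<b = ℚ.toℚᵘ-cancel-< (ℚᵘ.<-respˡ-≃ (ℚᵘ.≃-sym (toℚᵘ-ofℕ a)) (ℚᵘ.<-respʳ-≃ (ℚᵘ.≃-sym (toℚᵘ-ofℕ b))
  (*<* (subst₂ ℤ._<_ (sym (ℤ.*-identityʳ (ℤ.+ a))) (sym (ℤ.*-identityʳ (ℤ.+ b))) (ℤ.+<+ a<b)))))

ofℕ-cancel-< : ∀ {a b} → ofℕ a ℚ.< ofℕ b → a < b
ofℕ-cancel-< {a} {b} lt with ℚᵘ.<-respˡ-≃ (toℚᵘ-ofℕ a) (ℚᵘ.<-respʳ-≃ (toℚᵘ-ofℕ b) (ℚ.toℚᵘ-mono-< lt))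
... | *<* h = ℤ.drop‿+<+ (subst₂ ℤ._<_ (ℤ.*-identityʳ (ℤ.+ a)) (ℤ.*-identityʳ (ℤ.+ b)) h)

-- Superexponential properties contain every `H⟨ π ⟩`

module _ {ℓ} (P : Class ℓ) (SM : StronglyMonotoneProperty P) (SE : SuperExponential P) where
  open StronglyMonotoneProperty SM

  module _ {k} (π : Permutation′ k) where
    private
      R = grid-order π
      -- The successor makes the constant positive, as `SE` demands.
      K = suc (proj₁ (exponential-count R))

      covered : ∀ n → ∃[ 𝓛 ] length 𝓛 ≤ K ^ n ×
                (∀ (G : OrderedHypergraph n) → ¬ Contains π (Standardise.stdEdges G) → ∃[ C ] C ∈ 𝓛 × C ≋ Standardise.stdEdges G)
      covered zero = ([] ∷ []) , ≤-refl , λ G _ → [] , here refl , (λ ()) , λ {e} e∈ → contradiction (All.lookup (Standardise.stdEdges-size G) e∈) (edgeless e)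
        where
        edgeless : ∀ (e : Subset 0) → ¬ 2 ≤ ∣ e ∣
        edgeless [] ()
      covered n@(suc _) = let 𝓛 , len , cov = proj₂ (exponential-count R) n z<s in
        𝓛 , ≤-trans len (^-monoˡ-≤ n (n≤1+n _)) , λ G avoid → cov _ (Standardise.stdEdges-unique G) (avoid⇒¬edgeGrid π _ avoid)

    superExponential⇒matching : P (k + k) H⟨ π ⟩
    superExponential⇒matching with SE (ofℕ K) (ofℕ-mono-< {0} {K} z<s)
    ... | N , m , K^N<m , inj with covered N
    ...   | 𝓛 , len , cov = search (Fin.any? (λ i → contains? π (Standardise.stdEdges (G i))))
      where
      module I = Injection inj
      G : Fin m → OrderedHypergraph N
      G i = proj₁ (I.to i)
      search : Dec (∃[ i ] Contains π (Standardise.stdEdges (G i))) → P (k + k) H⟨ π ⟩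
      search (yes (i , c)) = ⊑-closed (contains⇒⊑ π _ c) (isProperty (≅-sym (Standardise.std≅ (G i))) (proj₂ (I.to i)))
      -- More than K ^ N pairwise non-isomorphic hypergraphs would avoid `π`; two of them share an
      -- entry of the cover, so their standardisations have the same edges and they are isomorphic.
      search (no none) = ⊥-elim (collide (Fin.pigeonhole {m = length 𝓛} many (λ i → Any.index (proj₁ (proj₂ (found i))))))
        where
        found : ∀ i → ∃[ C ] C ∈ 𝓛 × C ≋ Standardise.stdEdges (G i)
        found i = cov (G i) (λ c → none (i , c))
        many : length 𝓛 < m
        many = ≤-<-trans len (ofℕ-cancel-< (subst (ℚ._< ofℕ m) (ofℕ-^ K N) K^N<m))
        collide : ∃[ i ] ∃[ j ] i Fin.< j × Any.index (proj₁ (proj₂ (found i))) ≡ Any.index (proj₁ (proj₂ (found j))) → ⊥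
        collide (i , j , i<j , eq) with found i | found j
        ... | C , C∈ , C⊆ , ⊆C | C′ , C′∈ , C′⊆ , ⊆C′ = <⇒≢ i<j (cong toℕ (I.injective
          (≅-trans (≅-sym (Standardise.std≅ (G i))) (≅-trans (standard-≅
              ((λ e∈ → C′⊆ (subst (_ ∈_) C≡ (⊆C e∈))) , (λ e∈ → C⊆ (subst (_ ∈_) (sym C≡) (⊆C′ e∈)))))
            (Standardise.std≅ (G j))))))
          where
          C≡ : C ≡ C′
          C≡ = trans (lookup-index C∈) (trans (cong (List.lookup 𝓛) eq) (sym (lookup-index C′∈)))

-- Crossing matchings

-- A crossing matching read from left to right: a vertices are open and n are
-- still to come.  Once the first open vertex has been closed, no further vertex
-- is opened.
data Closing : ℕ → ℕ → Set where
  done  : Closing 0 0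
  skipᶜ : ∀ {n a} → Closing n a → Closing (suc n) a
  close : ∀ {n a} → Fin (suc a) → Closing n a → Closing (suc n) (suc a)

data Opening : ℕ → ℕ → Set where
  done  : Opening 0 0
  skipᵒ : ∀ {n a} → Opening n a → Opening (suc n) a
  start : ∀ {n a} → Opening n (suc a) → Opening (suc n) a
  close : ∀ {n a} → Fin (suc a) → Closing n a → Opening (suc n) (suc a)

cons : ∀ {X : Set} {a} → X → (Fin a → X) → Fin (suc a) → X
cons v O Fin.zero    = v
cons v O (Fin.suc i) = O i

module _ {N : ℕ} where

  X : Set
  X = Fin N

  pairsᶜ : ∀ {n a} → Closing n a → (Fin a → X) → (Fin n → X) → List (X × X)
  pairsᶜ done        O V = []
  pairsᶜ (skipᶜ w)   O V = pairsᶜ w O (V ∘ Fin.suc)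
  pairsᶜ (close i w) O V = (O i , V Fin.zero) ∷ pairsᶜ w (O ∘ Fin.punchIn i) (V ∘ Fin.suc)

  pairsᵒ : ∀ {n a} → Opening n a → (Fin a → X) → (Fin n → X) → List (X × X)
  pairsᵒ done        O V = []
  pairsᵒ (skipᵒ w)   O V = pairsᵒ w O (V ∘ Fin.suc)
  pairsᵒ (start w)   O V = pairsᵒ w (cons (V Fin.zero) O) (V ∘ Fin.suc)
  pairsᵒ (close i w) O V = (O i , V Fin.zero) ∷ pairsᶜ w (O ∘ Fin.punchIn i) (V ∘ Fin.suc)

  -- Any open vertex may be closed next, so their order is immaterial and `O` is only injective.
  record State {n a} (O : Fin a → X) (V : Fin n → X) : Set where
    field
      O-injective : ∀ {i j} → O i ≡ O j → i ≡ j
      V-mono      : ∀ {i j} → i Fin.< j → V i Fin.< V j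
      O<V         : ∀ i j → O i Fin.< V j

    V-injective : ∀ {i j} → V i ≡ V j → i ≡ j
    V-injective {i} {j} eq with Fin.<-cmp i j
    ... | tri< l _ _ = contradiction (cong toℕ eq) (<⇒≢ (V-mono l))
    ... | tri≈ _ e _ = e
    ... | tri> _ _ g = contradiction (cong toℕ (sym eq)) (<⇒≢ (V-mono g))

    O≢V : ∀ {i j} → O i ≢ V j
    O≢V {i} {j} eq = <⇒≢ (O<V i j) (cong toℕ eq)

  open State

  skip-state : ∀ {n a} {O : Fin a → X} {V : Fin (suc n) → X} → State O V → State O (V ∘ Fin.suc)
  skip-state s = record { O-injective = O-injective s ; V-mono = V-mono s ∘ s<s ; O<V = λ i j → O<V s i (Fin.suc j) }

  close-state : ∀ {n a} {O : Fin (suc a) → X} {V : Fin (suc n) → X} i → State O V → State (O ∘ Fin.punchIn i) (V ∘ Fin.suc)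
  close-state i s = record
    { O-injective = Fin.punchIn-injective i _ _ ∘ O-injective s ; V-mono = V-mono s ∘ s<s
    ; O<V = λ j k → O<V s (Fin.punchIn i j) (Fin.suc k) }

  start-state : ∀ {n a} {O : Fin a → X} {V : Fin (suc n) → X} → State O V → State (cons (V Fin.zero) O) (V ∘ Fin.suc)
  start-state {O = O} {V} s = record
    { O-injective = inj ; V-mono = V-mono s ∘ s<s
    ; O<V = λ { Fin.zero k → V-mono s z<s ; (Fin.suc j) k → O<V s j (Fin.suc k) } }
    where
    inj : ∀ {i j} → cons (V Fin.zero) O i ≡ cons (V Fin.zero) O j → i ≡ j
    inj {Fin.zero} {Fin.zero} _ = refl
    inj {Fin.zero} {Fin.suc j} eq = contradiction (sym eq) (O≢V s)
    inj {Fin.suc i} {Fin.zero} eq = contradiction eq (O≢V s)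
    inj {Fin.suc i} {Fin.suc j} eq = cong Fin.suc (O-injective s eq)

  Image : ∀ {a} → (Fin a → X) → X → Set
  Image O x = ∃[ i ] x ≡ O i

  soundᶜ : ∀ {n a} (w : Closing n a) {O V x y} → (x , y) ∈ pairsᶜ w O V → Image O x × Image V y
  soundᶜ (skipᶜ w) p = let a , j , eq = soundᶜ w p in a , Fin.suc j , eq
  soundᶜ (close i w) (here refl) = (i , refl) , (Fin.zero , refl)
  soundᶜ (close i w) (there p) = let (k , eq) , (j , eq′) = soundᶜ w p in (Fin.punchIn i k , eq) , (Fin.suc j , eq′)

  soundᵒ : ∀ {n a} (w : Opening n a) {O V x y} → (x , y) ∈ pairsᵒ w O V → (Image O x ⊎ Image V x) × Image V y
  soundᵒ (skipᵒ w) p with soundᵒ w p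
  ... | inj₁ a , j , eq = inj₁ a , Fin.suc j , eq
  ... | inj₂ (k , e) , j , eq = inj₂ (Fin.suc k , e) , Fin.suc j , eq
  soundᵒ (start w) p with soundᵒ w p
  ... | inj₁ (Fin.zero , e) , j , eq = inj₂ (Fin.zero , e) , Fin.suc j , eq
  ... | inj₁ (Fin.suc i , e) , j , eq = inj₁ (i , e) , Fin.suc j , eq
  ... | inj₂ (k , e) , j , eq = inj₂ (Fin.suc k , e) , Fin.suc j , eq
  soundᵒ (close i w) (here refl) = inj₁ (i , refl) , (Fin.zero , refl)
  soundᵒ (close i w) (there p) = let (k , eq) , (j , eq′) = soundᶜ w p in inj₁ (Fin.punchIn i k , eq) , (Fin.suc j , eq′)

  -- A word can end only when no vertex is open.
  matchedᵒ : ∀ {n a} (w : Opening n a) {O V} i → ∃[ y ] (O i , y) ∈ pairsᵒ w O V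
  matchedᶜ : ∀ {n a} (w : Closing n a) {O V} i → ∃[ y ] (O i , y) ∈ pairsᶜ w O V
  matchedᶜ (skipᶜ w) i = matchedᶜ w i
  matchedᶜ (close i w) {O} {V} k with i Fin.≟ k
  ... | yes refl = V Fin.zero , here refl
  ... | no i≢k = let y , p = matchedᶜ w {O ∘ Fin.punchIn i} {V ∘ Fin.suc} (Fin.punchOut i≢k) in
    y , there (subst (λ z → (O z , y) ∈ pairsᶜ w (O ∘ Fin.punchIn i) (V ∘ Fin.suc)) (Fin.punchIn-punchOut i≢k) p)
  matchedᵒ (skipᵒ w) i = matchedᵒ w i
  matchedᵒ (start w) {O} {V} i = matchedᵒ w {cons (V Fin.zero) O} {V ∘ Fin.suc} (Fin.suc i)
  matchedᵒ (close i w) {O} {V} k = matchedᶜ (close i w) {O} {V} k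

  record CrossingMatching (M : X → X → Set) : Set where
    field
      functional : ∀ {x y y′} → M x y → M x y′ → y ≡ y′
      injective  : ∀ {x x′ y} → M x y → M x′ y → x ≡ x′
      crossing   : ∀ {x y x′ y′} → M x y → M x′ y′ → x Fin.< y′

  PairRel : List (X × X) → X → X → Set
  PairRel ps x y = (x , y) ∈ ps

  open CrossingMatching

  head-fresh : ∀ {n a O} {V : Fin (suc n) → X} → State {a = a} O V → ¬ Image (V ∘ Fin.suc) (V Fin.zero)
  head-fresh s (j , eq) = case V-injective s eq of λ ()

  closing-matching : ∀ {n a} (w : Closing n a) {O V} → State O V → CrossingMatching (PairRel (pairsᶜ w O V))
  closing-matching w {O} {V} s = record
    { functional = fun w s
    ; injective = inj w s
    ; crossing = λ p q → let (i , e) , _ = soundᶜ w p ; _ , (j , e′) = soundᶜ w q in subst₂ Fin._<_ (sym e) (sym e′) (O<V s i j)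
    }
    where
    fun : ∀ {n a} (w : Closing n a) {O V} → State O V → ∀ {x y y′} → (x , y) ∈ pairsᶜ w O V → (x , y′) ∈ pairsᶜ w O V → y ≡ y′
    fun (skipᶜ w) s p q = fun w (skip-state s) p q
    fun (close i w) s (here refl) (here refl) = refl
    fun (close i w) s (here refl) (there q) = let (k , e) , _ = soundᶜ w q in contradiction (sym (O-injective s e)) (Fin.punchInᵢ≢i i k)
    fun (close i w) s (there p) (here refl) = let (k , e) , _ = soundᶜ w p in contradiction (sym (O-injective s e)) (Fin.punchInᵢ≢i i k)
    fun (close i w) s (there p) (there q) = fun w (close-state i s) p q
    inj : ∀ {n a} (w : Closing n a) {O V} → State O V → ∀ {x x′ y} → (x , y) ∈ pairsᶜ w O V → (x′ , y) ∈ pairsᶜ w O V → x ≡ x′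
    inj (skipᶜ w) s p q = inj w (skip-state s) p q
    inj (close i w) s (here refl) (here refl) = refl
    inj (close i w) s (here refl) (there q) = contradiction (proj₂ (soundᶜ w q)) (head-fresh s)
    inj (close i w) s (there p) (here refl) = contradiction (proj₂ (soundᶜ w p)) (head-fresh s)
    inj (close i w) s (there p) (there q) = inj w (close-state i s) p q

  opening-matching : ∀ {n a} (w : Opening n a) {O V} → State O V → CrossingMatching (PairRel (pairsᵒ w O V))
  opening-matching done s = record { functional = λ () ; injective = λ () ; crossing = λ () }
  opening-matching (skipᵒ w) s = opening-matching w (skip-state s)
  opening-matching (start w) s = opening-matching w (start-state s)
  opening-matching (close i w) s = closing-matching (close i w) s

  pairsᶜ-unique : ∀ {n a} (w : Closing n a) {O V} → State O V → Unique (pairsᶜ w O V)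
  pairsᶜ-unique done s = []
  pairsᶜ-unique (skipᶜ w) s = pairsᶜ-unique w (skip-state s)
  pairsᶜ-unique (close i w) s = All.tabulate (λ { p refl → head-fresh s (proj₂ (soundᶜ w p)) }) ∷ pairsᶜ-unique w (close-state i s)

  pairsᵒ-unique : ∀ {n a} (w : Opening n a) {O V} → State O V → Unique (pairsᵒ w O V)
  pairsᵒ-unique done s = []
  pairsᵒ-unique (skipᵒ w) s = pairsᵒ-unique w (skip-state s)
  pairsᵒ-unique (start w) s = pairsᵒ-unique w (start-state s)
  pairsᵒ-unique (close i w) s = pairsᶜ-unique (close i w) s

  -- The head can be cancelled because its right end is the current vertex, and all pairs of the
  -- tails have later right ends.
  ≋-tail : ∀ {n a} {O : Fin a → X} {V : Fin (suc n) → X} {ps qs : List (X × X)} {z : X × X} → State O V → proj₂ z ≡ V Fin.zero →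
           (∀ {x y} → (x , y) ∈ ps → Image (V ∘ Fin.suc) y) → (∀ {x y} → (x , y) ∈ qs → Image (V ∘ Fin.suc) y) →
           (z ∷ ps) ≋ (z ∷ qs) → ps ≋ qs
  ≋-tail {V = V} {z = z} s zV p-tail q-tail (to , from) =
    (λ p → case to (there p) of λ { (here refl) → contradiction (subst (Image _) zV (p-tail p)) (head-fresh s) ; (there q) → q }) ,
    (λ q → case from (there q) of λ { (here refl) → contradiction (subst (Image _) zV (q-tail q)) (head-fresh s) ; (there p) → p })

  close-index : ∀ {n a b} (w w′ : Closing n a) {O : Fin (suc a) → X} {V : Fin (suc n) → X} {i j} → State O V → b ≡ i →
                (O b , V Fin.zero) ∈ (O j , V Fin.zero) ∷ pairsᶜ w′ (O ∘ Fin.punchIn j) (V ∘ Fin.suc) → i ≡ j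
  close-index w w′ s refl (here eq) = O-injective s (cong proj₁ eq)
  close-index w w′ s refl (there q) = contradiction (proj₂ (soundᶜ w′ q)) (head-fresh s)

  pairsᶜ-injective : ∀ {n a} (w w′ : Closing n a) {O V} → State O V → pairsᶜ w O V ≋ pairsᶜ w′ O V → w ≡ w′
  pairsᶜ-injective done done s eq = refl
  pairsᶜ-injective (skipᶜ w) (skipᶜ w′) s eq = cong skipᶜ (pairsᶜ-injective w w′ (skip-state s) eq)
  pairsᶜ-injective (skipᶜ w) (close i w′) s (_ , from) =
    contradiction (proj₂ (soundᶜ w (from (here refl)))) (head-fresh s)
  pairsᶜ-injective (close i w) (skipᶜ w′) s (to , _) =
    contradiction (proj₂ (soundᶜ w′ (to (here refl)))) (head-fresh s)
  pairsᶜ-injective (close i w) (close j w′) s eq with close-index w w′ s refl (proj₁ eq (here refl))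
  ... | refl = cong (close i) (pairsᶜ-injective w w′ (close-state i s)
        (≋-tail s refl (proj₂ ∘ soundᶜ w) (proj₂ ∘ soundᶜ w′) eq))

  -- The pairs determine the first letter: the current vertex is a right end after `close`, a left
  -- end after `start` because opened vertices get matched, and in no pair after `skipᵒ`.
  pairsᵒ-injective : ∀ {n a} (w w′ : Opening n a) {O V} → State O V → pairsᵒ w O V ≋ pairsᵒ w′ O V → w ≡ w′
  pairsᵒ-injective done done s eq = refl
  pairsᵒ-injective (skipᵒ w) (skipᵒ w′) s eq = cong skipᵒ (pairsᵒ-injective w w′ (skip-state s) eq)
  pairsᵒ-injective (start w) (start w′) s eq = cong start (pairsᵒ-injective w w′ (start-state s) eq)
  pairsᵒ-injective (close i w) (close j w′) s eq with close-index w w′ s refl (proj₁ eq (here refl))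
  ... | refl = cong (close i) (pairsᶜ-injective w w′ (close-state i s)
        (≋-tail s refl (proj₂ ∘ soundᶜ w) (proj₂ ∘ soundᶜ w′) eq))
  pairsᵒ-injective (skipᵒ w) (close i w′) s (_ , from) = contradiction (proj₂ (soundᵒ w (from (here refl)))) (head-fresh s)
  pairsᵒ-injective (start w) (close i w′) s (_ , from) = contradiction (proj₂ (soundᵒ w (from (here refl)))) (head-fresh s)
  pairsᵒ-injective (close i w) (skipᵒ w′) s (to , _) = contradiction (proj₂ (soundᵒ w′ (to (here refl)))) (head-fresh s)
  pairsᵒ-injective (close i w) (start w′) s (to , _) = contradiction (proj₂ (soundᵒ w′ (to (here refl)))) (head-fresh s)
  pairsᵒ-injective (skipᵒ w) (start w′) {O} {V} s (_ , from)
    with soundᵒ w (from (proj₂ (matchedᵒ w′ {cons (V Fin.zero) O} {V ∘ Fin.suc} Fin.zero)))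
  ... | inj₁ (i , e) , _ = contradiction (sym e) (O≢V s)
  ... | inj₂ e , _ = contradiction e (head-fresh s)
  pairsᵒ-injective (start w) (skipᵒ w′) {O} {V} s (to , _)
    with soundᵒ w′ (to (proj₂ (matchedᵒ w {cons (V Fin.zero) O} {V ∘ Fin.suc} Fin.zero)))
  ... | inj₁ (i , e) , _ = contradiction (sym e) (O≢V s)
  ... | inj₂ e , _ = contradiction e (head-fresh s)

  module Read {M : X → X → Set} (M? : ∀ x y → Dec (M x y)) (cm : CrossingMatching M) where

    -- The reading invariant: the partners of open vertices are still to come. With no vertices
    -- left, it forces that none is open.
    Saturated : ∀ {n a} → (Fin a → X) → (Fin n → X) → Set
    Saturated O V = ∀ i → ∃[ j ] M (O i) (V j)

    later-partner : ∀ {n a} {O : Fin a → X} {V : Fin (suc n) → X} i → ¬ M (O i) (V Fin.zero) →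
                    ∃[ j ] M (O i) (V j) → ∃[ j ] M (O i) (V (Fin.suc j))
    later-partner i ¬m (Fin.zero , m) = contradiction m ¬m
    later-partner i ¬m (Fin.suc j , m) = j , m

    close-saturated : ∀ {n a} {O : Fin (suc a) → X} {V : Fin (suc n) → X} → State O V → ∀ i → M (O i) (V Fin.zero) →
                      Saturated O V → Saturated (O ∘ Fin.punchIn i) (V ∘ Fin.suc)
    close-saturated {O = O} {V} s i m sat j = later-partner {O = O} {V} (Fin.punchIn i j)
      (λ m′ → Fin.punchInᵢ≢i i j (O-injective s (injective cm m′ m))) (sat (Fin.punchIn i j))

    readᶜ : ∀ n {a} (O : Fin a → X) (V : Fin n → X) → State O V → Saturated O V →
            Σ (Closing n a) λ w → (∀ {x y} → (x , y) ∈ pairsᶜ w O V → M x y) × (∀ i j → M (O i) (V j) → (O i , V j) ∈ pairsᶜ w O V)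

    closeᶜ : ∀ {n a} (O : Fin (suc a) → X) (V : Fin (suc n) → X) → State O V → Saturated O V → ∀ i → M (O i) (V Fin.zero) →
             Σ (Closing n a) λ w → (∀ {x y} → (x , y) ∈ pairsᶜ (close i w) O V → M x y) ×
                                   (∀ k j → M (O k) (V j) → (O k , V j) ∈ pairsᶜ (close i w) O V)
    closeᶜ {n} O V s sat i m with readᶜ n (O ∘ Fin.punchIn i) (V ∘ Fin.suc) (close-state i s) (close-saturated s i m sat)
    ... | w , snd , cmp = w , (λ { (here refl) → m ; (there p) → snd p }) , complete
      where
      complete : ∀ k j → M (O k) (V j) → (O k , V j) ∈ pairsᶜ (close i w) O V
      complete k Fin.zero m′ = here (cong (_, V Fin.zero) (injective cm m′ m))
      complete k (Fin.suc j) m′ with i Fin.≟ k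
      ... | yes refl = case V-injective s (functional cm m m′) of λ ()
      ... | no i≢k = there (subst (λ z → (O z , V (Fin.suc j)) ∈ pairsᶜ w (O ∘ Fin.punchIn i) (V ∘ Fin.suc)) (Fin.punchIn-punchOut i≢k)
              (cmp (Fin.punchOut i≢k) j (subst (λ z → M (O z) (V (Fin.suc j))) (sym (Fin.punchIn-punchOut i≢k)) m′)))

    readᶜ zero {zero} O V s sat = done , (λ ()) , λ ()
    readᶜ zero {suc a} O V s sat = case sat Fin.zero of λ { (() , _) }
    readᶜ (suc n) {a} O V s sat with Fin.any? (λ i → M? (O i) (V Fin.zero))
    readᶜ (suc n) {suc a} O V s sat | yes (i , m) = let w , snd , cmp = closeᶜ O V s sat i m in close i w , snd , cmp
    ... | no none with readᶜ n O (V ∘ Fin.suc) (skip-state s) (λ i → later-partner {O = O} {V} i (λ m → none (i , m)) (sat i))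
    ...   | w , snd , cmp = skipᶜ w , snd , λ { i Fin.zero m → contradiction (i , m) none ; i (Fin.suc j) m → cmp i j m }

    readᵒ : ∀ n {a} (O : Fin a → X) (V : Fin n → X) → State O V → Saturated O V →
            Σ (Opening n a) λ w → (∀ {x y} → (x , y) ∈ pairsᵒ w O V → M x y) × (∀ i j → M (O i) (V j) → (O i , V j) ∈ pairsᵒ w O V) ×
                                  (∀ i j → M (V i) (V j) → (V i , V j) ∈ pairsᵒ w O V)
    readᵒ zero {zero} O V s sat = done , (λ ()) , (λ ()) , λ ()
    readᵒ zero {suc a} O V s sat = case sat Fin.zero of λ { (() , _) }
    readᵒ (suc n) {a} O V s sat with Fin.any? (λ i → M? (O i) (V Fin.zero))
    readᵒ (suc n) {suc a} O V s sat | yes (i , m) = let w , snd , cmp = closeᶜ O V s sat i m in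
      -- The current vertex is a right end, and `crossing` puts every left end before it, so no pair
      -- lies within the vertices from here on.
      close i w , snd , cmp , λ k j m′ → contradiction (crossing cm m′ m) (≤⇒≯ (first k))
      where
      first : ∀ k → toℕ (V Fin.zero) ≤ toℕ (V k)
      first Fin.zero = ≤-refl
      first (Fin.suc k) = <⇒≤ (V-mono s z<s)
    ... | no none with Fin.any? (λ j → M? (V Fin.zero) (V (Fin.suc j)))
    ...   | yes (j₀ , m₀) with readᵒ n (cons (V Fin.zero) O) (V ∘ Fin.suc) (start-state s)
              (λ { Fin.zero → j₀ , m₀ ; (Fin.suc i) → later-partner {O = O} {V} i (λ m → none (i , m)) (sat i) })
    ...     | w , snd , cmp , cmp′ = start w , snd
              , (λ { i Fin.zero m → contradiction (i , m) none ; i (Fin.suc j) m → cmp (Fin.suc i) j m })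
              , λ { Fin.zero Fin.zero m → contradiction (crossing cm m m) (<-irrefl refl)
                  ; Fin.zero (Fin.suc j) m → cmp Fin.zero j m
                  ; (Fin.suc i) Fin.zero m → contradiction (crossing cm m m) (<⇒≯ (V-mono s z<s))
                  ; (Fin.suc i) (Fin.suc j) m → cmp′ i j m }
    readᵒ (suc n) {a} O V s sat | no none | no none′ with readᵒ n O (V ∘ Fin.suc) (skip-state s)
              (λ i → later-partner {O = O} {V} i (λ m → none (i , m)) (sat i))
    ...     | w , snd , cmp , cmp′ = skipᵒ w , snd
              , (λ { i Fin.zero m → contradiction (i , m) none ; i (Fin.suc j) m → cmp i j m })
              , λ { Fin.zero Fin.zero m → contradiction (crossing cm m m) (<-irrefl refl)
                  ; Fin.zero (Fin.suc j) m → contradiction (j , m) none′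
                  ; (Fin.suc i) Fin.zero m → contradiction (crossing cm m m) (<⇒≯ (V-mono s z<s))
                  ; (Fin.suc i) (Fin.suc j) m → cmp′ i j m }

Word : ℕ → Set
Word n = Opening n 0

pairs : ∀ {n} → Word n → List (Fin n × Fin n)
pairs w = pairsᵒ w (λ ()) id

initial : ∀ {n} → State {n} {n} {0} (λ ()) id
initial = record { O-injective = λ { {()} } ; V-mono = id ; O<V = λ () }

read : ∀ {n} {M : Fin n → Fin n → Set} → (∀ x y → Dec (M x y)) → CrossingMatching M →
       Σ (Word n) λ w → ∀ {x y} → ((x , y) ∈ pairs w → M x y) × (M x y → (x , y) ∈ pairs w)
read {n} M? cm = let w , snd , _ , cmp = Read.readᵒ M? cm n (λ ()) id initial (λ ()) in w , λ {x} {y} → snd , cmp x y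

-- Counting the words

countᶜ countᵒ : ℕ → ℕ → ℕ
countᶜ zero    zero    = 1
countᶜ zero    (suc a) = 0
countᶜ (suc n) zero    = countᶜ n 0
countᶜ (suc n) (suc a) = countᶜ n (suc a) + suc a * countᶜ n a
countᵒ zero    zero    = 1
countᵒ zero    (suc a) = 0
countᵒ (suc n) zero    = countᵒ n 0 + countᵒ n 1
countᵒ (suc n) (suc a) = countᵒ n (suc a) + (countᵒ n (suc (suc a)) + suc a * countᶜ n a)

enumerateᶜ : ∀ n a → Fin (countᶜ n a) ↔ Closing n a
enumerateᶜ zero zero = mk↔ₛ′ (λ _ → done) (λ _ → Fin.zero) (λ { done → refl }) (λ { Fin.zero → refl ; (Fin.suc ()) })
enumerateᶜ zero (suc a) = mk↔ₛ′ (λ ()) (λ ()) (λ ()) (λ ())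
enumerateᶜ (suc n) zero = ↔-trans (enumerateᶜ n 0) (mk↔ₛ′ skipᶜ (λ { (skipᶜ w) → w }) (λ { (skipᶜ w) → refl }) (λ _ → refl))
enumerateᶜ (suc n) (suc a) = ↔-trans Fin.+↔⊎ (↔-trans (enumerateᶜ n (suc a) ⊎-↔ ↔-trans Fin.*↔× (↔-refl ×-↔ enumerateᶜ n a))
  (mk↔ₛ′ [ skipᶜ , uncurry close ]′ (λ { (skipᶜ w) → inj₁ w ; (close i w) → inj₂ (i , w) })
    (λ { (skipᶜ w) → refl ; (close i w) → refl }) (λ { (inj₁ w) → refl ; (inj₂ (i , w)) → refl })))

enumerateᵒ : ∀ n a → Fin (countᵒ n a) ↔ Opening n a
enumerateᵒ zero zero = mk↔ₛ′ (λ _ → done) (λ _ → Fin.zero) (λ { done → refl }) (λ { Fin.zero → refl ; (Fin.suc ()) })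
enumerateᵒ zero (suc a) = mk↔ₛ′ (λ ()) (λ ()) (λ ()) (λ ())
enumerateᵒ (suc n) zero = ↔-trans Fin.+↔⊎ (↔-trans (enumerateᵒ n 0 ⊎-↔ enumerateᵒ n 1)
  (mk↔ₛ′ [ skipᵒ , start ]′ (λ { (skipᵒ w) → inj₁ w ; (start w) → inj₂ w })
    (λ { (skipᵒ w) → refl ; (start w) → refl }) (λ { (inj₁ w) → refl ; (inj₂ w) → refl })))
enumerateᵒ (suc n) (suc a) = ↔-trans Fin.+↔⊎ (↔-trans (enumerateᵒ n (suc a) ⊎-↔
    ↔-trans Fin.+↔⊎ (enumerateᵒ n (suc (suc a)) ⊎-↔ ↔-trans Fin.*↔× (↔-refl ×-↔ enumerateᶜ n a)))
  (mk↔ₛ′ [ skipᵒ , [ start , uncurry close ]′ ]′ (λ { (skipᵒ w) → inj₁ w ; (start w) → inj₂ (inj₁ w) ; (close i w) → inj₂ (inj₂ (i , w)) })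
    (λ { (skipᵒ w) → refl ; (start w) → refl ; (close i w) → refl })
    (λ { (inj₁ w) → refl ; (inj₂ (inj₁ w)) → refl ; (inj₂ (inj₂ (i , w))) → refl })))

nC0≡1 : ∀ n → n choose 0 ≡ 1
nC0≡1 zero    = refl
nC0≡1 (suc n) = refl

countᶜ≡ : ∀ n a → countᶜ n a ≡ (n choose a) * a !
countᶜ≡ zero zero = refl
countᶜ≡ zero (suc a) = sym (cong (_* suc a !) (k>n⇒nCk≡0 {0} {suc a} z<s))
countᶜ≡ (suc n) zero = trans (countᶜ≡ n 0) (cong (_* 1) (trans (nC0≡1 n) (sym (nC0≡1 (suc n)))))
countᶜ≡ (suc n) (suc a) = begin
  countᶜ n (suc a) + suc a * countᶜ n a ≡⟨ cong₂ (λ u v → u + suc a * v) (countᶜ≡ n (suc a)) (countᶜ≡ n a) ⟩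
  (n choose suc a) * (suc a * a !) + suc a * ((n choose a) * a !) ≡⟨ lem (n choose suc a) (n choose a) (suc a) (a !) ⟩
  ((n choose a) + (n choose suc a)) * (suc a * a !) ≡⟨ cong (_* (suc a * a !)) (nCk+nC[k+1]≡[n+1]C[k+1] n a) ⟩
  (suc n choose suc a) * (suc a * a !) ∎
  where
  open ≡-Reasoning
  lem : ∀ x y s f → x * (s * f) + s * (y * f) ≡ (y + x) * (s * f)
  lem = solve-∀

∑ : ℕ → (ℕ → ℕ) → ℕ
∑ n f = sum (List.applyUpTo f n)

∑-cong : ∀ n {f g : ℕ → ℕ} → (∀ j → f j ≡ g j) → ∑ n f ≡ ∑ n g
∑-cong zero    h = refl
∑-cong (suc n) h = cong₂ _+_ (h 0) (∑-cong n (h ∘ suc))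

∑-+ : ∀ n (f g : ℕ → ℕ) → ∑ n (λ j → f j + g j) ≡ ∑ n f + ∑ n g
∑-+ zero    f g = refl
∑-+ (suc n) f g = trans (cong (f 0 + g 0 +_) (∑-+ n (f ∘ suc) (g ∘ suc))) (lem (f 0) (g 0) _ _)
  where
  lem : ∀ a b c d → a + b + (c + d) ≡ a + c + (b + d)
  lem = solve-∀

∑-zero : ∀ n (f : ℕ → ℕ) → (∀ j → f j ≡ 0) → ∑ n f ≡ 0
∑-zero zero    f h = refl
∑-zero (suc n) f h = cong₂ _+_ (h 0) (∑-zero n (f ∘ suc) (h ∘ suc))

-- The words that open `j` more vertices: a + 2 * j of the `n` vertices are used, the first `j` of
-- them open, and the other a + j close the open vertices in any of (a + j) ! orders.
term : ℕ → ℕ → ℕ → ℕ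
term n a j = (n choose (a + 2 * j)) * (a + j) !

term-pascal : ∀ n a j → term (suc n) (suc a) j ≡ term n (suc a) j + (n choose (a + 2 * j)) * (suc a + j) !
term-pascal n a j = trans (cong (_* (suc a + j) !) (sym (nCk+nC[k+1]≡[n+1]C[k+1] n (a + 2 * j))))
  (trans (*-distribʳ-+ ((suc a + j) !) (n choose (a + 2 * j)) (n choose suc (a + 2 * j))) (+-comm ((n choose (a + 2 * j)) * (suc a + j) !) _))

shift : ∀ a j → a + 2 * suc j ≡ suc (suc a) + 2 * j
shift = solve-∀

shifted : ∀ n a j → (n choose (a + 2 * suc j)) * (suc a + suc j) ! ≡ term n (suc (suc a)) j
shifted n a j = cong₂ (λ u v → (n choose u) * v !) (shift a j) (+-suc (suc a) j)

-- Any number B of summands beyond the last nonzero one gives the same value.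
countᵒ≡ : ∀ n a B → n < a + 2 * B → countᵒ n a ≡ ∑ B (term n a)
countᵒ≡ zero zero (suc B) lt = cong suc (sym (∑-zero B (term 0 0 ∘ suc) (λ j → cong (_* suc j !) (k>n⇒nCk≡0 {0} {2 * suc j} z<s))))
countᵒ≡ zero (suc a) B lt = sym (∑-zero B (term 0 (suc a)) (λ j → cong (_* (suc a + j) !) (k>n⇒nCk≡0 {0} {suc a + 2 * j} z<s)))
countᵒ≡ (suc n) zero (suc B) lt = begin
  countᵒ n 0 + countᵒ n 1 ≡⟨ cong₂ _+_ (countᵒ≡ n 0 (suc B) (<-trans (n<1+n n) lt)) (countᵒ≡ n 1 B (≤-pred (subst (suc n <_) (shift 0 B) lt))) ⟩
  term n 0 0 + ∑ B (term n 0 ∘ suc) + ∑ B (term n 1)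
    ≡⟨ trans (cong (λ z → z * 1 + ∑ B (term n 0 ∘ suc) + ∑ B (term n 1)) (nC0≡1 n)) (+-assoc 1 (∑ B (term n 0 ∘ suc)) (∑ B (term n 1))) ⟩
  1 + (∑ B (term n 0 ∘ suc) + ∑ B (term n 1)) ≡⟨ cong suc (sym (∑-+ B (term n 0 ∘ suc) (term n 1))) ⟩
  1 + ∑ B (λ j → term n 0 (suc j) + term n 1 j) ≡⟨ cong suc (∑-cong B pascal) ⟩
  1 + ∑ B (term (suc n) 0 ∘ suc) ∎
  where
  open ≡-Reasoning
  pascal : ∀ j → term n 0 (suc j) + term n 1 j ≡ term (suc n) 0 (suc j)
  pascal j = begin
    (n choose (2 * suc j)) * suc j ! + (n choose (1 + 2 * j)) * (1 + j) ! ≡⟨ sym (*-distribʳ-+ (suc j !) (n choose (2 * suc j)) (n choose (1 + 2 * j))) ⟩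
    ((n choose (2 * suc j)) + (n choose (1 + 2 * j))) * suc j !
      ≡⟨ cong (_* suc j !) (trans (+-comm (n choose (2 * suc j)) _) (trans (cong (λ z → (n choose (1 + 2 * j)) + (n choose z)) (shift 0 j)) (nCk+nC[k+1]≡[n+1]C[k+1] n (1 + 2 * j)))) ⟩
    (suc n choose (2 + 2 * j)) * suc j ! ≡⟨ cong (λ z → (suc n choose z) * suc j !) (sym (shift 0 j)) ⟩
    (suc n choose (2 * suc j)) * suc j ! ∎
countᵒ≡ (suc n) (suc a) zero lt = begin
  countᵒ n (suc a) + (countᵒ n (suc (suc a)) + suc a * countᶜ n a)
    ≡⟨ cong₂ _+_ (countᵒ≡ n (suc a) 0 (<-trans (n<1+n n) lt)) (cong₂ (λ u v → u + suc a * v) (countᵒ≡ n (suc (suc a)) 0 (<-trans (<-trans (n<1+n n) lt) (n<1+n _))) (countᶜ≡ n a)) ⟩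
  suc a * ((n choose a) * a !) ≡⟨ cong (λ z → suc a * (z * a !)) (k>n⇒nCk≡0 (≤-pred (subst (suc n <_) (+-identityʳ (suc a)) lt))) ⟩
  suc a * 0 ≡⟨ *-zeroʳ (suc a) ⟩
  0 ∎
  where open ≡-Reasoning
countᵒ≡ (suc n) (suc a) (suc B) lt = begin
  countᵒ n (suc a) + (countᵒ n (suc (suc a)) + suc a * countᶜ n a)
    ≡⟨ cong₂ _+_ (countᵒ≡ n (suc a) (suc B) (<-trans (n<1+n n) lt)) (cong₂ (λ u v → u + suc a * v)
         (countᵒ≡ n (suc (suc a)) B (≤-pred (subst (suc n <_) (shift (suc a) B) lt))) (countᶜ≡ n a)) ⟩
  ∑ (suc B) (term n (suc a)) + (∑ B (term n (suc (suc a))) + suc a * ((n choose a) * a !))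
    -- This is the part of Pascal's rule for words using the next vertex: for j = 0 it closes an
    -- open vertex, for larger j it opens.
    ≡⟨ cong (∑ (suc B) (term n (suc a)) +_) (trans (+-comm (∑ B (term n (suc (suc a)))) _) (cong₂ _+_ first (∑-cong B (λ j → sym (shifted n a j))))) ⟩
  ∑ (suc B) (term n (suc a)) + ∑ (suc B) (λ j → (n choose (a + 2 * j)) * (suc a + j) !) ≡⟨ sym (∑-+ (suc B) (term n (suc a)) (λ j → (n choose (a + 2 * j)) * (suc a + j) !)) ⟩
  ∑ (suc B) (λ j → term n (suc a) j + (n choose (a + 2 * j)) * (suc a + j) !) ≡⟨ ∑-cong (suc B) (λ j → sym (term-pascal n a j)) ⟩
  ∑ (suc B) (term (suc n) (suc a)) ∎
  where
  open ≡-Reasoning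
  rearrange : ∀ s c f → s * (c * f) ≡ c * (s * f)
  rearrange = solve-∀
  first : suc a * ((n choose a) * a !) ≡ (n choose (a + 2 * 0)) * (suc a + 0) !
  first = trans (rearrange (suc a) (n choose a) (a !)) (cong₂ (λ u v → (n choose u) * suc v !) (sym (+-identityʳ a)) (sym (+-identityʳ a)))

n<2[1+⌊n/2⌋] : ∀ n → n < 2 * suc ⌊ n /2⌋
n<2[1+⌊n/2⌋] zero = z<s
n<2[1+⌊n/2⌋] (suc zero) = s<s z<s
n<2[1+⌊n/2⌋] (suc (suc n)) = subst (suc (suc n) <_) (sym (shift 0 (suc ⌊ n /2⌋))) (s<s (s<s (n<2[1+⌊n/2⌋] n)))

minSpeed≡∑ : ∀ n → minSpeed n ≡ ∑ (suc ⌊ n /2⌋) (term n 0)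
minSpeed≡∑ n = cong sum (ListP.map-upTo (term n 0) (suc ⌊ n /2⌋))

minSpeed≡countᵒ : ∀ n → minSpeed n ≡ countᵒ n 0
minSpeed≡countᵒ n = trans (minSpeed≡∑ n) (sym (countᵒ≡ n 0 (suc ⌊ n /2⌋) (n<2[1+⌊n/2⌋] n)))

enumerate : ∀ n → Fin (minSpeed n) ↔ Word n
enumerate n = subst (λ m → Fin m ↔ Word n) (sym (minSpeed≡countᵒ n)) (enumerateᵒ n 0)

-- Crossing hypergraphs and their closure under containment

subset-ext : ∀ {n} {e f : Subset n} → (∀ {x} → e ∋ᶠ x → f ∋ᶠ x) → (∀ {x} → f ∋ᶠ x → e ∋ᶠ x) → e ≡ f
subset-ext {e = e} {f} e⊆ f⊆ = trans (sym (Vec.tabulate∘lookup e)) (trans (Vec.tabulate-cong agree) (Vec.tabulate∘lookup f))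
  where
  agree : ∀ x → Vec.lookup e x ≡ Vec.lookup f x
  agree x with Vec.lookup e x in ex | Vec.lookup f x in fx
  ... | true  | true  = refl
  ... | true  | false = trans (sym (e⊆ ex)) fx
  ... | false | true  = trans (sym ex) (f⊆ fx)
  ... | false | false = refl

-- Phrased through elements instead of cardinality, so that it transports along injective vertex
-- maps.
AtMostTwo : ∀ {n} → Subset n → Set
AtMostTwo {n} e = ∀ {x y z : Fin n} → e ∋ᶠ x → e ∋ᶠ y → e ∋ᶠ z → x ≡ y ⊎ x ≡ z ⊎ y ≡ z

atMostTwo⇒≤2 : ∀ {n} (e : Subset n) → AtMostTwo e → ∣ e ∣ ≤ 2
atMostTwo⇒≤2 e two = ≮⇒≥ λ 2< →
  let x , ex , rx = nth-element e 0 (<-trans z<s 2<)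
      y , ey , ry = nth-element e 1 (<-trans (s<s z<s) 2<)
      z , ez , rz = nth-element e 2 2<
  in case two {x} {y} {z} ex ey ez of λ
    { (inj₁ eq) → case clash rx ry eq of λ ()
    ; (inj₂ (inj₁ eq)) → case clash rx rz eq of λ ()
    ; (inj₂ (inj₂ eq)) → case clash ry rz eq of λ () }
  where
  clash : ∀ {x y i j} → rank (at e) (toℕ x) ≡ i → rank (at e) (toℕ y) ≡ j → x ≡ y → i ≡ j
  clash rx ry eq = trans (sym rx) (trans (cong (rank (at e) ∘ toℕ) eq) ry)

pairEdge : ∀ {n} → Fin n × Fin n → Subset n
pairEdge (x , y) = ⁅ x ⁆ ∪ ⁅ y ⁆

pair∋⁻ : ∀ {n} (x y : Fin n) {z} → pairEdge (x , y) ∋ᶠ z → z ≡ x ⊎ z ≡ y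
pair∋⁻ x y {z} h with x∈p∪q⁻ ⁅ x ⁆ ⁅ y ⁆ (Vec.lookup⇒[]= z _ h)
... | inj₁ p = inj₁ (x∈⁅y⁆⇒x≡y x p)
... | inj₂ p = inj₂ (x∈⁅y⁆⇒x≡y y p)

pair∋ˡ : ∀ {n} (x y : Fin n) → pairEdge (x , y) ∋ᶠ x
pair∋ˡ x y = Vec.[]=⇒lookup (x∈p∪q⁺ {p = ⁅ x ⁆} {⁅ y ⁆} (inj₁ (x∈⁅x⁆ x)))

pair∋ʳ : ∀ {n} (x y : Fin n) → pairEdge (x , y) ∋ᶠ y
pair∋ʳ x y = Vec.[]=⇒lookup (x∈p∪q⁺ {p = ⁅ x ⁆} {⁅ y ⁆} (inj₂ (x∈⁅x⁆ y)))

atMostTwo-pair : ∀ {n} (x y : Fin n) → AtMostTwo (pairEdge (x , y))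
atMostTwo-pair x y {z₁} {z₂} {z₃} a b c with pair∋⁻ x y {z₁} a | pair∋⁻ x y {z₂} b | pair∋⁻ x y {z₃} c
... | inj₁ refl | inj₁ refl | _         = inj₁ refl
... | inj₁ refl | inj₂ _    | inj₁ refl = inj₂ (inj₁ refl)
... | inj₁ refl | inj₂ refl | inj₂ refl = inj₂ (inj₂ refl)
... | inj₂ refl | inj₂ refl | _         = inj₁ refl
... | inj₂ refl | inj₁ _    | inj₂ refl = inj₂ (inj₁ refl)
... | inj₂ refl | inj₁ refl | inj₁ refl = inj₂ (inj₂ refl)

atMostTwo-member : ∀ {n} {e : Subset n} {x y z} → AtMostTwo e → x ≢ y → e ∋ᶠ x → e ∋ᶠ y → e ∋ᶠ z → z ≡ x ⊎ z ≡ y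
atMostTwo-member {x = x} {y} {z} two x≢y ex ey ez with two {z} {x} {y} ez ex ey
... | inj₁ z≡x = inj₁ z≡x
... | inj₂ (inj₁ z≡y) = inj₂ z≡y
... | inj₂ (inj₂ x≡y) = contradiction x≡y x≢y

pairEdge-≡ : ∀ {n} {e : Subset n} {x y} → AtMostTwo e → x ≢ y → e ∋ᶠ x → e ∋ᶠ y → e ≡ pairEdge (x , y)
pairEdge-≡ {e = e} {x} {y} two x≢y ex ey = subset-ext
  (λ {z} ez → case atMostTwo-member {e = e} {x} {y} {z} two x≢y ex ey ez of λ { (inj₁ refl) → pair∋ˡ x y ; (inj₂ refl) → pair∋ʳ x y })
  (λ {z} h → case pair∋⁻ x y {z} h of λ { (inj₁ refl) → ex ; (inj₂ refl) → ey })

pairEdge-injective : ∀ {n} {x y x′ y′ : Fin n} → x Fin.< y → x′ Fin.< y′ → pairEdge (x , y) ≡ pairEdge (x′ , y′) → (x , y) ≡ (x′ , y′)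
pairEdge-injective {x = x} {y} {x′} {y′} x<y x′<y′ eq
  with pair∋⁻ x′ y′ {x} (subst (_∋ᶠ x) eq (pair∋ˡ x y)) | pair∋⁻ x′ y′ {y} (subst (_∋ᶠ y) eq (pair∋ʳ x y))
... | inj₁ refl | inj₁ refl = contradiction x<y (<-irrefl refl)
... | inj₁ refl | inj₂ refl = refl
... | inj₂ refl | inj₁ refl = contradiction x<y (<⇒≯ x′<y′)
... | inj₂ refl | inj₂ refl = contradiction x<y (<-irrefl refl)

-- For edges of size two, crosses says min e < max f, so every left endpoint
-- precedes every right endpoint.
record Crossing {n} (G : OrderedHypergraph n) : Set where
  private module G = OrderedHypergraph G
  field
    thin     : ∀ {e} → e ∈ G.edges → AtMostTwo e
    disjoint : ∀ {e f x} → e ∈ G.edges → f ∈ G.edges → e ∋ᶠ x → f ∋ᶠ x → e ≡ f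
    crosses  : ∀ {e f} → e ∈ G.edges → f ∈ G.edges → ∃[ x ] ∃[ y ] e ∋ᶠ x × f ∋ᶠ y × x G.< y

crossing-degree : ∀ {n} {G : OrderedHypergraph n} → Crossing G → ∀ v → degree G v ≤ 1
crossing-degree {G = G} c v = length≤1 (Unique.filter⁺ (v Subset.∈?_) (edges-unique G))
  (λ e∈ f∈ → let e∈′ , ve = ∈-filter⁻ (v Subset.∈?_) {xs = edges G} e∈
                 f∈′ , vf = ∈-filter⁻ (v Subset.∈?_) {xs = edges G} f∈
             in Crossing.disjoint c {x = v} e∈′ f∈′ (Vec.[]=⇒lookup ve) (Vec.[]=⇒lookup vf))

crossing-≅ : ∀ {n} {G H : OrderedHypergraph n} → G ≅ H → Crossing G → Crossing H
crossing-≅ {n} {G} {H} i c = record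
  { thin = λ {s} s∈ {x} {y} {z} sx sy sz → transfer (C.thin (back s∈) {preimage x} {preimage y} {preimage z} (pull s sx) (pull s sy) (pull s sz))
  ; disjoint = λ {s} {t} {x} s∈ t∈ sx tx → trace-injective to surj (C.disjoint {x = preimage x} (back s∈) (back t∈) (pull s sx) (pull t tx))
  ; crosses = λ {s} {t} s∈ t∈ → let a , b , sa , tb , lt = C.crosses (back s∈) (back t∈) in
      to a , to b , trans (sym (lookup-trace to s a)) sa , trans (sym (lookup-trace to t b)) tb , I.mono lt
  }
  where
  open _≅_ i
  module I = IsOrderIsomorphism isOrderIsomorphism
  module C = Crossing c
  surj : ∀ y → ∃[ x ] to x ≡ y
  surj y = let x , h = I.surjective y in x , h refl
  back : ∀ {s} → s ∈ edges H → trace to s ∈ edges G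
  back {s} = Equivalence.from (preservesEdges s)
  preimage : Fin n → Fin n
  preimage y = proj₁ (surj y)
  pull : ∀ s {y} → s ∋ᶠ y → trace to s ∋ᶠ preimage y
  pull s {y} sy = trans (lookup-trace to s (preimage y)) (trans (cong (Vec.lookup s) (proj₂ (surj y))) sy)
  same : ∀ {x y} → preimage x ≡ preimage y → x ≡ y
  same {x} {y} eq = trans (sym (proj₂ (surj x))) (trans (cong to eq) (proj₂ (surj y)))
  transfer : ∀ {x y z} → preimage x ≡ preimage y ⊎ preimage x ≡ preimage z ⊎ preimage y ≡ preimage z → x ≡ y ⊎ x ≡ z ⊎ y ≡ z
  transfer (inj₁ eq) = inj₁ (same eq)
  transfer (inj₂ (inj₁ eq)) = inj₂ (inj₁ (same eq))
  transfer (inj₂ (inj₂ eq)) = inj₂ (inj₂ (same eq))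

-- Edges of `H` have at most two vertices, so a trace with two vertices has lost none (`reach`), and
-- the vertices witnessing `crosses` survive.
crossing-sub : ∀ {m n} {L : OrderedHypergraph m} {H : OrderedHypergraph n} → SubHypergraph L H → Crossing H → Crossing L
crossing-sub {L = L} {H} sub c = record
  { thin = λ {d} d∈ {x} {y} {z} dx dy dz → let e , e∈ , eq = isTrace d∈ in
      thin′ (C.thin e∈ {ι x} {ι y} {ι z} (push {d} {e} {x} eq dx) (push {d} {e} {y} eq dy) (push {d} {e} {z} eq dz))
  ; disjoint = λ {d} {d′} {x} d∈ d′∈ dx d′x → let e , e∈ , eq = isTrace d∈ ; e′ , e′∈ , eq′ = isTrace d′∈ in
      trans eq (trans (cong (trace ι) (C.disjoint {x = ι x} e∈ e′∈ (push {d} {e} {x} eq dx) (push {d′} {e′} {x} eq′ d′x))) (sym eq′))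
  ; crosses = λ d∈ d′∈ → let e , e∈ , eq = isTrace d∈ ; e′ , e′∈ , eq′ = isTrace d′∈
                             p , q , ep , e′q , lt = C.crosses e∈ e′∈
                             x , dx , ιx = reach {p = p} d∈ e∈ eq ep
                             y , d′y , ιy = reach {p = q} d′∈ e′∈ eq′ e′q
                         in x , y , dx , d′y , I.cancel (subst₂ (OrderedHypergraph._<_ H) (sym ιx) (sym ιy) lt)
  }
  where
  open SubHypergraph sub
  module I = IsOrderMonomorphism isOrderMonomorphism
  module C = Crossing c
  push : ∀ {d e x} → d ≡ trace ι e → d ∋ᶠ x → e ∋ᶠ ι x
  push {e = e} {x} refl dx = trans (sym (lookup-trace ι e x)) dx
  thin′ : ∀ {x y z} → ι x ≡ ι y ⊎ ι x ≡ ι z ⊎ ι y ≡ ι z → x ≡ y ⊎ x ≡ z ⊎ y ≡ z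
  thin′ (inj₁ eq) = inj₁ (I.injective eq)
  thin′ (inj₂ (inj₁ eq)) = inj₂ (inj₁ (I.injective eq))
  thin′ (inj₂ (inj₂ eq)) = inj₂ (inj₂ (I.injective eq))
  reach : ∀ {d e p} → d ∈ edges L → e ∈ edges H → d ≡ trace ι e → e ∋ᶠ p → ∃[ x ] d ∋ᶠ x × ι x ≡ p
  reach {d} {e} {p} d∈ e∈ eq ep with two-elements d (All.lookup (edges-size L) d∈)
  ... | x , y , x<y , dx , dy with atMostTwo-member {e = e} {ι x} {ι y} {p} (C.thin e∈) (λ eq′ → <⇒≢ x<y (cong toℕ (I.injective eq′))) (push {d} {e} {x} eq dx) (push {d} {e} {y} eq dy) ep
  ...   | inj₁ p≡ = x , dx , sym p≡
  ...   | inj₂ p≡ = y , dy , sym p≡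

crossing-⊑ : ∀ {m n} {K : OrderedHypergraph m} {H : OrderedHypergraph n} → K ⊑ H → Crossing H → Crossing K
crossing-⊑ {K = K} {H} (L , same , sub , fs , ds , fs↭ , ds↭ , pw) c = record
  { thin = λ e∈ {x} {y} {z} → C.thin (inL e∈) {x} {y} {z}
  ; disjoint = λ {_} {_} {x} e∈ f∈ → C.disjoint {x = x} (inL e∈) (inL f∈)
  ; crosses = λ e∈ f∈ → let x , y , ex , fy , lt = C.crosses (inL e∈) (inL f∈) in x , y , ex , fy , Equivalence.from (same x y) lt
  }
  where
  module C = Crossing (crossing-sub sub c)
  larger : ∀ {fs ds} → Pointwise _⊆_ fs ds → ∀ {f} → f ∈ fs → ∃[ d ] d ∈ ds × f ⊆ d
  larger (f⊆d ∷ pw) (here refl) = _ , here refl , f⊆d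
  larger (_ ∷ pw) (there f∈) = let d , d∈ , f⊆d = larger pw f∈ in d , there d∈ , f⊆d
  -- Here `f` lies in some `d`, has at least two vertices and `d` at most two, so f = d: containment
  -- cannot shrink these edges.
  inL : ∀ {f} → f ∈ edges K → f ∈ edges L
  inL {f} f∈ with larger pw (∈-resp-↭ (↭-sym fs↭) f∈)
  ... | d , d∈ , f⊆d with two-elements f (All.lookup (edges-size K) f∈)
  ...   | x , y , x<y , fx , fy = subst (_∈ edges L) (sym (subset-ext into out)) d∈L
    where
    d∈L : d ∈ edges L
    d∈L = ∈-resp-↭ ds↭ d∈
    into : ∀ {z} → f ∋ᶠ z → d ∋ᶠ z
    into {z} fz = Vec.[]=⇒lookup (f⊆d (Vec.lookup⇒[]= z f fz))
    out : ∀ {z} → d ∋ᶠ z → f ∋ᶠ z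
    out {z} dz with atMostTwo-member {e = d} {x} {y} {z} (C.thin d∈L) (λ x≡y → <⇒≢ x<y (cong toℕ x≡y)) (into {x} fx) (into {y} fy) dz
    ... | inj₁ refl = fx
    ... | inj₂ refl = fy

-- Crossing hypergraphs correspond to words

module _ {n : ℕ} (w : Word n) where

  word-matching : CrossingMatching (PairRel (pairs w))
  word-matching = opening-matching w initial

  pairs-increasing : ∀ {x y} → (x , y) ∈ pairs w → x Fin.< y
  pairs-increasing p = CrossingMatching.crossing word-matching p p

  wordEdges : List (Subset n)
  wordEdges = map pairEdge (pairs w)

  wordEdges⁻ : ∀ {e} → e ∈ wordEdges → ∃[ x ] ∃[ y ] (x , y) ∈ pairs w × e ≡ pairEdge (x , y)
  wordEdges⁻ e∈ = let (x , y) , p , eq = ∈-map⁻ pairEdge e∈ in x , y , p , eq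

  wordGraph : OrderedHypergraph n
  wordGraph = standard wordEdges
    (map-unique pairEdge (λ p q → pairEdge-injective (pairs-increasing p) (pairs-increasing q)) (pairsᵒ-unique w initial))
    (All.map⁺ (All.tabulate (λ {(x , y)} p → two≤∣∣ (pairEdge (x , y)) (λ x≡y → <⇒≢ (pairs-increasing p) (cong toℕ x≡y)) (pair∋ˡ x y) (pair∋ʳ x y))))

  wordGraph-crossing : Crossing wordGraph
  wordGraph-crossing = record
    { thin = λ e∈ → thin-edge e∈
    ; disjoint = λ {_} {_} {z} e∈ f∈ ez fz → case wordEdges⁻ e∈ , wordEdges⁻ f∈ of λ
        { ((x , y , p , refl) , (x′ , y′ , q , refl)) → shared p q (pair∋⁻ x y {z} ez) (pair∋⁻ x′ y′ {z} fz) }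
    ; crosses = λ e∈ f∈ → case wordEdges⁻ e∈ , wordEdges⁻ f∈ of λ
        { ((x , y , p , refl) , (x′ , y′ , q , refl)) → x , y′ , pair∋ˡ x y , pair∋ʳ x′ y′ , W.crossing p q }
    }
    where
    module W = CrossingMatching word-matching
    thin-edge : ∀ {e} → e ∈ wordEdges → AtMostTwo e
    thin-edge e∈ {a} {b} {c} with wordEdges⁻ e∈
    ... | x , y , _ , refl = atMostTwo-pair x y {a} {b} {c}
    shared : ∀ {x y x′ y′ z} → (x , y) ∈ pairs w → (x′ , y′) ∈ pairs w → z ≡ x ⊎ z ≡ y → z ≡ x′ ⊎ z ≡ y′ → pairEdge (x , y) ≡ pairEdge (x′ , y′)
    shared p q (inj₁ refl) (inj₁ refl) = cong (λ z → pairEdge (_ , z)) (W.functional p q)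
    shared p q (inj₁ refl) (inj₂ refl) = contradiction (W.crossing p q) (<-irrefl refl)
    shared p q (inj₂ refl) (inj₁ refl) = contradiction (W.crossing q p) (<-irrefl refl)
    shared p q (inj₂ refl) (inj₂ refl) = cong (λ z → pairEdge (z , _)) (W.injective p q)

module _ {n : ℕ} (E : List (Subset n)) where

  Joined : Fin n → Fin n → Set
  Joined x y = x Fin.< y × Any (λ e → e ∋ᶠ x × e ∋ᶠ y) E

  joined? : ∀ x y → Dec (Joined x y)
  joined? x y = (x Fin.<? y) ×-dec Any.any? (λ e → (Vec.lookup e x Bool.≟ true) ×-dec (Vec.lookup e y Bool.≟ true)) E

  joined-matching : ∀ {u s} → Crossing (standard E u s) → CrossingMatching Joined
  joined-matching c = record
    { functional = λ { {x} {y} {y′} (x<y , j) (x<y′ , j′) → let e , e∈ , ex , ey = find j ; e′ , e′∈ , e′x , e′y′ = find j′ in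
        case C.thin e∈ {x} {y} {y′} ex ey (subst (_∋ᶠ y′) (C.disjoint {x = x} e′∈ e∈ e′x ex) e′y′) of λ
          { (inj₁ refl) → contradiction x<y (<-irrefl refl)
          ; (inj₂ (inj₁ refl)) → contradiction x<y′ (<-irrefl refl)
          ; (inj₂ (inj₂ eq)) → eq } }
    ; injective = λ { {x} {x′} {y} (x<y , j) (x′<y , j′) → let e , e∈ , ex , ey = find j ; e′ , e′∈ , e′x′ , e′y = find j′ in
        case C.thin e∈ {x} {x′} {y} ex (subst (_∋ᶠ x′) (C.disjoint {x = y} e′∈ e∈ e′y ey) e′x′) ey of λ
          { (inj₁ eq) → eq
          ; (inj₂ (inj₁ refl)) → contradiction x<y (<-irrefl refl)
          ; (inj₂ (inj₂ refl)) → contradiction x′<y (<-irrefl refl) } }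
    ; crossing = λ { {x} {y} {x′} {y′} (x<y , j) (x′<y′ , j′) → let e , e∈ , ex , ey = find j ; e′ , e′∈ , e′x′ , e′y′ = find j′
                                                                    p , q , ep , e′q , lt = C.crosses e∈ e′∈
          -- `crosses` gives some p in `e` before some q in `e′`; then x ≤ p < q ≤ y′, because x is
          -- the smaller end of `e` and y′ the larger end of `e′`.
          in ≤-<-trans (lower-end x<y (atMostTwo-member {e = e} {x} {y} {p} (C.thin e∈) (λ eq → <⇒≢ x<y (cong toℕ eq)) ex ey ep))
               (<-≤-trans lt (upper-end x′<y′ (atMostTwo-member {e = e′} {x′} {y′} {q} (C.thin e′∈) (λ eq → <⇒≢ x′<y′ (cong toℕ eq)) e′x′ e′y′ e′q))) }
    }
    where
    module C = Crossing c
    lower-end : ∀ {x y p : Fin n} → x Fin.< y → p ≡ x ⊎ p ≡ y → toℕ x ≤ toℕ p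
    lower-end x<y (inj₁ refl) = ≤-refl
    lower-end x<y (inj₂ refl) = <⇒≤ x<y
    upper-end : ∀ {x y q : Fin n} → x Fin.< y → q ≡ x ⊎ q ≡ y → toℕ q ≤ toℕ y
    upper-end x<y (inj₁ refl) = <⇒≤ x<y
    upper-end x<y (inj₂ refl) = ≤-refl

module _ {n : ℕ} (E : List (Subset n)) (u : Unique E) (s : All (λ e → 2 ≤ ∣ e ∣) E) (c : Crossing (standard E u s)) where

  joined-edge : ∀ {e x y} → e ∈ E → x Fin.< y → e ∋ᶠ x → e ∋ᶠ y → e ≡ pairEdge (x , y)
  joined-edge {e} {x} {y} e∈ x<y = pairEdge-≡ {e = e} {x} {y} (Crossing.thin c e∈) (λ x≡y → <⇒≢ x<y (cong toℕ x≡y))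

  joined⇒edge : ∀ {x y} → Joined E x y → pairEdge (x , y) ∈ E
  joined⇒edge {x} {y} (x<y , j) = let e , e∈ , ex , ey = find j in subst (_∈ E) (joined-edge {e} {x} {y} e∈ x<y ex ey) e∈

  edge⇒joined : ∀ {e} → e ∈ E → ∃[ x ] ∃[ y ] Joined E x y × e ≡ pairEdge (x , y)
  edge⇒joined {e} e∈ = let x , y , x<y , ex , ey = two-elements e (All.lookup s e∈) in
    x , y , (x<y , lose e∈ (ex , ey)) , joined-edge {e} {x} {y} e∈ x<y ex ey

  read-standard : Σ (Word n) λ w → wordGraph w ≅ standard E u s
  read-standard = finish (read (joined? E) (joined-matching E {u} {s} c))
    where
    finish : (Σ (Word n) λ w → ∀ {x y} → ((x , y) ∈ pairs w → Joined E x y) × (Joined E x y → (x , y) ∈ pairs w)) →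
             Σ (Word n) λ w → wordGraph w ≅ standard E u s
    finish (w , spec) = w , standard-≅
      ( (λ e∈ → let x , y , p , eq = wordEdges⁻ w e∈ in subst (_∈ E) (sym eq) (joined⇒edge (proj₁ (spec {x} {y}) p)))
      , (λ e∈ → let x , y , j , eq = edge⇒joined e∈ in subst (_∈ wordEdges w) (sym eq) (∈-map⁺ pairEdge (proj₂ (spec {x} {y}) j))))

read-graph : ∀ {n} (G : OrderedHypergraph n) → Crossing G → Σ (Word n) λ w → wordGraph w ≅ G
read-graph G c = let w , i = read-standard stdEdges stdEdges-unique stdEdges-size (crossing-≅ (≅-sym std≅) c) in w , ≅-trans i std≅
  where open Standardise G

-- A strictly increasing self-map moves no point down, and this applies to `f` and to its inverse.
-- Hence isomorphic hypergraphs on the usual order have the same edges.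
strictlyMonotone⇒id : ∀ {n} (f : Fin n → Fin n) → (∀ {x y} → x Fin.< y → f x Fin.< f y) → (∀ y → ∃[ x ] f x ≡ y) → ∀ x → f x ≡ x
strictlyMonotone⇒id {n} f mono surj x = Fin.toℕ-injective (≤-antisym below (expands f mono _ x refl))
  where
  expands : ∀ (g : Fin n → Fin n) → (∀ {x y} → x Fin.< y → g x Fin.< g y) → ∀ m x → toℕ x ≡ m → m ≤ toℕ (g x)
  expands g mono zero x eq = z≤n
  expands g mono (suc m) x eq = ≤-<-trans (expands g mono m x⁻ (Fin.toℕ-fromℕ< m<n))
      (mono (subst₂ _<_ (sym (Fin.toℕ-fromℕ< m<n)) (sym eq) (n<1+n m)))
    where
    m<n : m < n
    m<n = <-trans (n<1+n m) (subst (_< n) eq (Fin.toℕ<n x))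
    x⁻ = fromℕ< m<n
  module F = IsOrderMonomorphism (strictlyMonotone⇒monomorphism Fin.<-isStrictTotalOrder Fin.<-isStrictTotalOrder mono)
  g : Fin n → Fin n
  g y = proj₁ (surj y)
  g-mono : ∀ {x y} → x Fin.< y → g x Fin.< g y
  g-mono {x} {y} x<y = F.cancel (subst₂ Fin._<_ (sym (proj₂ (surj x))) (sym (proj₂ (surj y))) x<y)
  below : toℕ (f x) ≤ toℕ x
  below = subst (λ z → toℕ (f x) ≤ toℕ z) (F.injective (proj₂ (surj (f x))))
    (expands g g-mono (toℕ (f x)) (f x) refl)

wordGraph-injective : ∀ {n} (w w′ : Word n) → wordGraph w ≅ wordGraph w′ → w ≡ w′
wordGraph-injective w w′ i = pairsᵒ-injective w w′ initial
  ( (λ p → include w w′ p (λ {e} e∈ → Equivalence.to (preservesEdges e) (subst (_∈ wordEdges w) (sym (fixed e)) e∈)))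
  , (λ p → include w′ w p (λ {e} e∈ → subst (_∈ wordEdges w) (fixed e) (Equivalence.from (preservesEdges e) e∈))))
  where
  open _≅_ i renaming (to to f)
  module I = IsOrderIsomorphism isOrderIsomorphism
  fixed : ∀ e → trace f e ≡ e
  fixed e = trans (Vec.tabulate-cong (λ x → cong (Vec.lookup e)
    (strictlyMonotone⇒id f I.mono (λ y → let x , h = I.surjective y in x , h refl) x))) (trace-id e)
  include : ∀ {n} (v v′ : Word n) {x y} → (x , y) ∈ pairs v → (∀ {e} → e ∈ wordEdges v → e ∈ wordEdges v′) → (x , y) ∈ pairs v′
  include v v′ p sub with wordEdges⁻ v′ (sub (∈-map⁺ pairEdge p))
  ... | x′ , y′ , q , eq = subst (_∈ pairs v′) (sym (pairEdge-injective (pairs-increasing v p) (pairs-increasing v′ q) eq)) q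

-- Asymptotics of minSpeed

nCk≤2^n : ∀ n k → n choose k ≤ 2 ^ n
nCk≤2^n zero zero = ≤-refl
nCk≤2^n zero (suc k) = ≤-trans (≤-reflexive (k>n⇒nCk≡0 {0} {suc k} z<s)) z≤n
nCk≤2^n (suc n) zero = ≤-trans (≤-reflexive (nC0≡1 (suc n))) (m^n>0 2 (suc n))
nCk≤2^n (suc n) (suc k) = begin
  suc n choose suc k ≡⟨ sym (nCk+nC[k+1]≡[n+1]C[k+1] n k) ⟩
  (n choose k) + (n choose suc k) ≤⟨ +-mono-≤ (nCk≤2^n n k) (nCk≤2^n n (suc k)) ⟩
  2 ^ n + 2 ^ n ≡⟨ cong (2 ^ n +_) (sym (+-identityʳ (2 ^ n))) ⟩
  2 ^ suc n ∎
  where open ≤-Reasoning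

nCk>0 : ∀ {n k} → k ≤ n → 0 < n choose k
nCk>0 {n} {zero} _ = ≤-reflexive (sym (nC0≡1 n))
nCk>0 {suc n} {suc k} (s≤s k≤n) = ≤-trans (≤-trans (nCk>0 k≤n) (m≤m+n (n choose k) (n choose suc k))) (≤-reflexive (nCk+nC[k+1]≡[n+1]C[k+1] n k))

n!≤n^n : ∀ n → n ! ≤ n ^ n
n!≤n^n zero    = ≤-refl
n!≤n^n (suc n) = *-monoʳ-≤ (suc n) (≤-trans (n!≤n^n n) (^-monoˡ-≤ n (n≤1+n n)))

n<2^n : ∀ n → n < 2 ^ n
n<2^n zero = z<s
n<2^n (suc n) = begin-strict
  suc n <⟨ s<s (n<2^n n) ⟩
  1 + 2 ^ n ≤⟨ +-mono-≤ (m^n>0 2 n) (m≤m+n (2 ^ n) 0) ⟩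
  2 ^ n + (2 ^ n + 0) ∎
  where open ≤-Reasoning

∑-≤ : ∀ B (f : ℕ → ℕ) M → (∀ j → j < B → f j ≤ M) → ∑ B f ≤ B * M
∑-≤ zero    f M h = z≤n
∑-≤ (suc B) f M h = +-mono-≤ (h 0 z<s) (∑-≤ B (f ∘ suc) M (λ j j< → h (suc j) (s<s j<)))

term≤∑ : ∀ {B} (f : ℕ → ℕ) {j} → j < B → f j ≤ ∑ B f
term≤∑ {suc B} f {zero}  _        = m≤m+n (f 0) _
term≤∑ {suc B} f {suc j} (s<s j<) = ≤-trans (term≤∑ (f ∘ suc) j<) (m≤n+m _ (f 0))

2⌊n/2⌋≤n : ∀ n → 2 * ⌊ n /2⌋ ≤ n
2⌊n/2⌋≤n zero = z≤n
2⌊n/2⌋≤n (suc zero) = z≤n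
2⌊n/2⌋≤n (suc (suc n)) = ≤-trans (≤-reflexive (shift 0 ⌊ n /2⌋)) (s≤s (s≤s (2⌊n/2⌋≤n n)))

n≤1+2⌊n/2⌋ : ∀ n → n ≤ 1 + 2 * ⌊ n /2⌋
n≤1+2⌊n/2⌋ n = ≤-pred (subst (n <_) (shift 0 ⌊ n /2⌋) (n<2[1+⌊n/2⌋] n))

^-distribʳ-* : ∀ a b k → (a * b) ^ k ≡ a ^ k * b ^ k
^-distribʳ-* a b zero = refl
^-distribʳ-* a b (suc k) = trans (cong (a * b *_) (^-distribʳ-* a b k)) (lem a b (a ^ k) (b ^ k))
  where
  lem : ∀ a b c d → a * b * (c * d) ≡ a * c * (b * d)
  lem = solve-∀

^-comm : ∀ a b c → (a ^ b) ^ c ≡ (a ^ c) ^ b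
^-comm a b c = trans (^-*-assoc a b c) (trans (cong (a ^_) (*-comm b c)) (sym (^-*-assoc a c b)))

-- Squaring avoids half-integral exponents. One factor 2 ^ n bounds the number of summands, another
-- the binomial coefficients; squared, they give 16 ^ n.
minSpeed-upper : ∀ n → 0 < n → minSpeed n ^ 2 ≤ 16 ^ n * n ^ n
minSpeed-upper n@(suc _) _ = begin
  minSpeed n ^ 2 ≤⟨ ^-monoˡ-≤ 2 bound ⟩
  (2 ^ n * (2 ^ n * n ^ j)) ^ 2 ≡⟨ square (2 ^ n) (n ^ j) ⟩
  (2 ^ n) ^ 4 * (n ^ j) ^ 2 ≡⟨ cong₂ _*_ (^-comm 2 n 4) (trans (^-*-assoc n j 2) (cong (n ^_) (*-comm j 2))) ⟩
  16 ^ n * n ^ (2 * j) ≤⟨ *-monoʳ-≤ (16 ^ n) (^-monoʳ-≤ n (2⌊n/2⌋≤n n)) ⟩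
  16 ^ n * n ^ n ∎
  where
  open ≤-Reasoning
  j = ⌊ n /2⌋
  square : ∀ a b → (a * (a * b)) * ((a * (a * b)) * 1) ≡ (a * (a * (a * (a * 1)))) * (b * (b * 1))
  square = solve-∀
  summand : ∀ k → k < suc j → term n 0 k ≤ 2 ^ n * n ^ j
  summand k (s≤s k≤j) = *-mono-≤ (nCk≤2^n n (2 * k)) (≤-trans (n!≤n^n k)
    (≤-trans (^-monoˡ-≤ k (≤-trans k≤j (⌊n/2⌋≤n n))) (^-monoʳ-≤ n k≤j)))
  bound : minSpeed n ≤ 2 ^ n * (2 ^ n * n ^ j)
  bound = ≤-trans (≤-reflexive (minSpeed≡∑ n)) (≤-trans (∑-≤ (suc j) (term n 0) _ summand)
    (*-monoˡ-≤ (2 ^ n * n ^ j) (≤-trans (s≤s (⌊n/2⌋≤n n)) (n<2^n n))))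

-- Both sides of n^n ≤ 4^n n! are compared with (2n)! / n!.
n^n≤4^n*n! : ∀ n → n ^ n ≤ 4 ^ n * n !
n^n≤4^n*n! n = *-cancelʳ-≤ (n ^ n) (4 ^ n * n !) (n !) {{n !≢0}}
  (≤-trans (power-below n n) (≤-trans (≤-reflexive (cong _! (cong (n +_) (sym (+-identityʳ n))))) (central n)))
  where
  power-below : ∀ i j → j ^ i * j ! ≤ (i + j) !
  power-below zero j = ≤-reflexive (+-identityʳ (j !))
  power-below (suc i) j = ≤-trans (≤-reflexive (*-assoc j (j ^ i) (j !))) (*-mono-≤ (≤-trans (m≤n+m j i) (n≤1+n (i + j))) (power-below i j))
  rearrange : ∀ k x f → (2 + 2 * k) * ((2 + 2 * k) * (x * f * f)) ≡ 4 * x * ((1 + k) * f) * ((1 + k) * f)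
  rearrange = solve-∀
  central : ∀ k → (2 * k) ! ≤ 4 ^ k * k ! * k !
  central zero = ≤-refl
  central (suc k) = begin
    (2 * suc k) ! ≡⟨ cong _! (shift 0 k) ⟩
    (2 + 2 * k) * ((1 + 2 * k) * (2 * k) !) ≤⟨ *-monoʳ-≤ (2 + 2 * k) (*-mono-≤ (n≤1+n (1 + 2 * k)) (central k)) ⟩
    (2 + 2 * k) * ((2 + 2 * k) * (4 ^ k * k ! * k !)) ≡⟨ rearrange k (4 ^ k) (k !) ⟩
    4 ^ suc k * suc k ! * suc k ! ∎
    where open ≤-Reasoning

-- The last summand is at least j ! for j = ⌊n/2⌋. From n ≤ 3 * j and j ^ j ≤ 4 ^ j * j ! follows n
-- ^ j ≤ 12 ^ j * j !, and 144 is the square of 12; the factor n accounts for odd n.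
minSpeed-lower : ∀ n → 2 ≤ n → n ^ n ≤ n * (144 ^ n * minSpeed n ^ 2)
minSpeed-lower n@(suc (suc n-2)) (s≤s (s≤s _)) = begin
  n ^ n ≤⟨ ^-monoʳ-≤ n (n≤1+2⌊n/2⌋ n) ⟩
  n * n ^ (2 * j) ≡⟨ cong (n *_) (trans (cong (n ^_) (*-comm 2 j)) (sym (^-*-assoc n j 2))) ⟩
  n * (n ^ j) ^ 2 ≤⟨ *-monoʳ-≤ n (^-monoˡ-≤ 2 root) ⟩
  n * (12 ^ j * minSpeed n) ^ 2 ≡⟨ cong (n *_) (trans (^-distribʳ-* (12 ^ j) (minSpeed n) 2) (cong (_* minSpeed n ^ 2) (^-comm 12 j 2))) ⟩
  n * (144 ^ j * minSpeed n ^ 2) ≤⟨ *-monoʳ-≤ n (*-monoˡ-≤ (minSpeed n ^ 2) (^-monoʳ-≤ 144 (⌊n/2⌋≤n n))) ⟩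
  n * (144 ^ n * minSpeed n ^ 2) ∎
  where
  open ≤-Reasoning
  j = ⌊ n /2⌋
  n≤3j : n ≤ 3 * j
  n≤3j = ≤-trans (n≤1+2⌊n/2⌋ n) (+-monoˡ-≤ (2 * j) {1} {j} (s≤s z≤n))
  j!≤ : j ! ≤ minSpeed n
  j!≤ = begin
    j ! ≡⟨ sym (+-identityʳ (j !)) ⟩
    1 * j ! ≤⟨ *-monoˡ-≤ (j !) (nCk>0 (2⌊n/2⌋≤n n)) ⟩
    term n 0 j ≤⟨ term≤∑ (term n 0) (n<1+n j) ⟩
    ∑ (suc j) (term n 0) ≡⟨ sym (minSpeed≡∑ n) ⟩
    minSpeed n ∎
  root : n ^ j ≤ 12 ^ j * minSpeed n
  root = begin
    n ^ j ≤⟨ ^-monoˡ-≤ j n≤3j ⟩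
    (3 * j) ^ j ≡⟨ ^-distribʳ-* 3 j j ⟩
    3 ^ j * j ^ j ≤⟨ *-monoʳ-≤ (3 ^ j) (n^n≤4^n*n! j) ⟩
    3 ^ j * (4 ^ j * j !) ≡⟨ trans (sym (*-assoc (3 ^ j) (4 ^ j) (j !))) (cong (_* j !) (sym (^-distribʳ-* 3 4 j))) ⟩
    12 ^ j * j ! ≤⟨ *-monoʳ-≤ (12 ^ j) j!≤ ⟩
    12 ^ j * minSpeed n ∎

abstract
  minSpeed-asymptotics : minSpeed ≈n^⟨n/2+o[n]⟩
  -- For n ≥ m the factor n ^ m, and for n ≥ 144 ^ m the factor (144 ^ n) ^ m, is at most n ^ n;
  -- together they make up the error n ^ (2 * n).
  minSpeed-asymptotics m = 2 + (m + 144 ^ m) , λ n n₀≤n → bounds n (≤-trans (m≤m+n 2 _) n₀≤n)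
      (≤-trans (m≤m+n m (144 ^ m)) (≤-trans (m≤n+m (m + 144 ^ m) 2) n₀≤n))
      (≤-trans (m≤n+m (144 ^ m) m) (≤-trans (m≤n+m (m + 144 ^ m) 2) n₀≤n))
    where
    open ≤-Reasoning
    power : ∀ a {b} n → b ^ m ≤ n → (b ^ n) ^ m * a ≤ n ^ n * a
    power a {b} n h = *-monoˡ-≤ a (≤-trans (≤-reflexive (^-comm b n m)) (^-monoˡ-≤ n h))
    rearrange : ∀ a b c → a * (b * c) ≡ c * (b * a)
    rearrange = solve-∀
    bounds : ∀ n → 2 ≤ n → m ≤ n → 144 ^ m ≤ n →
             (n ^ (m * n) ≤ minSpeed n ^ (2 * m) * n ^ (2 * n)) × (minSpeed n ^ (2 * m) ≤ n ^ (m * n + 2 * n))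
    bounds n@(suc _) 2≤n m≤n 144^m≤n = lower-bound , upper-bound
      where
      lower-bound : n ^ (m * n) ≤ minSpeed n ^ (2 * m) * n ^ (2 * n)
      lower-bound = begin
        n ^ (m * n) ≡⟨ trans (cong (n ^_) (*-comm m n)) (sym (^-*-assoc n n m)) ⟩
        (n ^ n) ^ m ≤⟨ ^-monoˡ-≤ m (minSpeed-lower n 2≤n) ⟩
        (n * (144 ^ n * minSpeed n ^ 2)) ^ m ≡⟨ trans (^-distribʳ-* n _ m) (cong (n ^ m *_) (^-distribʳ-* (144 ^ n) (minSpeed n ^ 2) m)) ⟩
        n ^ m * ((144 ^ n) ^ m * (minSpeed n ^ 2) ^ m) ≤⟨ *-mono-≤ (^-monoʳ-≤ n m≤n) (power ((minSpeed n ^ 2) ^ m) {144} n 144^m≤n) ⟩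
        n ^ n * (n ^ n * (minSpeed n ^ 2) ^ m) ≡⟨ rearrange (n ^ n) (n ^ n) ((minSpeed n ^ 2) ^ m) ⟩
        (minSpeed n ^ 2) ^ m * (n ^ n * n ^ n)
          ≡⟨ cong₂ _*_ (^-*-assoc (minSpeed n) 2 m) (trans (sym (^-distribˡ-+-* n n n)) (cong (λ z → n ^ (n + z)) (sym (+-identityʳ n)))) ⟩
        minSpeed n ^ (2 * m) * n ^ (2 * n) ∎
      upper-bound : minSpeed n ^ (2 * m) ≤ n ^ (m * n + 2 * n)
      upper-bound = begin
        minSpeed n ^ (2 * m) ≡⟨ sym (^-*-assoc (minSpeed n) 2 m) ⟩
        (minSpeed n ^ 2) ^ m ≤⟨ ^-monoˡ-≤ m (minSpeed-upper n z<s) ⟩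
        (16 ^ n * n ^ n) ^ m ≡⟨ ^-distribʳ-* (16 ^ n) (n ^ n) m ⟩
        (16 ^ n) ^ m * (n ^ n) ^ m ≤⟨ power ((n ^ n) ^ m) {16} n (≤-trans (^-monoˡ-≤ m (m≤m+n 16 128)) 144^m≤n) ⟩
        n ^ n * (n ^ n) ^ m ≡⟨ cong (n ^ n *_) (^-*-assoc n n m) ⟩
        n ^ n * n ^ (n * m) ≤⟨ *-monoˡ-≤ (n ^ (n * m)) (^-monoʳ-≤ n (m≤m+n n (n + 0))) ⟩
        n ^ (2 * n) * n ^ (n * m) ≡⟨ sym (^-distribˡ-+-* n (2 * n) (n * m)) ⟩
        n ^ (2 * n + n * m) ≡⟨ cong (n ^_) (trans (+-comm (2 * n) (n * m)) (cong (_+ 2 * n) (*-comm n m))) ⟩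
        n ^ (m * n + 2 * n) ∎

-- If minSpeed n ≤ d ^ n, the asymptotics for m = 4 give n ^ (2 * n) ≤ (d ^ 4) ^ (2 * n) after
-- cancellation, which fails for n > d ^ 4.
minSpeed-superexponential : ∀ d → ∃[ n ] d ^ n < minSpeed n
minSpeed-superexponential d = n , ≰⇒> (λ le → contradiction (absurd le) (<⇒≱ (^-monoˡ-< (2 * n) (s≤s (m≤n+m (d ^ 4) n₀)))))
  where
  open ≤-Reasoning
  n₀ = proj₁ (minSpeed-asymptotics 4)
  n = suc (n₀ + d ^ 4)
  rearrange : ∀ n → n * 4 ≡ 2 * n + 2 * n
  rearrange = solve-∀
  absurd : minSpeed n ≤ d ^ n → n ^ (2 * n) ≤ (d ^ 4) ^ (2 * n)
  absurd le = *-cancelʳ-≤ (n ^ (2 * n)) ((d ^ 4) ^ (2 * n)) (n ^ (2 * n)) {{m^n≢0 n (2 * n)}} (begin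
    n ^ (2 * n) * n ^ (2 * n) ≡⟨ trans (sym (^-distribˡ-+-* n (2 * n) (2 * n))) (cong (n ^_) (trans (sym (rearrange n)) (*-comm n 4))) ⟩
    n ^ (4 * n) ≤⟨ proj₁ (proj₂ (minSpeed-asymptotics 4) n (≤-trans (m≤m+n n₀ (d ^ 4)) (n≤1+n _))) ⟩
    minSpeed n ^ 8 * n ^ (2 * n) ≤⟨ *-monoˡ-≤ (n ^ (2 * n)) (^-monoˡ-≤ 8 le) ⟩
    (d ^ n) ^ 8 * n ^ (2 * n) ≡⟨ cong (_* n ^ (2 * n)) (trans (^-*-assoc d n 8) (trans (cong (d ^_) (exponents n)) (sym (^-*-assoc d 4 (2 * n))))) ⟩
    (d ^ 4) ^ (2 * n) * n ^ (2 * n) ∎)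
    where
    exponents : ∀ n → n * 8 ≡ 4 * (2 * n)
    exponents = solve-∀

-- Exchanging the two ends of every pair gives an involution π such that the
-- matching embeds in H⟨ π ⟩: vertices before the first right endpoint go to the
-- left copy of the vertex set and the others to the right copy.
module Completion {n : ℕ} {M : Fin n → Fin n → Set} (M? : ∀ x y → Dec (M x y)) (cm : CrossingMatching M) where
  open CrossingMatching cm

  Linked : Fin n → Fin n → Set
  Linked x y = M x y ⊎ M y x

  linked? : ∀ x y → Dec (Linked x y)
  linked? x y = M? x y ⊎-dec M? y x

  linked-functional : ∀ {x y y′} → Linked x y → Linked x y′ → y ≡ y′
  linked-functional (inj₁ p) (inj₁ q) = functional p q
  linked-functional (inj₁ p) (inj₂ q) = contradiction (crossing p q) (<-irrefl refl)
  linked-functional (inj₂ p) (inj₁ q) = contradiction (crossing q p) (<-irrefl refl)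
  linked-functional (inj₂ p) (inj₂ q) = injective p q

  linked-sym : ∀ {x y} → Linked x y → Linked y x
  linked-sym (inj₁ p) = inj₂ p
  linked-sym (inj₂ p) = inj₁ p

  partner : Fin n → Fin n
  partner x with Fin.any? (linked? x)
  ... | yes (y , _) = y
  -- Unmatched vertices become fixed points; the sub-hypergraph leaves out their edges.
  ... | no  _       = x

  partner-linked : ∀ {x y} → Linked x y → partner x ≡ y
  partner-linked {x} {y} l with Fin.any? (linked? x)
  ... | yes (_ , l′) = linked-functional l′ l
  ... | no none      = contradiction (y , l) none

  partner-involutive : ∀ x → partner (partner x) ≡ x
  partner-involutive x = helper (Fin.any? (linked? x))
    where
    helper : Dec (∃[ y ] Linked x y) → partner (partner x) ≡ x
    helper (yes (y , l)) = trans (cong partner (partner-linked l)) (partner-linked (linked-sym l))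
    helper (no none) = trans (cong partner fixed) fixed
      where
      fixed : partner x ≡ x
      fixed with Fin.any? (linked? x)
      ... | yes l = contradiction l none
      ... | no _ = refl

  involution : Permutation′ n
  involution = Perm.permutation partner partner partner-involutive partner-involutive

  Right : Fin n → Set
  Right x = ∃[ u ] ∃[ v ] M u v × v Fin.≤ x

  right? : ∀ x → Dec (Right x)
  right? x = Fin.any? (λ u → Fin.any? (λ v → M? u v ×-dec (v Fin.≤? x)))

  place : ∀ x → Dec (Right x) → Fin (n + n)
  place x (yes _) = n ↑ʳ x
  place x (no _)  = x ↑ˡ n

  ι : Fin n → Fin (n + n)
  ι x = place x (right? x)

  ι-right : ∀ {x} → Right x → ι x ≡ n ↑ʳ x
  ι-right {x} r with right? x
  ... | yes _ = refl
  ... | no ¬r = contradiction r ¬r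

  ι-left : ∀ {x} → ¬ Right x → ι x ≡ x ↑ˡ n
  ι-left {x} ¬r with right? x
  ... | yes r = contradiction r ¬r
  ... | no _ = refl

  ι-mono : ∀ {x y} → x Fin.< y → ι x Fin.< ι y
  ι-mono {x} {y} x<y with right? x | right? y
  ... | yes _ | yes _ = subst₂ _<_ (sym (Fin.toℕ-↑ʳ n x)) (sym (Fin.toℕ-↑ʳ n y)) (+-monoʳ-< n x<y)
  ... | yes (u , v , m , v≤x) | no ¬r = contradiction (u , v , m , ≤-trans v≤x (<⇒≤ x<y)) ¬r
  ... | no _ | yes _ = subst₂ _<_ (sym (Fin.toℕ-↑ˡ x n)) (sym (Fin.toℕ-↑ʳ n y)) (<-≤-trans (Fin.toℕ<n x) (m≤m+n n (toℕ y)))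
  ... | no _ | no _ = subst₂ _<_ (sym (Fin.toℕ-↑ˡ x n)) (sym (Fin.toℕ-↑ˡ y n)) x<y

  ι-monomorphism : IsOrderMonomorphism _≡_ _≡_ Fin._<_ Fin._<_ ι
  ι-monomorphism = strictlyMonotone⇒monomorphism Fin.<-isStrictTotalOrder Fin.<-isStrictTotalOrder ι-mono

  trace-matchingEdge : ∀ {x y} → M x y → pairEdge (x , y) ≡ trace ι (matchingEdge involution x)
  trace-matchingEdge {x} {y} m = trans (subset-ext into out) (cong (trace ι) (sym matched))
    where
    matched : matchingEdge involution x ≡ pairEdge (ι x , ι y)
    matched = cong₂ (λ a b → pairEdge (a , b))
      -- A left end precedes every right end, so x goes to the left copy; y is itself a right end
      -- and goes to the right copy.
      (sym (ι-left (λ (u , v , m′ , v≤x) → contradiction (crossing m m′) (≤⇒≯ v≤x))))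
      (trans (cong (n ↑ʳ_) (partner-linked (inj₁ m))) (sym (ι-right (x , y , m , ≤-refl))))
    into : ∀ {z} → pairEdge (x , y) ∋ᶠ z → trace ι (pairEdge (ι x , ι y)) ∋ᶠ z
    into {z} h = trans (lookup-trace ι (pairEdge (ι x , ι y)) z) (case pair∋⁻ x y {z} h of λ
      { (inj₁ refl) → pair∋ˡ (ι x) (ι y) ; (inj₂ refl) → pair∋ʳ (ι x) (ι y) })
    out : ∀ {z} → trace ι (pairEdge (ι x , ι y)) ∋ᶠ z → pairEdge (x , y) ∋ᶠ z
    out {z} h with pair∋⁻ (ι x) (ι y) {ι z} (trans (sym (lookup-trace ι (pairEdge (ι x , ι y)) z)) h)
    ... | inj₁ eq = subst (pairEdge (x , y) ∋ᶠ_) (sym (IsOrderMonomorphism.injective ι-monomorphism eq)) (pair∋ˡ x y)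
    ... | inj₂ eq = subst (pairEdge (x , y) ∋ᶠ_) (sym (IsOrderMonomorphism.injective ι-monomorphism eq)) (pair∋ʳ x y)

module _ {n : ℕ} (w : Word n) where
  private
    M? : ∀ x y → Dec (PairRel (pairs w) x y)
    M? x y = member? (Product.≡-dec Fin._≟_ Fin._≟_) (x , y) (pairs w)
    module C = Completion M? (word-matching w)

  completion : Permutation′ n
  completion = C.involution

  wordGraph-⊑ : wordGraph w ⊑ H⟨ completion ⟩
  wordGraph-⊑ = wordGraph w , (λ _ _ → mk⇔ id id) , sub , wordEdges w , wordEdges w , ↭-refl , ↭-refl , self (wordEdges w)
    where
    self : ∀ fs → Pointwise (_⊆_ {n}) fs fs
    self []       = []
    self (f ∷ fs) = id ∷ self fs
    sub : SubHypergraph (wordGraph w) H⟨ C.involution ⟩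
    sub = record
      { ι = C.ι
      ; isOrderMonomorphism = C.ι-monomorphism
      ; isTrace = λ f∈ → let x , y , p , eq = wordEdges⁻ w f∈ in
          matchingEdge C.involution x , ∈-tabulate⁺ x , trans eq (C.trace-matchingEdge p)
      }

-- The lower bound, the extremal property and its uniqueness

module _ {ℓ} {P : Class ℓ} (SM : StronglyMonotoneProperty P) (SE : SuperExponential P) where
  open StronglyMonotoneProperty SM

  word∈ : ∀ {n} (w : Word n) → P n (wordGraph w)
  word∈ w = ⊑-closed (wordGraph-⊑ w) (superExponential⇒matching P SM SE (completion w))

  crossing∈ : ∀ {n} (G : OrderedHypergraph n) → Crossing G → P n G
  crossing∈ G c = let w , i = read-graph G c in isProperty i (word∈ w)

  minSpeed-many : ∀ n → ∣ (P ⟨ 1 , 2 ⟩) ▹ n ∣≥ minSpeed n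
  minSpeed-many n = record
    { to = λ i → wordGraph (E.to i) , word∈ (E.to i) , crossing-degree (wordGraph-crossing (E.to i))
               , All.tabulate (λ {e} e∈ → atMostTwo⇒≤2 e (λ {x} {y} {z} → Crossing.thin (wordGraph-crossing (E.to i)) e∈ {x} {y} {z}))
    ; cong = λ { refl → ≅-refl }
    ; injective = λ {i} {j} eq → trans (sym (E.inverseʳ refl)) (E.inverseʳ (wordGraph-injective (E.to i) (E.to j) eq))
    }
    where module E = Inverse (enumerate n)

CrossingClass : ∀ ℓ → Class ℓ
CrossingClass ℓ n G = Lift ℓ (Crossing G)

crossingClass-monotone : ∀ ℓ → StronglyMonotoneProperty (CrossingClass ℓ)
crossingClass-monotone ℓ = record
  { isProperty = λ i (lift c) → lift (crossing-≅ i c)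
  ; ⊑-closed = λ K⊑H (lift c) → lift (crossing-⊑ K⊑H c)
  }

crossingClass-speed : ∀ ℓ n → ∣ CrossingClass ℓ ▹ n ∣≈ minSpeed n
crossingClass-speed ℓ n = record
  { to = λ i → wordGraph (E.to i) , lift (wordGraph-crossing (E.to i))
  ; from = from
  ; to-cong = λ { refl → ≅-refl }
  ; from-cong = λ {G} {H} i → cong E.from (wordGraph-injective (word G) (word H) (≅-trans (iso G) (≅-trans i (≅-sym (iso H)))))
  ; inverse = (λ { {G} refl → subst (λ w → wordGraph w ≅ proj₁ G) (sym (E.inverseˡ refl)) (iso G) })
            , (λ {i} {G} eq → E.inverseʳ (wordGraph-injective (word G) (E.to i) (≅-trans (iso G) eq)))
  }
  where
  module E = Inverse (enumerate n)
  word : Σ (OrderedHypergraph n) (CrossingClass ℓ n) → Word n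
  word (G , lift c) = proj₁ (read-graph G c)
  iso : ∀ G → wordGraph (word G) ≅ proj₁ G
  iso (G , lift c) = proj₂ (read-graph G c)
  from : Σ (OrderedHypergraph n) (CrossingClass ℓ n) → Fin (minSpeed n)
  from G = E.from (word G)

numerator-bound : ∀ (c : ℚ) → 0ℚ ℚ.< c → c ℚ.≤ ofℕ ℤ.∣ ℚ.numerator c ∣
numerator-bound c@(ℚ.mkℚ (ℤ.+ a) b-1 _) _ = ℚ.toℚᵘ-cancel-≤ (ℚᵘ.≤-respʳ-≃ (ℚᵘ.≃-sym (toℚᵘ-ofℕ a))
  (ℚᵘ.*≤* (subst₂ ℤ._≤_ (sym (ℤ.*-identityʳ (ℤ.+ a))) (ℤ.pos-* a (suc b-1)) (ℤ.+≤+ (m≤m*n a (suc b-1))))))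
numerator-bound (ℚ.mkℚ ℤ.-[1+ _ ] _ _) (ℚ.*<* ())

^ℚ-monoˡ : ∀ c d → 0ℚ ℚ.< c → c ℚ.≤ ofℕ d → ∀ n → c ^ℚ n ℚ.≤ ofℕ (d ^ n)
^ℚ-monoˡ c d 0<c c≤d zero = ℚ.≤-refl
^ℚ-monoˡ c d 0<c c≤d (suc n) = ℚ.≤-trans
  (ℚ.*-monoˡ-≤-nonNeg c {{ℚ.nonNegative (ℚ.<⇒≤ 0<c)}} (^ℚ-monoˡ c d 0<c c≤d n))
  (ℚ.≤-trans (ℚ.*-monoʳ-≤-nonNeg (ofℕ (d ^ n)) {{ℚ.nonNegative (ofℕ-nonneg (d ^ n))}} c≤d) (ℚ.≤-reflexive (ofℕ-* d (d ^ n))))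
  where
  ofℕ-nonneg : ∀ a → 0ℚ ℚ.≤ ofℕ a
  ofℕ-nonneg zero = ℚ.≤-refl
  ofℕ-nonneg (suc a) = ℚ.<⇒≤ (ofℕ-mono-< {0} {suc a} z<s)

-- Makes the lower bound, and with it all crossing matchings, available in any strongly monotone
-- property of this speed.
minSpeed⇒superExponential : ∀ {ℓ} {P : Class ℓ} → (∀ n → ∣ P ▹ n ∣≈ minSpeed n) → SuperExponential P
minSpeed⇒superExponential {P = P} speed c 0<c =
  let d = ℤ.∣ ℚ.numerator c ∣ ; n , lt = minSpeed-superexponential d in
  n , minSpeed n , ℚ.≤-<-trans (^ℚ-monoˡ c d 0<c (numerator-bound c 0<c) n) (ofℕ-mono-< lt) , injection n
  where
  injection : ∀ n → ∣ P ▹ n ∣≥ minSpeed n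
  injection n = record
    { to = S.to ; cong = S.to-cong
    ; injective = λ {i} {j} eq → trans (sym (S.inverseʳ {i} {S.to i} (≅-refl {G = proj₁ (S.to i)}))) (trans (S.from-cong eq) (S.inverseʳ {j} {S.to j} (≅-refl {G = proj₁ (S.to j)}))) }
    where module S = Inverse (speed n)

-- P contains the crossing matchings, and already these are minSpeed n many.
crossingClass-unique : ∀ {ℓ} {P : Class ℓ} → StronglyMonotoneProperty P → (∀ n → ∣ P ▹ n ∣≈ minSpeed n) → CrossingClass ℓ ≐ᶜ P
crossingClass-unique {ℓ} {P} SM speed n = (λ {G} (lift c) → crossing∈ SM SE G c) , λ {G} p → lift (crossing G p)
  where
  SE : SuperExponential P
  SE = minSpeed⇒superExponential speed
  module E = Inverse (enumerate n)
  module S = Inverse (speed n)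
  graph : Fin (minSpeed n) → Σ (OrderedHypergraph n) (P n)
  graph i = wordGraph (E.to i) , word∈ SM SE (E.to i)
  from-injective : ∀ {G H} → S.from G ≡ S.from H → proj₁ G ≅ proj₁ H
  from-injective {G} {H} eq = ≅-trans (≅-sym (S.inverseˡ {G} {S.from G} refl)) (S.inverseˡ {H} {S.from G} eq)
  graph-injective : ∀ {i j} → S.from (graph i) ≡ S.from (graph j) → i ≡ j
  graph-injective {i} {j} eq = trans (sym (E.inverseʳ refl))
    (E.inverseʳ (wordGraph-injective (E.to i) (E.to j) (from-injective {graph i} {graph j} eq)))
  crossing : ∀ G → P n G → Crossing G
  -- An injective self-map of a finite set is onto, so every member of `P` on n vertices is
  -- isomorphic to a word graph.
  crossing G p = let i , eq = injective⇒surjective (S.from ∘ graph) graph-injective (S.from (G , p)) in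
    crossing-≅ (from-injective {graph i} {G , p} eq) (wordGraph-crossing (E.to i))

theorem1 : ∀ {ℓ} →
    (∀ (P : Class ℓ) → StronglyMonotoneProperty P → SuperExponential P →
       (∀ (k : ℕ) (π : Permutation′ k) → P (k + k) H⟨ π ⟩)
       × (∀ (n : ℕ) →
            ∣ P ▹ n ∣≥∣ (P ⟨ 1 , 2 ⟩) ▹ n ∣
            × ∣ (P ⟨ 1 , 2 ⟩) ▹ n ∣≥ minSpeed n))
    × minSpeed ≈n^⟨n/2+o[n]⟩
    × (∃[ Q ] StronglyMonotoneProperty {ℓ} Q
              × SuperExponential Q
              × (∀ (n : ℕ) → ∣ Q ▹ n ∣≈ minSpeed n))
    × (∃! _≐ᶜ_ λ (Q : Class ℓ) →
         StronglyMonotoneProperty Q × (∀ (n : ℕ) → ∣ Q ▹ n ∣≈ minSpeed n))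
theorem1 {ℓ} =
  (λ P SM SE → (λ k π → superExponential⇒matching P SM SE π)
             , λ n → record { to = λ (G , p , _) → G , p ; cong = id ; injective = id } , minSpeed-many SM SE n)
  , minSpeed-asymptotics
  , (CrossingClass ℓ , crossingClass-monotone ℓ , minSpeed⇒superExponential (crossingClass-speed ℓ) , crossingClass-speed ℓ)
  , CrossingClass ℓ , (crossingClass-monotone ℓ , crossingClass-speed ℓ) , λ (SM , speed) → crossingClass-unique SM speed
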